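{- Let $n\geq 2$ and let $\alpha_1,\dots,\alpha_n$ be equipotent infinite ordinals, of common cardinality $\kappa$ (viewed as an initial ordinal). For each $i$ let $\alpha_i=\kappa\cdot q_i+r_i$ with $r_i<\kappa$ be the Euclidean division of $\alpha_i$ by $\kappa$. Then the ordinal \[ \kappa\cdot\bigotimes_{1\leq i\leq n}q_i+\Big|\sum_{1\leq i\leq n}r_i\Big|^+ \] is the least strict upper bound (the least ordinal strictly greater than every element) of the class of lengths $\ell(X,\leq)$ of posets $(X,\leq)$ whose ordering $\leq$ is the intersection of $n$ orderings $\leq_1,\dots,\leq_n$ on $X$ such that each $(X,\leq_i)$ is a WPO of length $\alpha_i$. Moreover, this least strict upper bound is unchanged if each ordering $\leq_i$ is in addition required to be linear (so that $(X,\leq_i)$ is a well order of type $\alpha_i$).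
   Context: Orderings are partial orders, seen as sets of ordered pairs; the intersection of orderings on the same set $X$ is their set-theoretic intersection. A poset is well partially ordered (WPO) if it is well founded and has no infinite antichain; equivalently all its linear extensions are well orders. The length $\ell(\mathbf p)$ of a WPO $\mathbf p$ is the largest ordinal type of a linear extension of $\mathbf p$ (the maximum exists by de Jongh–Parikh); for a well order it is its order type. An intersection of finitely many WPO orderings on a set is again WPO. $\otimes$ denotes the Hessenberg (natural) product of ordinals; $+$ and $\cdot$ are the usual ordinal sum and product, with $\kappa\cdot q$ being the type of $q$ successive copies of $\kappa$. For an ordinal $\rho$, $|\rho|$ denotes its cardinality (as the least ordinal equipotent to it); an ordinal is initial if $|\rho|=\rho$ (all finite ordinals are initial), and $|\rho|^+$ denotes the least initial ordinal greater than $\rho$. -}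

module Defs where

open import Level using (Level; _⊔_) renaming (suc to lsuc)
open import Data.Empty.Polymorphic using (⊥)
open import Data.Fin.Base using (Fin)
open import Data.List.Base using (List; map; cartesianProductWith)
import Data.List.Base as List
open import Data.List.Relation.Unary.Linked using (Linked)
open import Data.Maybe.Base using (Maybe; maybe)
open import Data.Nat.Base using (ℕ; zero; suc)
open import Data.Product.Base using (∃; Σ-syntax; ∃-syntax; _×_; _,_; proj₁)
open import Data.Sum.Base using (_⊎_; [_,_])
open import Data.Unit.Polymorphic using (⊤)
open import Data.Vec.Functional using (Vector; head; tail; foldr)
open import Function.Base using (flip)
open import Function.Bundles using (Bijection; _⇔_)
open import Induction.WellFounded using (WellFounded; Acc; acc)
open import Relation.Binary.Bundles using (Setoid; Poset)
open import Relation.Binary.Core using (Rel; _⇒_)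
open import Relation.Binary.Definitions using (Total)
import Relation.Binary.Construct.NonStrictToStrict as ToStrict
open import Relation.Binary.PropositionalEquality.Core using (_≢_)
open import Relation.Binary.Structures using (IsEquivalence; IsPartialOrder; IsTotalOrder)
open import Relation.Nullary.Negation.Core using (¬_)

private variable
  ℓ p : Level
  n : ℕ

-- Ordinals.  `lsub I f` stands for the least strict upper bound of the family f,
-- so that, classically, every ordinal (von Neumann ordinal of the universe Set ℓ)
-- is represented.  Representations are not unique; the equality of ordinals is
-- _≈_ below.

data Ord (ℓ : Level) : Set (lsuc ℓ) where
  lsub : (I : Set ℓ) → (I → Ord ℓ) → Ord ℓ

infix 4 _≤_ _<_ _≈_
infixl 6 _+_ _⊕_
infixl 7 _·_

_≤_ : Ord ℓ → Ord ℓ → Set ℓ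
lsub I f ≤ lsub J g = ∀ i → ∃[ j ] f i ≤ g j

_<_ : Ord ℓ → Ord ℓ → Set ℓ
α < lsub J g = ∃[ j ] α ≤ g j

_≈_ : Ord ℓ → Ord ℓ → Set ℓ
α ≈ β = α ≤ β × β ≤ α

≤-refl : (α : Ord ℓ) → α ≤ α
≤-refl (lsub I f) i = i , ≤-refl (f i)

≤-trans : (α β γ : Ord ℓ) → α ≤ β → β ≤ γ → α ≤ γ
≤-trans (lsub I f) (lsub J g) (lsub K h) α≤β β≤γ i with α≤β i
... | j , fi≤gj with β≤γ j
...   | k , gj≤hk = k , ≤-trans (f i) (g j) (h k) fi≤gj gj≤hk

≈-isEquivalence : IsEquivalence (_≈_ {ℓ})
≈-isEquivalence = record
  { refl  = λ {α} → ≤-refl α , ≤-refl α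
  ; sym   = λ (α≤β , β≤α) → β≤α , α≤β
  ; trans = λ {α β γ} (α≤β , β≤α) (β≤γ , γ≤β) →
      ≤-trans α β γ α≤β β≤γ , ≤-trans γ β α γ≤β β≤α
  }

fin : ℕ → Ord ℓ
fin zero    = lsub ⊥ λ ()
fin (suc n) = lsub ⊤ λ _ → fin n

ω : Ord ℓ
ω {ℓ} = lsub (Level.Lift ℓ ℕ) λ k → fin (Level.lower k)

_+_ : Ord ℓ → Ord ℓ → Ord ℓ
lsub I f + lsub J g = lsub (I ⊎ J) [ f , (λ j → lsub I f + g j) ]

-- α · β is β successive copies of α.

_·_ : Ord ℓ → Ord ℓ → Ord ℓ
lsub I f · lsub J g = lsub (J × I) λ (j , i) → lsub I f · g j + f i

-- ω^ β is the least ordinal above 0 and above every ω^ β′ · k with β′ < β, k < ω.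

ω^ : Ord ℓ → Ord ℓ
ω^ (lsub J g) = lsub (Maybe (J × ℕ)) (maybe (λ (j , k) → ω^ (g j) · fin k) (fin 0))

-- Hessenberg (natural) sum.

_⊕_ : Ord ℓ → Ord ℓ → Ord ℓ
lsub I f ⊕ lsub J g =
  lsub (I ⊎ J) [ (λ i → f i ⊕ lsub J g) , (λ j → lsub I f ⊕ g j) ]

-- `as` lists the exponents of the Cantor normal form of α: a nonincreasing list,
-- with repetitions in place of integer coefficients.

IsCantorNormalForm : Ord ℓ → List (Ord ℓ) → Set (lsuc ℓ)
IsCantorNormalForm α as =
  Linked (flip _≤_) as × α ≈ List.foldr _+_ (fin 0) (map ω^ as)

-- Hessenberg (natural) product: the Cantor normal forms are multiplied as if they
-- were polynomials in ω, adding exponents naturally.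

IsNaturalProduct : Ord ℓ → Ord ℓ → Ord ℓ → Set (lsuc ℓ)
IsNaturalProduct α β γ = ∃[ as ] ∃[ bs ]
    IsCantorNormalForm α as
  × IsCantorNormalForm β bs
  × γ ≈ List.foldr _⊕_ (fin 0) (cartesianProductWith (λ a b → ω^ (a ⊕ b)) as bs)

data Is⨂ {ℓ} : Vector (Ord ℓ) n → Ord ℓ → Set (lsuc ℓ) where
  nil  : {α : Vector (Ord ℓ) zero} {γ : Ord ℓ} → γ ≈ fin 1 → Is⨂ α γ
  cons : {α : Vector (Ord ℓ) (suc n)} {β γ : Ord ℓ} →
         Is⨂ (tail α) β → IsNaturalProduct (head α) β γ → Is⨂ α γ

∑ : Vector (Ord ℓ) n → Ord ℓ
∑ = foldr _+_ (fin 0)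

IsLeast IsGreatest : (Ord ℓ → Set p) → Ord ℓ → Set (lsuc ℓ ⊔ p)
IsLeast    C α = C α × (∀ β → C β → α ≤ β)
IsGreatest C α = C α × (∀ β → C β → β ≤ α)

IsLeastStrictUpperBound : (Ord ℓ → Set p) → Ord ℓ → Set (lsuc ℓ ⊔ p)
IsLeastStrictUpperBound C = IsLeast λ σ → ∀ α → C α → α < σ

-- An ordinal as the set of all smaller ordinals (the index type of a
-- representation will not do: it need not enumerate all of them, and may repeat some).

Below : Ord ℓ → Setoid (lsuc ℓ) ℓ
Below {ℓ} α = record
  { Carrier       = Σ[ β ∈ Ord ℓ ] β < α
  ; _≈_           = λ x y → proj₁ x ≈ proj₁ y
  ; isEquivalence = record { refl = E.refl ; sym = E.sym ; trans = E.trans }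
  }
  where module E = IsEquivalence (≈-isEquivalence {ℓ})

Equipotent : Ord ℓ → Ord ℓ → Set (lsuc ℓ)
Equipotent α β = Bijection (Below α) (Below β)

IsCardinality : Ord ℓ → Ord ℓ → Set (lsuc ℓ)
IsCardinality ρ = IsLeast (Equipotent ρ)

IsInitial : Ord ℓ → Set (lsuc ℓ)
IsInitial ρ = IsCardinality ρ ρ

-- IsCardinalSuccessor ρ μ says that μ is ∣ρ∣⁺.

IsCardinalSuccessor : Ord ℓ → Ord ℓ → Set (lsuc ℓ)
IsCardinalSuccessor ρ = IsLeast λ μ → IsInitial μ × ρ < μ

-- The rank of x is the least ordinal above the ranks of the predecessors of x; for a
-- strict well order the ranks form the initial segment of the ordinals isomorphic to it.

module _ {A : Set ℓ} {_⊏_ : Rel A ℓ} where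

  rank : ∀ {x} → Acc _⊏_ x → Ord ℓ
  rank {x} (acc rs) = lsub (Σ[ y ∈ A ] y ⊏ x) λ (y , y⊏x) → rank (rs y⊏x)

  orderType : WellFounded _⊏_ → Ord ℓ
  orderType wf = lsub A λ x → rank (wf x)

-- Orderings on a set, the latter being a setoid.  (_≋_ is its equality, _≼_ the ordering.)

module _ {A : Set ℓ} (_≋_ _≼_ : Rel A ℓ) where

  private
    _≺_ : Rel A ℓ
    _≺_ = ToStrict._<_ _≋_ _≼_

  InfiniteAntichain : Set ℓ
  InfiniteAntichain = Σ[ f ∈ (ℕ → A) ] (∀ i j → i ≢ j → ¬ (f i ≼ f j))

  record IsWPO : Set ℓ where
    field
      isPartialOrder      : IsPartialOrder _≋_ _≼_
      wellFounded         : WellFounded _≺_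
      noInfiniteAntichain : ¬ InfiniteAntichain

  HasOrderType : Ord ℓ → Set ℓ
  HasOrderType α = Σ[ wf ∈ WellFounded _≺_ ] orderType wf ≈ α

module _ {A : Set ℓ} (_≋_ _≼_ : Rel A ℓ) where

  LinearExtensionType : Ord ℓ → Set (lsuc ℓ)
  LinearExtensionType α = ∃ λ (_⊑_ : Rel A ℓ) →
    IsTotalOrder _≋_ _⊑_ × (_≼_ ⇒ _⊑_) × HasOrderType _≋_ _⊑_ α

  IsLength : Ord ℓ → Set (lsuc ℓ)
  IsLength = IsGreatest LinearExtensionType

record IntersectionOfWPOs (P : Poset ℓ ℓ ℓ) (α : Vector (Ord ℓ) n) : Set (lsuc ℓ) where
  private module P = Poset P
  field
    order        : Fin n → Rel P.Carrier ℓ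
    isWPO        : ∀ i → IsWPO P._≈_ (order i)
    isLength     : ∀ i → IsLength P._≈_ (order i) (α i)
    intersection : ∀ x y → x P.≤ y ⇔ (∀ i → order i x y)

IntersectionLength : Vector (Ord ℓ) n → Ord ℓ → Set (lsuc ℓ)
IntersectionLength {ℓ} α l = Σ[ P ∈ Poset ℓ ℓ ℓ ]
  IntersectionOfWPOs P α × IsLength (Poset._≈_ P) (Poset._≤_ P) l

LinearIntersectionLength : Vector (Ord ℓ) n → Ord ℓ → Set (lsuc ℓ)
LinearIntersectionLength {ℓ} α l = Σ[ P ∈ Poset ℓ ℓ ℓ ]
    (Σ[ D ∈ IntersectionOfWPOs P α ] ∀ i → Total (IntersectionOfWPOs.order D i))
  × IsLength (Poset._≈_ P) (Poset._≤_ P) l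

{-# OPTIONS --safe #-}

-- The rank o(S) of the tree of bad sequences of a well partial order S is its length (de Jongh and
-- Parikh), and is easier to handle: o(A ∪ B) ≤ o(A) ⊕ o(B), and if o(S) ≤ ζ + ξ, then removing
-- from S a lower part of rank exactly ζ leaves a set of rank at most ξ.
--
-- Upper bound.  Each order i splits X into a part of length κ · q i and one of length r i.  The
-- latter parts together inject into ∑ r, and so add less than |∑ r|⁺.  On the intersection of the
-- former parts, cut along the Cantor normal forms of the q i, one argues by induction on the
-- exponents: what is not above x splits into the sets not above x in the single orders, and each
-- of these into finitely many pieces with smaller exponents and a set of less than κ elements.
--
-- Lower bound.  Place r i on top in the i-th order.  Below it, sort Π q × κ by the i-th coordinate
-- first and in type κ for a fixed one; there, the intersection has length at least κ · ⨂ q.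
-- The copies of the r i, which lie on top of this, are mutually incomparable in the intersection,
-- and each can be sorted in the other orders at will, so that they may add any ρ < |∑ r|⁺.

module Submission where

open import Defs
open import Axiom.ExcludedMiddle using (ExcludedMiddle)
open import Data.Empty using (⊥-elim)
open import Data.Empty.Polymorphic using (⊥)
open import Data.Fin.Base using (Fin; zero; suc; toℕ; fromℕ; inject₁)
open import Data.Fin.Properties using (toℕ-fromℕ; toℕ-inject₁; pigeonhole; _≟_)
open import Data.List.Base as List using (List; []; _∷_; cartesianProductWith)
open import Data.List.Properties using (map-++)
open import Data.List.Relation.Unary.All as All using (All; []; _∷_)
import Data.List.Relation.Unary.All.Properties as AllP
open import Data.List.Relation.Unary.AllPairs using (AllPairs; []; _∷_)
import Data.List.Relation.Unary.AllPairs.Properties as AllPairs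
open import Data.List.Relation.Unary.Linked using ([]; [-]; _∷_; Linked)
open import Data.Maybe.Base using (Maybe; just; nothing)
open import Data.Nat.Base as ℕ using (ℕ; zero; suc)
import Data.Nat.Properties as ℕₚ
open import Data.Product.Base using (Σ-syntax; ∃-syntax; _×_; _,_; proj₁; proj₂)
open import Data.Sum.Base using (_⊎_; inj₁; inj₂; [_,_])
open import Data.Unit.Polymorphic using (⊤; tt)
open import Data.Vec.Functional using (Vector)
open import Function.Base using (flip; _∘_; id)
open import Function.Bundles using (Bijection; Equivalence; mk⇔)
import Function.Construct.Composition as Compose
open import Induction.WellFounded using (WellFounded; Acc; acc)
open import Level using (Level; lift) renaming (suc to lsuc)
open import Relation.Binary.Bundles using (Poset)
open import Relation.Binary.Core using (Rel; _⇒_)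
import Relation.Binary.Construct.NonStrictToStrict as ToStrict
open import Relation.Binary.Definitions using (Total; tri<; tri≈; tri>)
open import Relation.Binary.PropositionalEquality.Core
  using (_≡_; _≢_; refl; sym; trans; cong; cong₂; subst; subst₂)
open import Relation.Binary.Structures using (IsPartialOrder; IsTotalOrder)
open import Relation.Nullary.Decidable.Core using (Dec; yes; no; decidable-stable)
open import Relation.Nullary.Negation.Core using (¬_)

-- Equal ordinals have many representations, and a function obtained from excluded middle may tell
-- them apart. This makes the theorem of de Jongh and Parikh laborious here: a linear extension as
-- long as the rank requires a sequence in X indexed by ordinals up to `_≃_`. The sequence is
-- therefore a relation, `Graph`, all of whose choices are canonical; the choices among elements of
-- X refer to a ranking by ordinals, taken from a linear extension of one of the given orders. The
-- theorem serves three purposes. It turns the given lengths into ranks, it turns the rank of the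
-- example back into a length, and it compares cardinalities: a set of rank at least ρ contains
-- distinct elements indexed by ρ. The last point explains the successor cardinal. Of the elements
-- outside the main part one knows only that they inject into `∑ r`, and ρ is below the successor
-- cardinal of `∑ r` exactly if ρ injects into `∑ r`. That this bound is approached depends on
-- having two orders: the j-th order fixes the type of the copy of `r j`, and another one is free to
-- rearrange it.

module Classical (em : ∀ {a} → ExcludedMiddle a) where

  -- Comparison of ordinals and least elements.

  private variable
    a b ℓ : Level
    α α′ β β′ γ γ′ δ κ π ρ σ τ ζ ξ : Ord ℓ

  ¬∀⇒∃¬ : {A : Set a} {P : A → Set b} → ¬ (∀ x → P x) → Σ[ x ∈ A ] ¬ P x
  ¬∀⇒∃¬ {P = P} ¬∀ with em {P = Σ[ x ∈ _ ] ¬ P x}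
  ... | yes ∃¬ = ∃¬
  ... | no ¬∃ = ⊥-elim (¬∀ λ x → decidable-stable em λ ¬Px → ¬∃ (x , ¬Px))

  -- The relations of Defs compute on their arguments, which hides the latter from
  -- unification; the following records do not.

  infix 4 _≼_ _≺_ _≃_

  record _≼_ (α β : Ord ℓ) : Set ℓ where
    constructor ⟨_⟩
    field un≼ : α ≤ β
  open _≼_ public

  record _≺_ (α β : Ord ℓ) : Set ℓ where
    constructor ⟨_⟩
    field un≺ : α < β
  open _≺_ public

  _≃_ : Ord ℓ → Ord ℓ → Set ℓ
  α ≃ β = α ≼ β × β ≼ α

  ≃⇒≈ : α ≃ β → α ≈ β
  ≃⇒≈ (p , q) = un≼ p , un≼ q

  ≈⇒≃ : α ≈ β → α ≃ β
  ≈⇒≃ (p , q) = ⟨ p ⟩ , ⟨ q ⟩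

  infixl 8 _!_

  Idx : Ord ℓ → Set ℓ
  Idx (lsub I f) = I

  _!_ : (α : Ord ℓ) → Idx α → Ord ℓ
  lsub I f ! i = f i

  ≼-intro : (∀ i → α ! i ≺ β) → α ≼ β
  ≼-intro {α = lsub I f} {β = lsub J g} h = ⟨ (λ i → un≺ (h i)) ⟩

  ≼-elim : α ≼ β → ∀ i → α ! i ≺ β
  ≼-elim {α = lsub I f} {β = lsub J g} ⟨ p ⟩ i = ⟨ p i ⟩

  ≺-intro : (j : Idx β) → α ≼ β ! j → α ≺ β
  ≺-intro {β = lsub J g} j ⟨ p ⟩ = ⟨ (j , p) ⟩

  ≺-elim : α ≺ β → Σ[ j ∈ Idx β ] α ≼ β ! j
  ≺-elim {β = lsub J g} ⟨ (j , p) ⟩ = j , ⟨ p ⟩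

  ≼-refl : α ≼ α
  ≼-refl {α = α} = ⟨ ≤-refl α ⟩

  ≼-trans : α ≼ β → β ≼ γ → α ≼ γ
  ≼-trans {α = α} {β = β} {γ = γ} ⟨ p ⟩ ⟨ q ⟩ = ⟨ ≤-trans α β γ p q ⟩

  ≼-≺-trans : α ≼ β → β ≺ γ → α ≺ γ
  ≼-≺-trans p q with ≺-elim q
  ... | j , r = ≺-intro j (≼-trans p r)

  ≺-≼-trans : α ≺ β → β ≼ γ → α ≺ γ
  ≺-≼-trans p q with ≺-elim p
  ... | j , r = ≼-≺-trans r (≼-elim q j)

  !-≺ : (i : Idx α) → α ! i ≺ α
  !-≺ i = ≺-intro i ≼-refl

  !-≼ : (α : Ord ℓ) (i : Idx α) → α ! i ≼ α
  !-≼ (lsub I f) i = ≼-intro λ k → ≺-intro i (!-≼ (f i) k)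

  ≺⇒≼ : α ≺ β → α ≼ β
  ≺⇒≼ {β = β} p with ≺-elim p
  ... | j , q = ≼-trans q (!-≼ β j)

  ≺-trans : α ≺ β → β ≺ γ → α ≺ γ
  ≺-trans p q = ≺-≼-trans p (≺⇒≼ q)

  ≺-acc : (α : Ord ℓ) → β ≼ α → Acc _≺_ β
  ≺-acc (lsub I f) β≼α = acc λ γ≺β → let (i , q) = ≺-elim (≺-≼-trans γ≺β β≼α) in ≺-acc (f i) q

  ≺-rec : (P : Ord ℓ → Set b) → (∀ α → (∀ β → β ≺ α → P β) → P α) → ∀ α → P α
  ≺-rec P step α = go α (≺-acc α ≼-refl)
    where
    go : ∀ α → Acc _≺_ α → P α
    go α (acc rs) = step α λ β β≺α → go β (rs β≺α)

  ≺-irrefl : ¬ α ≺ α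
  ≺-irrefl {α = α} = ≺-rec (λ α → ¬ α ≺ α) (λ α ih α≺α → ih α α≺α α≺α) α

  ≼⇒⊁ : α ≼ β → ¬ β ≺ α
  ≼⇒⊁ p q = ≺-irrefl (≼-≺-trans p q)

  -- A double recursion: an `f i` that is not below β is compared with each `β ! j`, found to lie
  -- above all of them, and hence bounds β.
  compare : (α β : Ord ℓ) → α ≼ β ⊎ β ≺ α
  compare (lsub I f) β with em {P = ∀ i → f i ≺ β}
  ... | yes h = inj₁ (≼-intro h)
  ... | no ¬h with ¬∀⇒∃¬ ¬h
  ...   | i , fi⊀β = inj₂ (≺-intro i (≼-intro below))
    where
    below : ∀ j → β ! j ≺ f i
    below j with compare (f i) (β ! j)
    ... | inj₁ p = ⊥-elim (fi⊀β (≺-intro j p))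
    ... | inj₂ q = q

  ⊀⇒≽ : ¬ α ≺ β → β ≼ α
  ⊀⇒≽ {α = α} {β = β} α⊀β with compare β α
  ... | inj₁ p = p
  ... | inj₂ q = ⊥-elim (α⊀β q)

  ⋠⇒≻ : ¬ α ≼ β → β ≺ α
  ⋠⇒≻ {α = α} {β = β} α⋠β with compare α β
  ... | inj₁ p = ⊥-elim (α⋠β p)
  ... | inj₂ q = q

  data Tri (α β : Ord ℓ) : Set ℓ where
    lt : α ≺ β → Tri α β
    eq : α ≃ β → Tri α β
    gt : β ≺ α → Tri α β

  tri : (α β : Ord ℓ) → Tri α β
  tri α β with compare α β | compare β α
  ... | inj₂ q | _      = gt q
  ... | inj₁ p | inj₂ q = lt q
  ... | inj₁ p | inj₁ q = eq (p , q)

  ≃-refl : α ≃ α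
  ≃-refl = ≼-refl , ≼-refl

  ≃-sym : α ≃ β → β ≃ α
  ≃-sym (p , q) = q , p

  ≃-trans : α ≃ β → β ≃ γ → α ≃ γ
  ≃-trans (p , q) (p′ , q′) = ≼-trans p p′ , ≼-trans q′ q

  least : (P : Ord ℓ → Set b) → P α → Σ[ μ ∈ Ord ℓ ] (P μ × ∀ β → P β → μ ≼ β)
  least {ℓ = ℓ} {α = α} P = ≺-rec (λ α → P α → Goal) step α
    where
    Goal = Σ[ μ ∈ Ord ℓ ] (P μ × ∀ β → P β → μ ≼ β)
    step : ∀ α → (∀ β → β ≺ α → P β → Goal) → P α → Goal
    step α ih Pα with em {P = Σ[ β ∈ Ord ℓ ] (β ≺ α × P β)}
    ... | yes (β , β≺α , Pβ) = ih β β≺α Pβ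
    ... | no ¬∃ = α , Pα , λ β Pβ → ⊀⇒≽ λ β≺α → ¬∃ (β , β≺α , Pβ)

  -- Finite ordinals and successors

  0≼ : fin 0 ≼ α
  0≼ = ≼-intro λ ()

  ≺0 : ¬ α ≺ fin {ℓ} 0
  ≺0 p with ≺-elim p
  ... | () , _

  sc : Ord ℓ → Ord ℓ
  sc α = lsub ⊤ λ _ → α

  ≺sc : α ≺ sc α
  ≺sc = ≺-intro _ ≼-refl

  ≺sc⇒≼ : α ≺ sc β → α ≼ β
  ≺sc⇒≼ p = proj₂ (≺-elim p)

  sc-≼ : α ≺ β → sc α ≼ β
  sc-≼ p = ≼-intro λ _ → p

  ≺-fin⇒ : ∀ k → α ≺ fin k → Σ[ m ∈ Fin k ] α ≃ fin (toℕ m)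
  ≺-fin⇒ zero p = ⊥-elim (≺0 p)
  ≺-fin⇒ {α = α} (suc k) p with compare (fin k) α
  ... | inj₁ q = fromℕ k , subst (λ m → α ≃ fin m) (sym (toℕ-fromℕ k)) (≺sc⇒≼ p , q)
  ... | inj₂ q with ≺-fin⇒ k q
  ...   | m , r = inject₁ m , subst (λ m → α ≃ fin m) (sym (toℕ-inject₁ m)) r

  fin≺ω : ∀ k → fin {ℓ} k ≺ ω
  fin≺ω k = ≺-intro (lift k) ≼-refl

  ≺ω⇒ : α ≺ ω → Σ[ k ∈ ℕ ] α ≼ fin k
  ≺ω⇒ p with ≺-elim p
  ... | lift k , q = k , q

  -- Sum

  ≼-+ˡ : (α β : Ord ℓ) → α ≼ α + β
  ≼-+ˡ (lsub I f) (lsub J g) = ≼-intro λ i → ≺-intro (inj₁ i) ≼-refl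

  +-monoʳ-≺! : (α β : Ord ℓ) (j : Idx β) → α + β ! j ≺ α + β
  +-monoʳ-≺! (lsub I f) (lsub J g) j = ≺-intro (inj₂ j) ≼-refl

  ≺-+ : (α β : Ord ℓ) → γ ≺ α + β → γ ≺ α ⊎ Σ[ j ∈ Idx β ] γ ≼ α + β ! j
  ≺-+ (lsub I f) (lsub J g) p with ≺-elim p
  ... | inj₁ i , q = inj₁ (≺-intro i q)
  ... | inj₂ j , q = inj₂ (j , q)

  +-lub : (∀ i → α ! i ≺ γ) → (∀ j → α + β ! j ≺ γ) → α + β ≼ γ
  +-lub {α = lsub I f} {β = lsub J g} h k = ≼-intro λ { (inj₁ i) → h i ; (inj₂ j) → k j }

  +-mono-≼ : α ≼ α′ → β ≼ β′ → α + β ≼ α′ + β′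
  +-mono-≼ {α = α} {α′ = α′} {β = lsub J g} {β′ = β′} p q = +-lub {β = lsub J g}
    (λ i → ≺-≼-trans (≼-elim p i) (≼-+ˡ α′ β′))
    λ j → let (j′ , r) = ≺-elim (≼-elim q j) in
      ≼-≺-trans (+-mono-≼ {β = g j} p r) (+-monoʳ-≺! α′ β′ j′)

  +-monoʳ-≺ : (α : Ord ℓ) → β ≺ β′ → α + β ≺ α + β′
  +-monoʳ-≺ {β′ = β′} α p with ≺-elim p
  ... | j , q = ≼-≺-trans (+-mono-≼ ≼-refl q) (+-monoʳ-≺! α β′ j)

  +-cong : α ≃ α′ → β ≃ β′ → α + β ≃ α′ + β′
  +-cong (p , q) (p′ , q′) = +-mono-≼ p p′ , +-mono-≼ q q′

  ≼-+ʳ : (α β : Ord ℓ) → β ≼ α + β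
  ≼-+ʳ α (lsub J g) = ≼-intro λ j → ≼-≺-trans (≼-+ʳ α (g j)) (+-monoʳ-≺! α (lsub J g) j)

  +-cancelˡ-≼ : (α : Ord ℓ) → α + β ≼ α + β′ → β ≼ β′
  +-cancelˡ-≼ {β = β} {β′ = β′} α p with compare β β′
  ... | inj₁ q = q
  ... | inj₂ q = ⊥-elim (≼⇒⊁ p (+-monoʳ-≺ α q))

  +-cancelˡ-≺ : (α : Ord ℓ) → α + β ≺ α + β′ → β ≺ β′
  +-cancelˡ-≺ {β = β} {β′ = β′} α p = ⋠⇒≻ λ q → ≼⇒⊁ (+-mono-≼ ≼-refl q) p

  +-assoc : (α β γ : Ord ℓ) → (α + β) + γ ≃ α + (β + γ)
  +-assoc (lsub I f) (lsub J g) (lsub K h) =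
      ≼-intro (λ { (inj₁ (inj₁ i)) → ≺-intro (inj₁ i) ≼-refl
                 ; (inj₁ (inj₂ j)) → ≺-intro (inj₂ (inj₁ j)) ≼-refl
                 ; (inj₂ k) → ≺-intro (inj₂ (inj₂ k)) (proj₁ (+-assoc (lsub I f) (lsub J g) (h k))) })
    , ≼-intro (λ { (inj₁ i) → ≺-intro (inj₁ (inj₁ i)) ≼-refl
                 ; (inj₂ (inj₁ j)) → ≺-intro (inj₁ (inj₂ j)) ≼-refl
                 ; (inj₂ (inj₂ k)) → ≺-intro (inj₂ k) (proj₂ (+-assoc (lsub I f) (lsub J g) (h k))) })

  +-identityʳ : (α : Ord ℓ) → α + fin 0 ≃ α
  +-identityʳ α = +-lub {β = fin 0} !-≺ (λ ()) , ≼-+ˡ α (fin 0)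

  +-identityˡ : (α : Ord ℓ) → fin 0 + α ≃ α
  +-identityˡ (lsub I f) =
    +-lub {β = lsub I f} (λ ()) (λ i → ≺-intro i (proj₁ (+-identityˡ (f i)))) , ≼-+ʳ (fin 0) (lsub I f)

  +-sc : (α β : Ord ℓ) → α + sc β ≃ sc (α + β)
  +-sc α β =
      +-lub {β = sc β} (λ i → ≺-intro _ (≼-trans (!-≼ α i) (≼-+ˡ α β))) (λ _ → ≺-intro _ ≼-refl)
    , sc-≼ (+-monoʳ-≺! α (sc β) _)

  subtract : α ≼ γ → Σ[ β ∈ Ord ℓ ] γ ≃ α + β
  subtract {α = α} {γ = γ} α≼γ with least (λ β → γ ≼ α + β) (≼-+ʳ α γ)
  ... | β , γ≼ , minimal = β , γ≼ , +-lub {β = β} (λ i → ≺-≼-trans (!-≺ i) α≼γ)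
    λ j → ⋠⇒≻ λ q → ≼⇒⊁ (minimal (β ! j) q) (!-≺ j)

  -- Product

  ·-intro : (κ π : Ord ℓ) → τ ≺ π → σ ≺ κ → κ · τ + σ ≺ κ · π

  ·-monoʳ-≼ : (κ : Ord ℓ) → π ≼ τ → κ · π ≼ κ · τ
  ·-monoʳ-≼ {π = lsub J g} {τ = τ} (lsub I f) p =
    ≼-intro λ (j , i) → ·-intro (lsub I f) τ (≼-elim p j) (!-≺ i)

  ·-intro {τ = τ} {σ = σ} (lsub I f) (lsub J g) p q with ≺-elim p | ≺-elim q
  ... | j , r | i , s = ≺-intro (j , i) (+-mono-≼ (·-monoʳ-≼ {π = τ} (lsub I f) r) s)

  ≺-· : (κ π : Ord ℓ) → γ ≺ κ · π →
        Σ[ j ∈ Idx π ] Σ[ i ∈ Idx κ ] γ ≼ κ · π ! j + κ ! i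
  ≺-· (lsub I f) (lsub J g) p with ≺-elim p
  ... | (j , i) , q = j , i , q

  ·-lub : (∀ j i → κ · π ! j + κ ! i ≺ γ) → κ · π ≼ γ
  ·-lub {κ = lsub I f} {π = lsub J g} h = ≼-intro λ (j , i) → h j i

  ·-step : (κ : Ord ℓ) → τ ≺ π → κ · τ + κ ≼ κ · π
  ·-step {τ = τ} {π = π} κ p with em {P = Σ[ σ ∈ Ord _ ] σ ≺ κ}
  ... | yes (σ , q) = +-lub {β = κ}
          (λ i → ≺-≼-trans (!-≺ i) (·-monoʳ-≼ κ (≺⇒≼ p)))
          (λ i → ·-intro κ π p (!-≺ i))
  ... | no ¬q = +-lub {β = κ}
          (λ i → ≺-≼-trans (!-≺ i) (·-monoʳ-≼ κ (≺⇒≼ p)))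
          (λ i → ⊥-elim (¬q (κ ! i , !-≺ i)))

  ·-zeroʳ : (κ : Ord ℓ) → κ · fin 0 ≼ γ
  ·-zeroʳ κ = ·-lub {π = fin 0} λ ()

  ·-sc : (κ π : Ord ℓ) → κ · sc π ≃ κ · π + κ
  ·-sc κ π = ·-lub {κ = κ} {π = sc π} (λ _ i → +-monoʳ-≺! (κ · π) κ i) , ·-step κ ≺sc

  ·-distribˡ : (κ π τ : Ord ℓ) → κ · (π + τ) ≃ κ · π + κ · τ
  ·-distribˡ κ π (lsub J g) =
      ·-lub {κ = κ} {π = π + lsub J g} upper
    , +-lub {β = κ · lsub J g}
        (λ i → ≺-≼-trans (!-≺ i) (·-monoʳ-≼ κ (≼-+ˡ π (lsub J g))))
        λ k → let (j , i , p) = ≺-· κ (lsub J g) (!-≺ k) in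
          ≼-≺-trans (+-mono-≼ ≼-refl p)
            (≼-≺-trans (proj₂ (+-assoc (κ · π) (κ · g j) (κ ! i)))
              (≼-≺-trans (+-mono-≼ (proj₂ (·-distribˡ κ π (g j))) ≼-refl)
                (·-intro κ (π + lsub J g) (+-monoʳ-≺! π (lsub J g) j) (!-≺ i))))
    where
    upper : ∀ k i → κ · (π + lsub J g) ! k + κ ! i ≺ κ · π + κ · lsub J g
    upper k i with ≺-+ π (lsub J g) (!-≺ k)
    ... | inj₁ p = ≺-≼-trans (·-intro κ π p (!-≺ i)) (≼-+ˡ (κ · π) (κ · lsub J g))
    ... | inj₂ (j , p) =
          ≼-≺-trans (+-mono-≼ (·-monoʳ-≼ κ p) ≼-refl)
            (≼-≺-trans (+-mono-≼ (proj₁ (·-distribˡ κ π (g j))) ≼-refl)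
              (≼-≺-trans (proj₁ (+-assoc (κ · π) (κ · g j) (κ ! i)))
                (+-monoʳ-≺ (κ · π) (·-intro κ (lsub J g) (!-≺ j) (!-≺ i)))))

  ·-identityʳ : (κ : Ord ℓ) → κ · fin 1 ≃ κ
  ·-identityʳ κ =
      ≼-trans (proj₁ (·-sc κ (fin 0)))
        (≼-trans (+-mono-≼ (·-zeroʳ κ) ≼-refl) (proj₁ (+-identityˡ κ)))
    , ≼-trans (≼-+ʳ (κ · fin 0) κ) (·-step κ ≺sc)

  ·-cancel-≼ : (κ : Ord ℓ) → ρ ≺ κ → κ · π + σ ≼ κ · τ + ρ → π ≼ τ
  ·-cancel-≼ {π = π} {τ = τ} κ ρ≺κ p with compare π τ
  ... | inj₁ q = q
  ... | inj₂ q = ⊥-elim (≼⇒⊁ (≼-trans (·-step κ q) (≼-trans (≼-+ˡ (κ · π) _) p))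
                   (+-monoʳ-≺ (κ · τ) ρ≺κ))

  -- The quotient is the least π with γ below `κ · sc π`. Minimality puts every `κ · sc (π ! j)`,
  -- and therefore `κ · π`, within γ, whether π is a successor or a limit.
  divide : (κ γ : Ord ℓ) → fin 0 ≺ κ → Σ[ π ∈ Ord ℓ ] Σ[ ρ ∈ Ord ℓ ] ρ ≺ κ × γ ≃ κ · π + ρ
  divide κ γ 0≺κ with least (λ π → γ ≺ κ · sc π) (≼-≺-trans (γ≼ γ) (·-intro-0 γ))
    where
    ·-intro-0 : ∀ π → κ · π ≺ κ · sc π
    ·-intro-0 π = ≼-≺-trans (≼-+ˡ (κ · π) (fin 0)) (·-intro κ (sc π) ≺sc 0≺κ)
    γ≼ : ∀ γ → γ ≼ κ · γ
    γ≼ (lsub J g) = ≼-intro λ j → ≼-≺-trans (γ≼ (g j))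
      (≼-≺-trans (≼-+ˡ (κ · g j) (fin 0)) (·-intro κ (lsub J g) (!-≺ j) 0≺κ))
  ... | π , γ≺ , minimal with subtract κπ≼γ
    where
    κπ≼γ : κ · π ≼ γ
    κπ≼γ = ·-lub {κ = κ} {π = π} λ j i →
      ≺-≼-trans (≺-≼-trans (+-monoʳ-≺ (κ · π ! j) (!-≺ i)) (proj₂ (·-sc κ (π ! j))))
        (⊀⇒≽ λ p → ≼⇒⊁ (minimal (π ! j) p) (!-≺ j))
  ...   | ρ , γ≃ = π , ρ , +-cancelˡ-≺ (κ · π)
            (≼-≺-trans (proj₂ γ≃) (≺-≼-trans γ≺ (proj₁ (·-sc κ π)))) , γ≃

  -- Natural sum

  ⊕-monoˡ-! : (α β : Ord ℓ) (i : Idx α) → α ! i ⊕ β ≺ α ⊕ β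
  ⊕-monoˡ-! (lsub I f) (lsub J g) i = ≺-intro (inj₁ i) ≼-refl

  ⊕-monoʳ-! : (α β : Ord ℓ) (j : Idx β) → α ⊕ β ! j ≺ α ⊕ β
  ⊕-monoʳ-! (lsub I f) (lsub J g) j = ≺-intro (inj₂ j) ≼-refl

  ⊕-lub : (∀ i → α ! i ⊕ β ≺ γ) → (∀ j → α ⊕ β ! j ≺ γ) → α ⊕ β ≼ γ
  ⊕-lub {α = lsub I f} {β = lsub J g} h k = ≼-intro λ { (inj₁ i) → h i ; (inj₂ j) → k j }

  ⊕-mono-≼ : α ≼ α′ → β ≼ β′ → α ⊕ β ≼ α′ ⊕ β′
  ⊕-mono-≼ {α = lsub I f} {α′ = α′} {β = lsub J g} {β′ = β′} p q = ⊕-lub {α = lsub I f} {β = lsub J g}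
    (λ i → let (i′ , r) = ≺-elim (≼-elim p i) in
      ≼-≺-trans (⊕-mono-≼ {α = f i} {β = lsub J g} r q) (⊕-monoˡ-! α′ β′ i′))
    (λ j → let (j′ , r) = ≺-elim (≼-elim q j) in
      ≼-≺-trans (⊕-mono-≼ {α = lsub I f} {β = g j} p r) (⊕-monoʳ-! α′ β′ j′))

  ⊕-monoʳ-≺ : (α : Ord ℓ) → β ≺ β′ → α ⊕ β ≺ α ⊕ β′
  ⊕-monoʳ-≺ {β′ = β′} α p with ≺-elim p
  ... | j , q = ≼-≺-trans (⊕-mono-≼ ≼-refl q) (⊕-monoʳ-! α β′ j)

  ⊕-comm-≼ : (α β : Ord ℓ) → α ⊕ β ≼ β ⊕ α
  ⊕-comm-≼ (lsub I f) (lsub J g) = ⊕-lub {α = lsub I f} {β = lsub J g}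
    (λ i → ≼-≺-trans (⊕-comm-≼ (f i) (lsub J g)) (⊕-monoʳ-! (lsub J g) (lsub I f) i))
    (λ j → ≼-≺-trans (⊕-comm-≼ (lsub I f) (g j)) (⊕-monoˡ-! (lsub J g) (lsub I f) j))

  ⊕-lubˡ : (∀ i → (α ! i ⊕ β) ⊕ γ ≺ δ) → (∀ j → (α ⊕ β ! j) ⊕ γ ≺ δ) →
           (∀ k → (α ⊕ β) ⊕ γ ! k ≺ δ) → (α ⊕ β) ⊕ γ ≼ δ
  ⊕-lubˡ {α = lsub I f} {β = lsub J g} {γ = lsub K h} u v w = ≼-intro
    λ { (inj₁ (inj₁ i)) → u i ; (inj₁ (inj₂ j)) → v j ; (inj₂ k) → w k }

  ⊕-lubʳ : (∀ i → α ! i ⊕ (β ⊕ γ) ≺ δ) → (∀ j → α ⊕ (β ! j ⊕ γ) ≺ δ) →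
           (∀ k → α ⊕ (β ⊕ γ ! k) ≺ δ) → α ⊕ (β ⊕ γ) ≼ δ
  ⊕-lubʳ {α = lsub I f} {β = lsub J g} {γ = lsub K h} u v w = ≼-intro
    λ { (inj₁ i) → u i ; (inj₂ (inj₁ j)) → v j ; (inj₂ (inj₂ k)) → w k }

  ⊕-assoc : (α β γ : Ord ℓ) → (α ⊕ β) ⊕ γ ≃ α ⊕ (β ⊕ γ)
  ⊕-assoc (lsub I f) (lsub J g) (lsub K h) =
      ⊕-lubˡ {α = lsub I f} {β = lsub J g} {γ = lsub K h}
        (λ i → ≺-intro (inj₁ i) (proj₁ (⊕-assoc (f i) (lsub J g) (lsub K h))))
        (λ j → ≺-intro (inj₂ (inj₁ j)) (proj₁ (⊕-assoc (lsub I f) (g j) (lsub K h))))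
        (λ k → ≺-intro (inj₂ (inj₂ k)) (proj₁ (⊕-assoc (lsub I f) (lsub J g) (h k))))
    , ⊕-lubʳ {α = lsub I f} {β = lsub J g} {γ = lsub K h}
        (λ i → ≺-intro (inj₁ (inj₁ i)) (proj₂ (⊕-assoc (f i) (lsub J g) (lsub K h))))
        (λ j → ≺-intro (inj₁ (inj₂ j)) (proj₂ (⊕-assoc (lsub I f) (g j) (lsub K h))))
        (λ k → ≺-intro (inj₂ k) (proj₂ (⊕-assoc (lsub I f) (lsub J g) (h k))))

  ≼-⊕ˡ : (α β : Ord ℓ) → α ≼ α ⊕ β
  ≼-⊕ˡ (lsub I f) β = ≼-intro λ i → ≼-≺-trans (≼-⊕ˡ (f i) β) (⊕-monoˡ-! (lsub I f) β i)

  ≼-⊕ʳ : (α β : Ord ℓ) → β ≼ α ⊕ β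
  ≼-⊕ʳ α β = ≼-trans (≼-⊕ˡ β α) (⊕-comm-≼ β α)

  ⊕-identityʳ-≼ : (α : Ord ℓ) → α ⊕ fin 0 ≼ α
  ⊕-identityʳ-≼ (lsub I f) = ⊕-lub {α = lsub I f} {β = fin 0}
    (λ i → ≺-intro i (⊕-identityʳ-≼ (f i))) (λ ())

  ⊕-identityˡ-≼ : (α : Ord ℓ) → fin 0 ⊕ α ≼ α
  ⊕-identityˡ-≼ α = ≼-trans (⊕-comm-≼ (fin 0) α) (⊕-identityʳ-≼ α)

  +≼⊕ : (α β : Ord ℓ) → α + β ≼ α ⊕ β
  +≼⊕ α (lsub J g) = +-lub {α = α} {β = lsub J g}
    (λ i → ≺-≼-trans (!-≺ i) (≼-⊕ˡ α (lsub J g)))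
    (λ j → ≼-≺-trans (+≼⊕ α (g j)) (⊕-monoʳ-! α (lsub J g) j))

  fin-⊕ : ∀ k m → fin {ℓ} k ⊕ fin m ≼ fin (k ℕ.+ m)
  fin-⊕ zero m = ⊕-identityˡ-≼ (fin m)
  fin-⊕ (suc k) m = ⊕-lub {α = fin (suc k)} {β = fin m}
    (λ _ → ≺-intro _ (fin-⊕ k m)) (right m)
    where
    right : ∀ m (j : Idx (fin m)) → fin (suc k) ⊕ fin m ! j ≺ fin (suc k ℕ.+ m)
    right (suc m) j = ≼-≺-trans (fin-⊕ (suc k) m) (≺-intro _
      (subst (λ x → fin (suc k ℕ.+ m) ≼ fin x) (sym (ℕₚ.+-suc k m)) ≼-refl))

  -- Ordinals closed under natural sum

  -- The nonzero closed ordinals are the powers of ω, that is, the additively indecomposable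
  -- ordinals.
  Closed : Ord ℓ → Set (lsuc ℓ)
  Closed κ = ∀ {α β} → α ≺ κ → β ≺ κ → α ⊕ β ≺ κ

  Closed-resp-≃ : κ ≃ τ → Closed κ → Closed τ
  Closed-resp-≃ (p , q) cl r s = ≺-≼-trans (cl (≺-≼-trans r q) (≺-≼-trans s q)) p

  -- Lowering a summand either lowers its remainder, or drops its quotient and brings in some
  -- remainder below κ. As κ is closed, the remainders still add up to less than κ and are covered
  -- by the lost multiple of κ. The induction is lexicographic, quotients before remainders.
  ·+-⊕-≼ : (κ : Ord ℓ) → Closed κ → ∀ π π′ σ ρ → σ ≺ κ → ρ ≺ κ →
           (κ · π + σ) ⊕ (κ · π′ + ρ) ≼ κ · (π ⊕ π′) + (σ ⊕ ρ)
  ·+-⊕-≼ κ cl (lsub J g) (lsub J′ g′) (lsub I f) (lsub I′ f′) σ≺κ ρ≺κ =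
    step (lsub J g) (lsub J′ g′) (lsub I f) (lsub I′ f′) σ≺κ ρ≺κ
      (λ j i → ·+-⊕-≼ κ cl (g j) (lsub J′ g′) (κ ! i) (lsub I′ f′) (!-≺ i) ρ≺κ)
      (λ j i → ·+-⊕-≼ κ cl (lsub J g) (g′ j) (lsub I f) (κ ! i) σ≺κ (!-≺ i))
      (λ i p → ·+-⊕-≼ κ cl (lsub J g) (lsub J′ g′) (f i) (lsub I′ f′) p ρ≺κ)
      (λ i p → ·+-⊕-≼ κ cl (lsub J g) (lsub J′ g′) (lsub I f) (f′ i) σ≺κ p)
    where
    step : ∀ π π′ σ ρ → σ ≺ κ → ρ ≺ κ →
      (∀ j i → (κ · π ! j + κ ! i) ⊕ (κ · π′ + ρ) ≼ κ · (π ! j ⊕ π′) + (κ ! i ⊕ ρ)) →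
      (∀ j i → (κ · π + σ) ⊕ (κ · π′ ! j + κ ! i) ≼ κ · (π ⊕ π′ ! j) + (σ ⊕ κ ! i)) →
      (∀ i → σ ! i ≺ κ → (κ · π + σ ! i) ⊕ (κ · π′ + ρ) ≼ κ · (π ⊕ π′) + (σ ! i ⊕ ρ)) →
      (∀ i → ρ ! i ≺ κ → (κ · π + σ) ⊕ (κ · π′ + ρ ! i) ≼ κ · (π ⊕ π′) + (σ ⊕ ρ ! i)) →
      (κ · π + σ) ⊕ (κ · π′ + ρ) ≼ κ · (π ⊕ π′) + (σ ⊕ ρ)
    step π π′ σ ρ σ≺κ ρ≺κ ihπ ihπ′ ihσ ihρ =
      ⊕-lub {α = κ · π + σ} {β = κ · π′ + ρ} (λ i → left (!-≺ i)) (λ i → right (!-≺ i))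
      where
      left : γ ≺ κ · π + σ → γ ⊕ (κ · π′ + ρ) ≺ κ · (π ⊕ π′) + (σ ⊕ ρ)
      left p with ≺-+ (κ · π) σ p
      ... | inj₁ q = let (j , i , r) = ≺-· κ π q in
            ≼-≺-trans (⊕-mono-≼ r ≼-refl) (≼-≺-trans (ihπ j i)
              (≺-≼-trans (·-intro κ (π ⊕ π′) (⊕-monoˡ-! π π′ j) (cl (!-≺ i) ρ≺κ)) (≼-+ˡ _ (σ ⊕ ρ))))
      ... | inj₂ (i , r) =
            ≼-≺-trans (⊕-mono-≼ r ≼-refl) (≼-≺-trans (ihσ i (≺-trans (!-≺ i) σ≺κ))
              (+-monoʳ-≺ (κ · (π ⊕ π′)) (⊕-monoˡ-! σ ρ i)))
      right : γ ≺ κ · π′ + ρ → (κ · π + σ) ⊕ γ ≺ κ · (π ⊕ π′) + (σ ⊕ ρ)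
      right p with ≺-+ (κ · π′) ρ p
      ... | inj₁ q = let (j , i , r) = ≺-· κ π′ q in
            ≼-≺-trans (⊕-mono-≼ ≼-refl r) (≼-≺-trans (ihπ′ j i)
              (≺-≼-trans (·-intro κ (π ⊕ π′) (⊕-monoʳ-! π π′ j) (cl σ≺κ (!-≺ i))) (≼-+ˡ _ (σ ⊕ ρ))))
      ... | inj₂ (i , r) =
            ≼-≺-trans (⊕-mono-≼ ≼-refl r) (≼-≺-trans (ihρ i (≺-trans (!-≺ i) ρ≺κ))
              (+-monoʳ-≺ (κ · (π ⊕ π′)) (⊕-monoʳ-! σ ρ i)))

  ·-⊕-≼ : (κ : Ord ℓ) → Closed κ → fin 0 ≺ κ → ∀ π π′ → κ · π ⊕ κ · π′ ≼ κ · (π ⊕ π′)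
  ·-⊕-≼ κ cl 0≺κ π π′ =
    ≼-trans (⊕-mono-≼ (≼-+ˡ (κ · π) (fin 0)) (≼-+ˡ (κ · π′) (fin 0)))
      (≼-trans (·+-⊕-≼ κ cl π π′ (fin 0) (fin 0) 0≺κ 0≺κ)
        (≼-trans (+-mono-≼ ≼-refl (⊕-identityʳ-≼ (fin 0))) (proj₁ (+-identityʳ _))))

  ·-+-⊕-≼ : (κ : Ord ℓ) → Closed κ → ∀ π → σ ≺ κ → ρ ≺ κ → (κ · π + σ) ⊕ ρ ≼ κ · π + (σ ⊕ ρ)
  ·-+-⊕-≼ {σ = σ} {ρ = ρ} κ cl π σ≺κ ρ≺κ =
    ≼-trans (⊕-mono-≼ ≼-refl (≼-+ʳ (κ · fin 0) ρ))
      (≼-trans (·+-⊕-≼ κ cl π (fin 0) σ ρ σ≺κ ρ≺κ)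
        (+-mono-≼ (·-monoʳ-≼ κ (⊕-identityʳ-≼ π)) ≼-refl))

  ·-monoˡ-≼ : κ ≼ τ → (π : Ord ℓ) → κ · π ≼ τ · π
  ·-monoˡ-≼ {κ = κ} {τ = τ} p (lsub J g) = ·-lub {κ = κ} {π = lsub J g} λ j i →
    ≼-≺-trans (+-mono-≼ (·-monoˡ-≼ p (g j)) ≼-refl)
      (·-intro τ (lsub J g) (!-≺ j) (≼-elim p i))

  Closed-· : Closed κ → Closed π → Closed (κ · π)
  Closed-· {κ = κ} {π = π} clκ clπ p q with ≺-· κ π p | ≺-· κ π q
  ... | j , i , r | j′ , i′ , r′ =
    ≼-≺-trans (⊕-mono-≼ r r′)
      (≼-≺-trans (·+-⊕-≼ κ clκ (π ! j) (π ! j′) (κ ! i) (κ ! i′) (!-≺ i) (!-≺ i′))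
        (·-intro κ π (clπ (!-≺ j) (!-≺ j′)) (clκ (!-≺ i) (!-≺ i′))))

  -- Powers of ω

  0≺ω^ : (α : Ord ℓ) → fin 0 ≺ ω^ α
  0≺ω^ (lsub I f) = ≺-intro nothing ≼-refl

  ≺-ω^ : (α : Ord ℓ) → γ ≺ ω^ α → γ ≼ fin 0 ⊎ Σ[ i ∈ Idx α ] Σ[ k ∈ ℕ ] γ ≼ ω^ (α ! i) · fin k
  ≺-ω^ (lsub I f) p with ≺-elim p
  ... | nothing , q      = inj₁ q
  ... | just (i , k) , q = inj₂ (i , k , q)

  ω^-intro-! : (α : Ord ℓ) (i : Idx α) (k : ℕ) → ω^ (α ! i) · fin k ≺ ω^ α
  ω^-intro-! (lsub I f) i k = ≺-intro (just (i , k)) ≼-refl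

  ω^-lub : (α : Ord ℓ) → fin 0 ≺ γ → (∀ i k → ω^ (α ! i) · fin k ≺ γ) → ω^ α ≼ γ
  ω^-lub (lsub I f) p h = ≼-intro λ { nothing → p ; (just (i , k)) → h i k }

  ω^-mono-≼ : α ≼ β → ω^ α ≼ ω^ β
  ω^-mono-≼ {α = lsub I f} {β = β} p = ω^-lub (lsub I f) (0≺ω^ β)
    λ i k → let (j , q) = ≺-elim (≼-elim p i) in
      ≼-≺-trans (·-monoˡ-≼ (ω^-mono-≼ {α = f i} q) (fin k)) (ω^-intro-! β j k)

  ω^-intro : (α : Ord ℓ) → β ≺ α → ∀ k → ω^ β · fin k ≺ ω^ α
  ω^-intro α p k with ≺-elim p
  ... | i , q = ≼-≺-trans (·-monoˡ-≼ (ω^-mono-≼ q) (fin k)) (ω^-intro-! α i k)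

  ω^-mono-≺ : α ≺ β → ω^ α ≺ ω^ β
  ω^-mono-≺ {α = α} {β = β} p = ≼-≺-trans (proj₂ (·-identityʳ (ω^ α))) (ω^-intro β p 1)

  ≼ω^ : (α : Ord ℓ) → α ≼ ω^ α
  ≼ω^ (lsub I f) = ≼-intro λ i → ≼-≺-trans (≼ω^ (f i)) (ω^-mono-≺ {α = f i} (!-≺ i))

  ω^-⊕-≺ : (α : Ord ℓ) (i : Idx α) (k m : ℕ) → Closed (ω^ (α ! i)) →
           β ≼ ω^ (α ! i) · fin k → γ ≼ ω^ (α ! i) · fin m → β ⊕ γ ≺ ω^ α
  ω^-⊕-≺ α i k m cl p q = ≼-≺-trans (⊕-mono-≼ p q)
    (≼-≺-trans (·-⊕-≼ (ω^ (α ! i)) cl (0≺ω^ (α ! i)) (fin k) (fin m))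
      (≼-≺-trans (·-monoʳ-≼ (ω^ (α ! i)) (fin-⊕ k m)) (ω^-intro-! α i (k ℕ.+ m))))

  Closed-ω^-step : (α : Ord ℓ) → (∀ i → Closed (ω^ (α ! i))) → Closed (ω^ α)
  Closed-ω^-step α ih {β} {γ} p q with ≺-ω^ α p | ≺-ω^ α q
  ... | inj₁ β≼0 | _ = ≼-≺-trans (≼-trans (⊕-mono-≼ β≼0 ≼-refl) (⊕-identityˡ-≼ γ)) q
  ... | inj₂ _   | inj₁ γ≼0 = ≼-≺-trans (≼-trans (⊕-mono-≼ ≼-refl γ≼0) (⊕-identityʳ-≼ β)) p
  ... | inj₂ (i , k , r) | inj₂ (j , m , s) with compare (α ! i) (α ! j)
  ...   | inj₁ u = ω^-⊕-≺ α j k m (ih j) (≼-trans r (·-monoˡ-≼ (ω^-mono-≼ u) (fin k))) s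
  ...   | inj₂ v = ω^-⊕-≺ α i k m (ih i) r (≼-trans s (·-monoˡ-≼ (ω^-mono-≼ (≺⇒≼ v)) (fin m)))

  Closed-ω^ : (α : Ord ℓ) → Closed (ω^ α)
  Closed-ω^ (lsub I f) = Closed-ω^-step (lsub I f) λ i → Closed-ω^ (f i)

  fin-+-≼ : ∀ k m → fin {ℓ} (k ℕ.+ m) ≼ fin k + fin m
  fin-+-≼ k zero = subst (λ x → fin x ≼ fin k + fin 0) (sym (ℕₚ.+-identityʳ k)) (≼-+ˡ (fin k) (fin 0))
  fin-+-≼ k (suc m) = subst (λ x → fin x ≼ fin k + fin (suc m)) (sym (ℕₚ.+-suc k m))
    (sc-≼ (≼-≺-trans (fin-+-≼ k m) (+-monoʳ-≺! (fin k) (fin (suc m)) _)))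

  ·-fin-suc-≼ : (κ : Ord ℓ) (k : ℕ) → κ · fin (suc k) ≼ κ + κ · fin k
  ·-fin-suc-≼ κ k = ≼-trans (·-monoʳ-≼ κ (fin-+-≼ 1 k))
    (≼-trans (proj₁ (·-distribˡ κ (fin 1) (fin k))) (+-mono-≼ (proj₁ (·-identityʳ κ)) ≼-refl))

  -- Dividing by κ gives δ a finite quotient. The natural sum adds the coefficients of κ, and on
  -- finite ordinals the two sums agree.
  ⊕-absorb-≼ : (κ : Ord ℓ) → Closed κ → fin 0 ≺ κ → ∀ m → δ ≼ κ · fin m → κ ⊕ δ ≼ κ + δ
  ⊕-absorb-≼ {δ = δ} κ cl 0≺κ m δ≼ =
    let (π , ρ , ρ≺κ , δ≃) = divide κ δ 0≺κ
        π≼m = ·-cancel-≼ {π = π} {σ = ρ} {τ = fin m} κ 0≺κ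
          (≼-trans (proj₂ δ≃) (≼-trans δ≼ (≼-+ˡ (κ · fin m) (fin 0))))
        (k , π≃k) = ≺-fin⇒ (suc m) (≺-intro {β = fin (suc m)} tt π≼m)
    in
    ≼-trans (⊕-mono-≼ (≼-trans (proj₂ (·-identityʳ κ)) (≼-+ˡ (κ · fin 1) (fin 0))) (proj₁ δ≃))
      (≼-trans (·+-⊕-≼ κ cl (fin 1) π (fin 0) ρ 0≺κ ρ≺κ)
        (≼-trans (+-mono-≼ (κ-step π (toℕ k) π≃k) (⊕-identityˡ-≼ ρ))
          (≼-trans (proj₁ (+-assoc κ (κ · π) ρ)) (+-mono-≼ ≼-refl (proj₂ δ≃)))))
    where
    κ-step : ∀ π k → π ≃ fin k → κ · (fin 1 ⊕ π) ≼ κ + κ · π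
    κ-step π k π≃k = ≼-trans (·-monoʳ-≼ κ (≼-trans (⊕-mono-≼ ≼-refl (proj₁ π≃k)) (fin-⊕ 1 k)))
      (≼-trans (·-fin-suc-≼ κ k) (+-mono-≼ ≼-refl (·-monoʳ-≼ κ (proj₂ π≃k))))

  -- Cantor normal forms

  sumω^ : List (Ord ℓ) → Ord ℓ
  sumω^ as = List.foldr _+_ (fin 0) (List.map ω^ as)

  Nonincreasing : List (Ord ℓ) → Set (lsuc ℓ)
  Nonincreasing = Linked (flip _≤_)

  nonincreasing-∷ : ∀ {as} → All (_≼ α) as → Nonincreasing as → Nonincreasing (α ∷ as)
  nonincreasing-∷ [] [] = [-]
  nonincreasing-∷ (p ∷ _) l = un≼ p ∷ l

  Cantor : (P : Ord ℓ → Set ℓ) (α : Ord ℓ) → Set (lsuc ℓ)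
  Cantor P α = Σ[ as ∈ List (Ord _) ] Nonincreasing as × All P as × α ≃ sumω^ as

  -- Copies of `ω^ ε` are split off while α is at least `ω^ ε`, and k bounds their number; what is
  -- left falls to `ih`.
  cantor-≼ : (ε : Ord ℓ) → (∀ {α} → α ≺ ω^ ε → Cantor (_≺ ε) α) →
             ∀ k {α} → α ≼ ω^ ε · fin k → Cantor (_≼ ε) α
  cantor-≼ ε ih zero p = [] , [] , [] , ≼-trans p (·-zeroʳ (ω^ ε)) , 0≼
  cantor-≼ ε ih (suc k) {α} p with compare (ω^ ε) α
  ... | inj₂ q = let (as , l , as≺ , α≃) = ih q in as , l , All.map ≺⇒≼ as≺ , α≃
  ... | inj₁ q with subtract q
  ...   | ξ , α≃ with cantor-≼ ε ih k (+-cancelˡ-≼ (ω^ ε)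
                        (≼-trans (proj₂ α≃) (≼-trans p (·-fin-suc-≼ (ω^ ε) k))))
  ...     | as , l , as≼ , ξ≃ =
            ε ∷ as , nonincreasing-∷ as≼ l , ≼-refl ∷ as≼ , ≃-trans α≃ (+-cong ≃-refl ξ≃)

  cantor-≺-step : (ε : Ord ℓ) → (∀ i {α} → α ≺ ω^ (ε ! i) → Cantor (_≺ (ε ! i)) α) →
                  α ≺ ω^ ε → Cantor (_≺ ε) α
  cantor-≺-step ε ih p with ≺-ω^ ε p
  ... | inj₁ q = [] , [] , [] , q , 0≼
  ... | inj₂ (i , k , q) = let (as , l , as≼ , α≃) = cantor-≼ (ε ! i) (ih i) k q in
        as , l , All.map (≺-intro i) as≼ , α≃

  cantor-≺ : (ε : Ord ℓ) → α ≺ ω^ ε → Cantor (_≺ ε) α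
  cantor-≺ (lsub I f) = cantor-≺-step (lsub I f) λ i → cantor-≺ (f i)

  cantor : (α : Ord ℓ) → Σ[ as ∈ List (Ord ℓ) ] Nonincreasing as × α ≃ sumω^ as
  cantor α with cantor-≺ (sc α) (≼-≺-trans (≼ω^ α) (ω^-mono-≺ ≺sc))
  ... | as , l , _ , α≃ = as , l , α≃

  -- In fact τ is `ω^ ε` for the least ε with τ ≼ `ω^ ε`. Otherwise τ would be within a finite
  -- multiple of a smaller power, which is below τ by minimality of ε, and so are its multiples by
  -- closure.
  +-Closed⇒Closed : fin 0 ≺ τ → (∀ {α β} → α ≺ τ → β ≺ τ → α + β ≺ τ) → Closed τ
  +-Closed⇒Closed {τ = τ} 0≺τ cl with least (λ ε → τ ≼ ω^ ε) (≼ω^ τ)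
  ... | ε , τ≼ , minimal = Closed-resp-≃ (ω^ε≼τ , τ≼) (Closed-ω^ ε)
    where
    multiple : ∀ k → α ≺ τ → α · fin k ≺ τ
    multiple {α = α} zero p = ≼-≺-trans (·-zeroʳ α) 0≺τ
    multiple {α = α} (suc k) p = ≼-≺-trans (proj₁ (·-sc α (fin k))) (cl (multiple k p) p)
    ω^ε≼τ : ω^ ε ≼ τ
    ω^ε≼τ with compare (ω^ ε) τ
    ... | inj₁ p = p
    ... | inj₂ τ≺ with ≺-ω^ ε τ≺
    ...   | inj₁ τ≼0 = ⊥-elim (≼⇒⊁ τ≼0 0≺τ)
    ...   | inj₂ (i , k , q) = ⊥-elim (≼⇒⊁ q (multiple k
              (⋠⇒≻ λ r → ≼⇒⊁ (minimal (ε ! i) r) (!-≺ i))))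

  -- σ + τ where τ is the last term of the Cantor normal form of γ, described without choices.

  record LastTerm (γ σ τ : Ord ℓ) : Set (lsuc ℓ) where
    field
      positive   : fin 0 ≺ τ
      decomposes : γ ≃ σ + τ
      τ-least    : ∀ {σ′ τ′} → fin 0 ≺ τ′ → γ ≃ σ′ + τ′ → τ ≼ τ′
      σ-least    : ∀ {σ′} → γ ≃ σ′ + τ → σ ≼ σ′

  lastTerm : fin 0 ≺ γ → Σ[ σ ∈ Ord ℓ ] Σ[ τ ∈ Ord ℓ ] LastTerm γ σ τ
  lastTerm {γ = γ} 0≺γ
    with least (λ τ → fin 0 ≺ τ × Σ[ σ ∈ Ord _ ] γ ≃ σ + τ) (0≺γ , fin 0 , ≃-sym (+-identityˡ γ))
  ... | τ , (0≺τ , σ₀ , γ≃₀) , τ-min with least (λ σ → γ ≃ σ + τ) γ≃₀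
  ...   | σ , γ≃ , σ-min = σ , τ , record
          { positive = 0≺τ ; decomposes = γ≃
          ; τ-least = λ 0≺τ′ e → τ-min _ (0≺τ′ , _ , e) ; σ-least = λ e → σ-min _ e }

  module _ (L : LastTerm γ σ τ) where
    open LastTerm L

    -- Write τ as α + β′ with β′ nonzero. Then β′ also ends a decomposition of γ, so τ ≼ β′ by
    -- minimality, and α + β stays below α + β′.
    lastTerm-+-closed : α ≺ τ → β ≺ τ → α + β ≺ τ
    lastTerm-+-closed {α = α} {β = β} p q =
      let (β′ , τ≃) = subtract (≺⇒≼ p)
          0≺β′ = ⋠⇒≻ λ r → ≼⇒⊁ (≼-trans (proj₁ τ≃)
            (≼-trans (+-mono-≼ ≼-refl r) (proj₁ (+-identityʳ α)))) p
          τ≼β′ = τ-least 0≺β′ (≃-trans decomposes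
            (≃-trans (+-cong ≃-refl τ≃) (≃-sym (+-assoc σ α β′))))
      in ≺-≼-trans (+-monoʳ-≺ α (≺-≼-trans q τ≼β′)) (proj₂ τ≃)

    lastTerm-Closed : Closed τ
    lastTerm-Closed = +-Closed⇒Closed positive lastTerm-+-closed

    private
      ⊕-bound : Closed τ → ∀ π {σ} → σ ≺ τ → β ≺ τ → α ≼ τ · π + σ → α ⊕ β ≺ τ · π + τ
      ⊕-bound cl π σ≺τ q r = ≼-≺-trans (⊕-mono-≼ r ≼-refl)
        (≼-≺-trans (·-+-⊕-≼ τ cl π σ≺τ q) (+-monoʳ-≺ (τ · π) (cl σ≺τ q)))

      ⊕-bound′ : Closed τ → ∀ π → β ≺ τ → α ≺ τ · π + τ → α ⊕ β ≺ τ · π + τ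
      ⊕-bound′ cl π q p with ≺-+ (τ · π) τ p
      ... | inj₁ r       = ⊕-bound cl π positive q (≼-trans (≺⇒≼ r) (≼-+ˡ (τ · π) (fin 0)))
      ... | inj₂ (j , r) = ⊕-bound cl π (!-≺ j) q r

    -- Dividing σ by τ and absorbing the remainder shows that γ is `τ · π + τ`. Any α below it is at
    -- most `τ · π` plus a remainder below τ, and adding β does not leave the last copy of τ.
    lastTerm-⊕ : α ≺ γ → β ≺ τ → α ⊕ β ≺ γ
    lastTerm-⊕ p q =
      let (π , ρ , ρ≺τ , σ≃) = divide τ σ positive
          γ≼ = ≼-trans (proj₁ decomposes) (≼-trans (+-mono-≼ (proj₁ σ≃) ≼-refl)
            (≼-trans (proj₁ (+-assoc (τ · π) ρ τ)) (+-mono-≼ ≼-refl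
              (+-lub {α = ρ} {β = τ} (λ i → ≺-trans (!-≺ i) ρ≺τ) (λ j → lastTerm-+-closed ρ≺τ (!-≺ j))))))
          ≼γ = ≼-trans (+-mono-≼ (≼-trans (≼-+ˡ (τ · π) ρ) (proj₂ σ≃)) ≼-refl) (proj₂ decomposes)
      in ≺-≼-trans (⊕-bound′ lastTerm-Closed π q (≺-≼-trans p γ≼)) ≼γ

  lastTerm-unique : LastTerm γ σ τ → LastTerm γ′ ρ π → γ ≃ γ′ → σ ≃ ρ × τ ≃ π
  lastTerm-unique L L′ γ≃γ′ = (σ≼ L L′ γ≃γ′ τ≃ , σ≼ L′ L (≃-sym γ≃γ′) (≃-sym τ≃)) , τ≃
    where
    open LastTerm
    τ≼ : LastTerm α σ τ → LastTerm β ρ π → α ≃ β → τ ≼ π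
    τ≼ L L′ e = τ-least L (positive L′) (≃-trans e (decomposes L′))
    τ≃ = τ≼ L L′ γ≃γ′ , τ≼ L′ L (≃-sym γ≃γ′)
    σ≼ : LastTerm α σ τ → LastTerm β ρ π → α ≃ β → τ ≃ π → σ ≼ ρ
    σ≼ L L′ e e′ = σ-least L (≃-trans e (≃-trans (decomposes L′) (+-cong ≃-refl (≃-sym e′))))

  -- Ordinals measuring the well-foundedness of bad sequences

  _∖[_]_ : {X : Set ℓ} → (X → Set ℓ) → Rel X ℓ → X → X → Set ℓ
  (S ∖[ R ] x) y = S y × ¬ R x y

  -- The rank of S is that of the tree of finite sequences in S none of whose terms lies above an
  -- earlier one.  WT says that this tree is well founded, Len γ and Big γ that its rank is at most
  -- and at least γ.

  data WT {X : Set ℓ} (R : Rel X ℓ) (S : X → Set ℓ) : Set ℓ where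
    wt : (∀ x → S x → WT R (S ∖[ R ] x)) → WT R S

  data Len {X : Set ℓ} (R : Rel X ℓ) (S : X → Set ℓ) (γ : Ord ℓ) : Set ℓ where
    len : (∀ x → S x → Σ[ j ∈ Idx γ ] Len R (S ∖[ R ] x) (γ ! j)) → Len R S γ

  data Big {X : Set ℓ} (R : Rel X ℓ) (S : X → Set ℓ) (γ : Ord ℓ) : Set ℓ where
    big : (∀ j → Σ[ x ∈ X ] S x × Big R (S ∖[ R ] x) (γ ! j)) → Big R S γ

  private variable
    X Y : Set ℓ
    R R′ : Rel X ℓ
    S S′ T A B : X → Set ℓ

  infix 4 _⊆_
  _⊆_ : {X : Set ℓ} → (X → Set ℓ) → (X → Set ℓ) → Set ℓ
  A ⊆ B = ∀ x → A x → B x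

  ⊆-refl : S ⊆ S
  ⊆-refl _ Sx = Sx

  -- Such a φ carries bad sequences in `S′` to bad sequences in `S`, so that bounds on the tree of
  -- `S` pass to that of `S′`.
  Comap : {X Y : Set ℓ} (R : Rel X ℓ) (R′ : Rel Y ℓ) (φ : Y → X) → (X → Set ℓ) → (Y → Set ℓ) → Set ℓ
  Comap R R′ φ S S′ = (∀ y → S′ y → S (φ y)) × (∀ y y′ → S′ y → S′ y′ → R (φ y) (φ y′) → R′ y y′)

  Comap-∖ : (φ : Y → X) → ∀ y → Comap R R′ φ S S′ → S′ y → Comap R R′ φ (S ∖[ R ] φ y) (S′ ∖[ R′ ] y)
  Comap-∖ φ y (s , r) S′y =
      (λ z (S′z , ¬yz) → s z S′z , λ p → ¬yz (r y z S′y S′z p))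
    , λ z w (S′z , _) (S′w , _) → r z w S′z S′w

  Len-comap : (φ : Y → X) → Comap R R′ φ S S′ → γ ≼ γ′ → Len R S γ → Len R′ S′ γ′
  Len-comap {R = R} {S = S} φ m p (len h) = len λ y S′y →
    let (j , l) = h (φ y) (proj₁ m y S′y)
        (j′ , q) = ≺-elim (≼-elim p j)
    in j′ , Len-comap φ (Comap-∖ {R = R} {S = S} φ y m S′y) q l

  WT-comap : (φ : Y → X) → Comap R R′ φ S S′ → WT R S → WT R′ S′
  WT-comap {R = R} {S = S} φ m (wt h) = wt λ y S′y →
    WT-comap φ (Comap-∖ {R = R} {S = S} φ y m S′y) (h (φ y) (proj₁ m y S′y))

  Big-map : (φ : X → Y) → (∀ x → S x → S′ (φ x)) → (∀ x x′ → S x → S x′ → R′ (φ x) (φ x′) → R x x′) →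
            γ′ ≼ γ → Big R S γ → Big R′ S′ γ′
  Big-map φ s r p (big h) = big λ j →
    let (i , q) = ≺-elim (≼-elim p j)
        (x , Sx , b) = h i
    in φ x , s x Sx , Big-map φ (λ y (Sy , ¬xy) → s y Sy , λ e → ¬xy (r x y Sx Sy e))
                        (λ y z (Sy , _) (Sz , _) → r y z Sy Sz) q b

  Len-mono : S′ ⊆ S → γ ≼ γ′ → Len R S γ → Len R S′ γ′
  Len-mono s p l = Len-comap id (s , λ _ _ _ _ r → r) p l

  Big-mono : S ⊆ S′ → γ′ ≼ γ → Big R S γ → Big R S′ γ′
  Big-mono s p b = Big-map id s (λ _ _ _ _ r → r) p b

  WT-mono : S′ ⊆ S → WT R S → WT R S′
  WT-mono s w = WT-comap id (s , λ _ _ _ _ r → r) w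

  ∖-mono : (R : Rel X ℓ) (x : X) → S ⊆ S′ → (S ∖[ R ] x) ⊆ (S′ ∖[ R ] x)
  ∖-mono R x s y (Sy , ¬xy) = s y Sy , ¬xy

  Len-elim : Len R S γ → ∀ x → S x → Σ[ δ ∈ Ord _ ] δ ≺ γ × Len R (S ∖[ R ] x) δ
  Len-elim (len h) x Sx = let (j , l) = h x Sx in _ , !-≺ j , l

  Len-intro : (∀ x → S x → Σ[ δ ∈ Ord _ ] δ ≺ γ × Len R (S ∖[ R ] x) δ) → Len R S γ
  Len-intro h = len λ x Sx →
    let (δ , p , l) = h x Sx
        (j , q) = ≺-elim p
    in j , Len-mono ⊆-refl q l

  Big-elim : Big R S γ → δ ≺ γ → Σ[ x ∈ _ ] S x × Big R (S ∖[ R ] x) δ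
  Big-elim (big h) p =
    let (j , q) = ≺-elim p
        (x , Sx , b) = h j
    in x , Sx , Big-mono ⊆-refl q b

  Big-0 : Big R S (fin 0)
  Big-0 = big λ ()

  Len-∅ : (∀ x → ¬ S x) → Len R S γ
  Len-∅ ∅ = len λ x Sx → ⊥-elim (∅ x Sx)

  Big⇒Len⇒≼ : Big R S γ → Len R S δ → γ ≼ δ
  Big⇒Len⇒≼ (big h) (len k) = ≼-intro λ i →
    let (x , Sx , b) = h i
        (j , l) = k x Sx
    in ≺-intro j (Big⇒Len⇒≼ b l)

  Len⇒WT : Len R S γ → WT R S
  Len⇒WT (len h) = wt λ x Sx → Len⇒WT (proj₂ (h x Sx))

  rankOf : WT R S → Σ[ γ ∈ Ord _ ] Len R S γ × Big R S γ
  rankOf {S = S} (wt h) =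
      lsub (Σ[ x ∈ _ ] S x) (λ (x , Sx) → proj₁ (rankOf (h x Sx)))
    , len (λ x Sx → (x , Sx) , proj₁ (proj₂ (rankOf (h x Sx))))
    , big (λ (x , Sx) → x , Sx , proj₂ (proj₂ (rankOf (h x Sx))))

  Big-or-Len : WT R S → ∀ ζ → Big R S ζ ⊎ Σ[ δ ∈ Ord _ ] δ ≺ ζ × Len R S δ
  Big-or-Len w ζ with rankOf w
  ... | γ , l , b with compare ζ γ
  ...   | inj₁ p = inj₁ (Big-mono ⊆-refl p b)
  ...   | inj₂ p = inj₂ (γ , p , l)

  -- A bad sequence in S interleaves one in A with one in B: each term lowers the bound of the part
  -- that contains it.
  Len-∪ : (∀ x → S x → A x ⊎ B x) → Len R A γ → Len R B δ → Len R S (γ ⊕ δ)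
  Len-∪ {S = S} {R = R} {γ = γ} {δ = δ} s (len h) (len k) = Len-intro step
    where
    step : ∀ x → S x → Σ[ ζ ∈ Ord _ ] ζ ≺ γ ⊕ δ × Len R (S ∖[ R ] x) ζ
    step x Sx with s x Sx
    ... | inj₁ Ax = let (i , l) = h x Ax in
      _ , ⊕-monoˡ-! γ δ i , Len-∪ (λ y (Sy , n) → [ (λ Ay → inj₁ (Ay , n)) , inj₂ ] (s y Sy)) l (len k)
    ... | inj₂ Bx = let (j , l) = k x Bx in
      _ , ⊕-monoʳ-! γ δ j , Len-∪ (λ y (Sy , n) → [ inj₁ , (λ By → inj₂ (By , n)) ] (s y Sy)) (len h) l

  WT-∪ : (∀ x → S x → A x ⊎ B x) → WT R A → WT R B → WT R S
  WT-∪ s w w′ = let (_ , l , _) = rankOf w ; (_ , l′ , _) = rankOf w′ in Len⇒WT (Len-∪ s l l′)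

  NotBelow : {X : Set ℓ} → Rel X ℓ → (B A : X → Set ℓ) → Set ℓ
  NotBelow R B A = ∀ x y → A x → B y → ¬ R y x

  -- A bad sequence may visit B first, as by `NotBelow` this leaves all of A available. Hence B
  -- accounts for the upper summand.
  Big-+ : A ⊆ S → B ⊆ S → NotBelow R B A → Big R A γ → Big R B δ → Big R S (γ + δ)
  Big-+ {R = R} {γ = lsub I f} {δ = lsub J g} a b ¬ba bigA@(big h) (big k) = big λ
    { (inj₁ i) → let (x , Ax , c) = h i in x , a x Ax , Big-mono (∖-mono R x a) ≼-refl c
    ; (inj₂ j) → let (x , Bx , c) = k j in
        x , b x Bx , Big-+ (λ y Ay → a y Ay , ¬ba y x Ay Bx) (∖-mono R x b)
                       (λ y z Ay (Bz , _) → ¬ba y z Ay Bz) bigA c }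

  -- Cutting a set at a given rank.

  Transitiveᴿ : {X : Set ℓ} → Rel X ℓ → Set ℓ
  Transitiveᴿ R = ∀ {x y z} → R x y → R y z → R x z

  LowerIn : {X : Set ℓ} → Rel X ℓ → (X → Set ℓ) → (X → Set ℓ) → Set ℓ
  LowerIn R S A = A ⊆ S × (∀ x y → A x → S y → R y x → A y)

  _─_ : {X : Set ℓ} → (X → Set ℓ) → (X → Set ℓ) → X → Set ℓ
  (S ─ A) x = S x × ¬ A x

  ─-cover : ∀ x → S x → A x ⊎ (S ─ A) x
  ─-cover {A = A} x Sx with em {P = A x}
  ... | yes Ax = inj₁ Ax
  ... | no ¬Ax = inj₂ (Sx , ¬Ax)

  LowerIn⇒NotBelow : LowerIn R S A → NotBelow R (S ─ A) A
  LowerIn⇒NotBelow (_ , low) x y Ax (Sy , ¬Ay) yx = ¬Ay (low x y Ax Sy yx)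

  -- Passing from S to `S ∖[ R ] x` while the rank stays at least ζ must end by `WT`, and the rank
  -- is then exactly ζ. Each of these sets is a lower part by transitivity.
  lowerPart : Transitiveᴿ R → WT R S → Big R S ζ →
              Σ[ A ∈ (_ → Set _) ] LowerIn R S A × Len R A ζ × Big R A ζ
  lowerPart {R = R} {S = S} {ζ = ζ} tr (wt h) b with em {P = Len R S ζ}
  ... | yes l = S , (⊆-refl , λ _ _ _ Sy _ → Sy) , l , b
  ... | no ¬l with em {P = Σ[ x ∈ _ ] Σ[ Sx ∈ S x ] Big R (S ∖[ R ] x) ζ}
  ...   | yes (x , Sx , b′) with lowerPart tr (h x Sx) b′
  ...     | A , (A⊆ , low) , l , c =
              A , ((λ y Ay → proj₁ (A⊆ y Ay))
                , λ y z Ay Sz zy → low y z Ay (Sz , λ xz → proj₂ (A⊆ y Ay) (tr xz zy)) zy) , l , c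
  lowerPart {R = R} {S = S} {ζ = ζ} tr (wt h) b | no ¬l | no ¬∃ = ⊥-elim (¬l (Len-intro small))
    where
    small : ∀ x → S x → Σ[ δ ∈ Ord _ ] δ ≺ ζ × Len R (S ∖[ R ] x) δ
    small x Sx with Big-or-Len (h x Sx) ζ
    ... | inj₁ c = ⊥-elim (¬∃ (x , Sx , c))
    ... | inj₂ r = r

  -- Removing what lies above an element of B spares all of A, so the rank stays at least ζ, and the
  -- bound ζ + ξ can only drop within its summand ξ.
  Len-complement : A ⊆ S → B ⊆ S → NotBelow R B A → Big R A ζ → Len R S (ζ + ξ) → Len R B ξ
  Len-complement {A = A} {B = B} {R = R} {ζ = lsub I f} {ξ = lsub J g} a b ¬ba bigA (len h) = len rest
    where
    rest : ∀ x → B x → Σ[ j ∈ J ] Len R (B ∖[ R ] x) (g j)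
    rest x Bx with h x (b x Bx)
    ... | inj₁ i , l = ⊥-elim (≼⇒⊁
            (Big⇒Len⇒≼ bigA (Len-mono (λ y Ay → a y Ay , ¬ba y x Ay Bx) ≼-refl l)) (!-≺ {α = lsub I f} i))
    ... | inj₂ j , l = j , Len-complement (λ y Ay → a y Ay , ¬ba y x Ay Bx) (∖-mono R x b)
                             (λ y z Ay (Bz , _) → ¬ba y z Ay Bz) bigA l

  Len-split : Transitiveᴿ R → Len R S (ζ + ξ) →
              Σ[ A ∈ (_ → Set _) ] Σ[ B ∈ (_ → Set _) ]
                (∀ x → S x → A x ⊎ B x) × A ⊆ S × B ⊆ S × Len R A ζ × Len R B ξ
  Len-split {R = R} {S = S} {ζ = ζ} tr l with Big-or-Len (Len⇒WT l) ζ
  ... | inj₂ (δ , p , l′) =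
        S , (λ _ → ⊥) , (λ _ → inj₁) , ⊆-refl , (λ _ ()) , Len-mono ⊆-refl (≺⇒≼ p) l′ , Len-∅ λ _ ()
  ... | inj₁ b with lowerPart tr (Len⇒WT l) b
  ...   | A , low , lA , bA =
          A , (S ─ A) , ─-cover , proj₁ low , (λ _ → proj₁) , lA
        , Len-complement (proj₁ low) (λ _ → proj₁) (LowerIn⇒NotBelow low) bA l

  -- Were `T ─ A` of rank δ ≺ ξ, then T would have rank at most κ ⊕ δ, which is κ + δ because δ is
  -- within a finite multiple of κ. But T has rank κ + ξ.
  Big-split : Transitiveᴿ R → WT R S → Closed κ → fin 0 ≺ κ → ∀ m → ξ ≼ κ · fin m → Big R S (κ + ξ) →
              Σ[ A ∈ (_ → Set _) ] Σ[ B ∈ (_ → Set _) ]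
                A ⊆ S × B ⊆ S × NotBelow R B A × Big R A κ × Big R B ξ
  Big-split {R = R} {S = S} {κ = κ} {ξ = ξ} tr w cl 0≺κ m ξ≼ b
    with lowerPart tr w b
  ... | T , (T⊆S , _) , lT , bT with lowerPart tr (WT-mono T⊆S w) (Big-mono ⊆-refl (≼-+ˡ κ ξ) bT)
  ...   | A , low , lA , bA with Big-or-Len (WT-mono {S′ = T ─ A} (λ x p → T⊆S x (proj₁ p)) w) ξ
  ...     | inj₁ bB = A , (T ─ A) , (λ x Ax → T⊆S x (proj₁ low x Ax)) , (λ x p → T⊆S x (proj₁ p))
                    , LowerIn⇒NotBelow low , bA , bB
  ...     | inj₂ (δ , δ≺ξ , lB) = ⊥-elim (≼⇒⊁
              (≼-trans (Big⇒Len⇒≼ bT (Len-∪ ─-cover lA lB))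
                (⊕-absorb-≼ κ cl 0≺κ m (≼-trans (≺⇒≼ δ≺ξ) ξ≼)))
              (+-monoʳ-≺ κ δ≺ξ))

  -- Maximal linear extensions

  infix 4 _≐_
  _≐_ : {X : Set ℓ} → (X → Set ℓ) → (X → Set ℓ) → Set ℓ
  A ≐ B = A ⊆ B × B ⊆ A

  ≐-refl : {A : X → Set ℓ} → A ≐ A
  ≐-refl = ⊆-refl , ⊆-refl

  ≐-sym : {A B : X → Set ℓ} → A ≐ B → B ≐ A
  ≐-sym (p , q) = q , p

  -- If P δ′ δ says that δ lies beyond a layer beginning at δ′, then the chosen ordinals are the
  -- beginnings of successive layers.

  module Greedy {ℓ} (P : Ord ℓ → Ord ℓ → Set b) where

    Chosen′ : ∀ δ → Acc _≺_ δ → Set (lsuc ℓ Level.⊔ b)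
    Chosen′ δ (acc rs) = ∀ δ′ (p : δ′ ≺ δ) → Chosen′ δ′ (rs p) → P δ′ δ

    Chosen : Ord ℓ → Set (lsuc ℓ Level.⊔ b)
    Chosen δ = Chosen′ δ (≺-acc δ ≼-refl)

  Monotoneʳ : (Ord ℓ → Ord ℓ → Set b) → Set (lsuc ℓ Level.⊔ b)
  Monotoneʳ P = ∀ {τ ε ε′} → P τ ε → ε ≼ ε′ → P τ ε′

  Chosen′-resp : {P Q : Ord ℓ → Ord ℓ → Set b} → Monotoneʳ P → Monotoneʳ Q →
    (∀ {τ ε} → P τ ε → Q τ ε) → (∀ {τ ε} → Q τ ε → P τ ε) →
    ∀ {δ δ′} a a′ → δ ≃ δ′ → Greedy.Chosen′ P δ a → Greedy.Chosen′ Q δ′ a′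
  Chosen′-resp mP mQ f g (acc rs) (acc rs′) δ≃ c ε ε≺ Dε =
    mQ (f (c ε (≺-≼-trans ε≺ (proj₂ δ≃)) (Chosen′-resp mQ mP g f (rs′ ε≺) (rs _) ≃-refl Dε))) (proj₁ δ≃)

  module _ {ℓ b} {P : Ord ℓ → Ord ℓ → Set b} (mP : Monotoneʳ P) where
    open Greedy P

    Chosen⇒ : ∀ {δ δ′} → Chosen δ → δ′ ≺ δ → Chosen δ′ → P δ′ δ
    Chosen⇒ {δ} {δ′} c p c′ = unfold (≺-acc δ ≼-refl) c
      where
      unfold : ∀ a → Chosen′ δ a → P δ′ δ
      unfold (acc rs) c = c δ′ p (Chosen′-resp mP mP id id _ (rs p) ≃-refl c′)

    ⇒Chosen : ∀ {δ} → (∀ {δ′} → δ′ ≺ δ → Chosen δ′ → P δ′ δ) → Chosen δ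
    ⇒Chosen {δ} h = fold (≺-acc δ ≼-refl)
      where
      fold : ∀ a → Chosen′ δ a
      fold (acc rs) δ′ p c′ = h p (Chosen′-resp mP mP id id (rs p) _ ≃-refl c′)

    -- If β lies beyond the layer of every earlier chosen ordinal, then β is itself chosen and
    -- begins its own block.
    block : (∀ {τ} → ¬ P τ τ) → ∀ β → Σ[ δ ∈ Ord ℓ ] Chosen δ × δ ≼ β × ¬ P δ β
    block ¬P β with em {P = Σ[ δ ∈ Ord ℓ ] δ ≺ β × Chosen δ × ¬ P δ β}
    ... | yes (δ , δ≺β , c , ¬Pδβ) = δ , c , ≺⇒≼ δ≺β , ¬Pδβ
    ... | no ¬∃ = β , ⇒Chosen (λ {δ} p c → decidable-stable em λ ¬Pδβ → ¬∃ (δ , p , c , ¬Pδβ)) , ≼-refl , ¬P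

  -- Excluded middle yields choice functions, but not ones respecting a given equality: a choice
  -- depending on an ordinal may differ for another representation of it.  Choosing elements of X
  -- minimal with respect to rk makes them canonical.

  module Extension {X : Set ℓ} (R : Rel X ℓ) (tr : Transitiveᴿ R)
                   (rk : X → Ord ℓ) (rk-injective : ∀ {x y} → rk x ≃ rk y → R x y) where

    LeastIn : (X → Set b) → X → Set (ℓ Level.⊔ b)
    LeastIn C x = C x × ∀ y → C y → rk x ≼ rk y

    leastIn : (C : X → Set b) → ∀ x → C x → Σ[ y ∈ X ] LeastIn C y
    leastIn C x Cx with least (λ β → Σ[ y ∈ X ] C y × rk y ≃ β) (x , Cx , ≃-refl)
    ... | β , (y , Cy , y≃β) , minimal = y , Cy , λ z Cz → ≼-trans (proj₁ y≃β) (minimal _ (z , Cz , ≃-refl))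

    leastIn-unique : {C C′ : X → Set b} → (∀ x → C x → C′ x) → (∀ x → C′ x → C x) →
                     ∀ {x y} → LeastIn C x → LeastIn C′ y → R x y × R y x
    leastIn-unique f g {x} {y} (Cx , x-least) (C′y , y-least) =
      rk-injective (x≼y , y≼x) , rk-injective (y≼x , x≼y)
      where
      x≼y = x-least y (g y C′y)
      y≼x = y-least x (f x Cx)

    ∖-resp : ∀ {S S′ x x′} → S ≐ S′ → R x x′ × R x′ x → (S ∖[ R ] x) ≐ (S′ ∖[ R ] x′)
    ∖-resp (s , s′) (xx′ , x′x) =
        (λ y (Sy , ¬xy) → s y Sy , λ x′y → ¬xy (tr xx′ x′y))
      , (λ y (S′y , ¬x′y) → s′ y S′y , λ xy → ¬x′y (tr x′x xy))

    Exact : (X → Set ℓ) → Ord ℓ → Set ℓ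
    Exact S γ = Len R S γ × Big R S γ

    Exact-unique : ∀ {S S′ γ γ′} → S ≐ S′ → Exact S γ → Exact S′ γ′ → γ ≃ γ′
    Exact-unique (s , s′) (l , b) (l′ , b′) =
        Big⇒Len⇒≼ b (Len-mono s ≼-refl l′)
      , Big⇒Len⇒≼ b′ (Len-mono s′ ≼-refl l)

    -- In S of rank γ closed under ⊕, Core finds B ⊆ S such that the ranks of the S ∖ x, for x in B,
    -- are unbounded below γ, but become bounded when x is not allowed above a given element of B.

    Unbounded : Ord ℓ → (X → Set ℓ) → (X → Set ℓ) → Set (lsuc ℓ)
    Unbounded γ S B = ∀ δ → δ ≺ γ → Σ[ x ∈ X ] B x × Big R (S ∖[ R ] x) δ

    Bad : Ord ℓ → (X → Set ℓ) → (X → Set ℓ) → X → Set (lsuc ℓ)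
    Bad γ S B x = B x × Unbounded γ S (B ∖[ R ] x)

    data Core (γ : Ord ℓ) (S T : X → Set ℓ) : (X → Set ℓ) → Set (lsuc ℓ) where
      stop : (∀ x → ¬ Bad γ S T x) → Core γ S T T
      step : ∀ {x B} → LeastIn (Bad γ S T) x → Core γ S (T ∖[ R ] x) B → Core γ S T B

    Bad-resp : ∀ {γ γ′ S S′ B B′} → γ ≃ γ′ → S ≐ S′ → B ≐ B′ → ∀ x → Bad γ S B x → Bad γ′ S′ B′ x
    Bad-resp γ≃ (s , _) (b , _) x (Bx , u) = b x Bx , λ δ p →
      let (y , (By , ¬xy) , c) = u δ (≺-≼-trans p (proj₂ γ≃))
      in y , (b y By , ¬xy) , Big-mono (∖-mono R y s) ≼-refl c

    Core-unique : ∀ {γ γ′ S S′ T T′ B B′} → γ ≃ γ′ → S ≐ S′ → T ≐ T′ →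
                  Core γ S T B → Core γ′ S′ T′ B′ → B ≐ B′
    Core-unique γ≃ S≐ T≐ (stop _) (stop _) = T≐
    Core-unique γ≃ S≐ T≐ (stop g) (step (bad , _) _) =
      ⊥-elim (g _ (Bad-resp (≃-sym γ≃) (≐-sym S≐) (≐-sym T≐) _ bad))
    Core-unique γ≃ S≐ T≐ (step (bad , _) _) (stop g) = ⊥-elim (g _ (Bad-resp γ≃ S≐ T≐ _ bad))
    Core-unique γ≃ S≐ T≐ (step m c) (step m′ c′) = Core-unique γ≃ S≐
      (∖-resp T≐ (leastIn-unique (Bad-resp γ≃ S≐ T≐)
        (Bad-resp (≃-sym γ≃) (≐-sym S≐) (≐-sym T≐)) m m′)) c c′

    -- By the definition of `Bad`, discarding everything above a bad element keeps the set
    -- unbounded; `WT` ends the process.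
    core : ∀ {γ S T} → WT R T → Unbounded γ S T →
           Σ[ B ∈ (X → Set ℓ) ] Core γ S T B × B ⊆ T × Unbounded γ S B × (∀ x → ¬ Bad γ S B x)
    core {γ} {S} {T} (wt h) u with em {P = Σ[ x ∈ X ] Bad γ S T x}
    ... | no good = T , stop (λ x bad → good (x , bad)) , ⊆-refl , u , λ x bad → good (x , bad)
    ... | yes (x₀ , bad₀) with leastIn (Bad γ S T) x₀ bad₀
    ...   | x , bad@((Tx , u′) , _) with core (h x Tx) u′
    ...     | B , c , B⊆ , uB , good = B , step bad c , (λ y By → proj₁ (B⊆ y By)) , uB , good

    -- Tails are upper sets of S that shrink as τ grows. So no element of a layer between two tails
    -- lies above an element of a later layer.
    Tail : (S B : X → Set ℓ) → Ord ℓ → X → Set ℓ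
    Tail S B τ z = S z × Σ[ x ∈ X ] B x × Big R (S ∖[ R ] x) τ × R x z

    Tail-antitone : ∀ {S B τ ε} → τ ≼ ε → Tail S B ε ⊆ Tail S B τ
    Tail-antitone p z (Sz , x , Bx , c , xz) = Sz , x , Bx , Big-mono ⊆-refl p c , xz

    Tail-upper : ∀ {S B τ z z′} → S z′ → Tail S B τ z → R z z′ → Tail S B τ z′
    Tail-upper Sz′ (_ , x , Bx , c , xz) zz′ = Sz′ , x , Bx , c , tr xz zz′

    Layer : (S B : X → Set ℓ) → Ord ℓ → Ord ℓ → X → Set ℓ
    Layer S B τ ε = Tail S B τ ─ Tail S B ε

    Room : (S B : X → Set ℓ) → Ord ℓ → Ord ℓ → Set ℓ
    Room S B τ ε = τ ≺ ε × Big R (Layer S B τ ε) τ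

    Room-monoʳ : ∀ {S B} → Monotoneʳ (Room S B)
    Room-monoʳ {S} {B} (τ≺ε , c) p = ≺-≼-trans τ≺ε p ,
      Big-mono (λ z (v , ¬v) → v , λ v′ → ¬v (Tail-antitone {S} {B} p z v′)) ≼-refl c

    Room-antitoneˡ : ∀ {S B τ τ′ ε} → τ ≼ τ′ → Room S B τ′ ε → Room S B τ ε
    Room-antitoneˡ {S} {B} p (τ′≺ε , c) = ≼-≺-trans p τ′≺ε ,
      Big-mono (λ z (v , ¬v) → Tail-antitone {S} {B} p z v , ¬v) p c

    Next : (S B : X → Set ℓ) → Ord ℓ → Ord ℓ → Set (lsuc ℓ)
    Next S B τ ε = Room S B τ ε × ∀ ε′ → Room S B τ ε′ → ε ≼ ε′

    Tail-resp : ∀ {S S′ B B′ τ τ′} → S ≐ S′ → B ≐ B′ → τ ≃ τ′ → Tail S B τ ⊆ Tail S′ B′ τ′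
    Tail-resp (s , _) (b , _) τ≃ z (Sz , x , Bx , c , xz) =
      s z Sz , x , b x Bx , Big-mono (∖-mono R x s) (proj₂ τ≃) c , xz

    Layer-resp : ∀ {S S′ B B′ τ τ′ ε ε′} → S ≐ S′ → B ≐ B′ → τ ≃ τ′ → ε ≃ ε′ →
                 Layer S B τ ε ⊆ Layer S′ B′ τ′ ε′
    Layer-resp S≐ B≐ τ≃ ε≃ z (v , ¬v) = Tail-resp S≐ B≐ τ≃ z v ,
      λ v′ → ¬v (Tail-resp (≐-sym S≐) (≐-sym B≐) (≃-sym ε≃) z v′)

    Room-resp : ∀ {S S′ B B′ τ ε} → S ≐ S′ → B ≐ B′ → Room S B τ ε → Room S′ B′ τ ε
    Room-resp S≐ B≐ (τ≺ε , c) = τ≺ε , Big-mono (Layer-resp S≐ B≐ ≃-refl ≃-refl) ≼-refl c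

    Next-unique : ∀ {S S′ B B′ τ τ′ ε ε′} → S ≐ S′ → B ≐ B′ → τ ≃ τ′ →
                  Next S B τ ε → Next S′ B′ τ′ ε′ → ε ≃ ε′
    Next-unique {S} {S′} {B} {B′} S≐ B≐ τ≃ (r , m) (r′ , m′) =
        m _ (Room-antitoneˡ {S} {B} (proj₁ τ≃) (Room-resp (≐-sym S≐) (≐-sym B≐) r′))
      , m′ _ (Room-antitoneˡ {S′} {B′} (proj₂ τ≃) (Room-resp S≐ B≐ r))

    -- Graph S β z: z is the β-th term of a sequence in S, as long as the rank of S, none of whose
    -- terms lies below an earlier one.  A rank σ + τ is dealt with by splitting S at some x such that
    -- S ∖ x has rank at least σ; a rank closed under ⊕ by successive layers of S of large enough rank.

    data Graph (S : X → Set ℓ) : Ord ℓ → X → Set (lsuc ℓ) where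
      single : ∀ {γ β z} → Exact S γ → γ ≼ fin 1 → S z → β ≼ fin 0 → Graph S β z
      sumˡ   : ∀ {γ σ τ x β z} → Exact S γ → LastTerm γ σ τ → fin 0 ≺ σ →
               LeastIn (λ y → S y × Big R (S ∖[ R ] y) σ) x →
               β ≺ σ → Graph (S ∖[ R ] x) β z → Graph S β z
      sumʳ   : ∀ {γ σ τ x β β′ z} → Exact S γ → LastTerm γ σ τ → fin 0 ≺ σ →
               LeastIn (λ y → S y × Big R (S ∖[ R ] y) σ) x →
               β ≃ σ + β′ → Graph (λ y → S y × R x y) β′ z → Graph S β z
      -- The layer from ε to ε′ has rank at least ε, which exceeds every β in the block of δ; the
      -- layer from δ to ε is only known to have rank at least δ.
      layer  : ∀ {γ σ τ B δ ε ε′ β z} → Exact S γ → LastTerm γ σ τ → σ ≼ fin 0 → fin 1 ≺ γ →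
               Core γ S S B → Greedy.Chosen (Room S B) δ → δ ≼ β → ¬ Room S B δ β →
               Next S B δ ε → Next S B ε ε′ → Graph (Layer S B ε ε′) β z → Graph S β z

    Graph⇒∈ : ∀ {S β z} → Graph S β z → S z
    Graph⇒∈ (single _ _ Sz _) = Sz
    Graph⇒∈ (sumˡ _ _ _ _ _ G) = proj₁ (Graph⇒∈ G)
    Graph⇒∈ (sumʳ _ _ _ _ _ G) = proj₁ (Graph⇒∈ G)
    Graph⇒∈ (layer _ _ _ _ _ _ _ _ _ _ G) = proj₁ (proj₁ (Graph⇒∈ G))

    private
      1≺ : ∀ {γ σ τ : Ord ℓ} → LastTerm γ σ τ → fin 0 ≺ σ → fin 1 ≺ γ
      1≺ {σ = σ} L 0≺σ = ≼-≺-trans (sc-≼ 0≺σ) (≼-≺-trans (≼-+ˡ σ (fin 0))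
        (≺-≼-trans (+-monoʳ-≺ σ (LastTerm.positive L)) (proj₂ (LastTerm.decomposes L))))

      absurd₁ : ∀ {S S′ γ γ′} {C : Set a} → S ≐ S′ → Exact S γ → Exact S′ γ′ → fin 1 ≺ γ → γ′ ≼ fin 1 → C
      absurd₁ S≐ E E′ p q = ⊥-elim (≼⇒⊁ (≼-trans (proj₁ (Exact-unique S≐ E E′)) q) p)

      absurd₀ : ∀ {S S′ γ γ′ σ σ′ τ τ′} {C : Set a} → S ≐ S′ → Exact S γ → Exact S′ γ′ →
                LastTerm γ σ τ → LastTerm γ′ σ′ τ′ → fin 0 ≺ σ → σ′ ≼ fin 0 → C
      absurd₀ S≐ E E′ L L′ p q =
        ⊥-elim (≼⇒⊁ (≼-trans (proj₁ (proj₁ (lastTerm-unique L L′ (Exact-unique S≐ E E′)))) q) p)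

      σ-unique : ∀ {S S′ γ γ′ σ σ′ τ τ′} → S ≐ S′ → Exact S γ → Exact S′ γ′ →
                 LastTerm γ σ τ → LastTerm γ′ σ′ τ′ → σ ≃ σ′
      σ-unique S≐ E E′ L L′ = proj₁ (lastTerm-unique L L′ (Exact-unique S≐ E E′))

      pivot-unique : ∀ {S S′ σ σ′ x x′} → S ≐ S′ → σ ≃ σ′ →
                     LeastIn (λ y → S y × Big R (S ∖[ R ] y) σ) x →
                     LeastIn (λ y → S′ y × Big R (S′ ∖[ R ] y) σ′) x′ → R x x′ × R x′ x
      pivot-unique (s , s′) σ≃ = leastIn-unique
        (λ y (Sy , c) → s y Sy , Big-mono (∖-mono R y s) (proj₂ σ≃) c)
        (λ y (Sy , c) → s′ y Sy , Big-mono (∖-mono R y s′) (proj₁ σ≃) c)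

      above-resp : ∀ {S S′ : X → Set ℓ} {x x′} → S ≐ S′ → R x x′ × R x′ x →
                   (λ y → S y × R x y) ≐ (λ y → S′ y × R x′ y)
      above-resp (s , s′) (xx′ , x′x) =
        (λ y (Sy , xy) → s y Sy , tr x′x xy) , λ y (Sy , x′y) → s′ y Sy , tr xx′ x′y

    -- All data of the two derivations are unique up to equality, so that derivations beginning with
    -- different kinds of rank exclude each other, and those of the same kind split S in the same
    -- way.
    Graph-reflects : ∀ {S S′ β β′ z z′} → S ≐ S′ → Graph S β z → Graph S′ β′ z′ → R z z′ → β ≼ β′
    Graph-reflects S≐ (single _ _ _ β≼0) _ _ = ≼-trans β≼0 0≼
    Graph-reflects S≐ (sumˡ E L p _ _ _) (single E′ γ′≼1 _ _) _ = absurd₁ S≐ E E′ (1≺ L p) γ′≼1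
    Graph-reflects S≐ (sumʳ E L p _ _ _) (single E′ γ′≼1 _ _) _ = absurd₁ S≐ E E′ (1≺ L p) γ′≼1
    Graph-reflects S≐ (layer E _ _ p _ _ _ _ _ _ _) (single E′ γ′≼1 _ _) _ = absurd₁ S≐ E E′ p γ′≼1
    Graph-reflects S≐ (layer E L q _ _ _ _ _ _ _ _) (sumˡ E′ L′ p _ _ _) _ = absurd₀ (≐-sym S≐) E′ E L′ L p q
    Graph-reflects S≐ (layer E L q _ _ _ _ _ _ _ _) (sumʳ E′ L′ p _ _ _) _ = absurd₀ (≐-sym S≐) E′ E L′ L p q
    Graph-reflects S≐ (sumˡ E L p _ _ _) (layer E′ L′ q _ _ _ _ _ _ _ _) _ = absurd₀ S≐ E E′ L L′ p q
    Graph-reflects S≐ (sumʳ E L p _ _ _) (layer E′ L′ q _ _ _ _ _ _ _ _) _ = absurd₀ S≐ E E′ L L′ p q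
    Graph-reflects S≐ (sumˡ E L _ m _ G) (sumˡ E′ L′ _ m′ _ G′) zz′ =
      Graph-reflects (∖-resp S≐ (pivot-unique S≐ (σ-unique S≐ E E′ L L′) m m′)) G G′ zz′
    Graph-reflects S≐ (sumˡ E L _ _ β≺σ _) (sumʳ {β′ = β₁} E′ L′ _ _ β′≃ _) _ =
      ≼-trans (≺⇒≼ β≺σ) (≼-trans (proj₁ (σ-unique S≐ E E′ L L′)) (≼-trans (≼-+ˡ _ β₁) (proj₂ β′≃)))
    Graph-reflects S≐ (sumʳ E L _ m _ G) (sumˡ E′ L′ _ m′ _ G′) zz′ =
      ⊥-elim (proj₂ (Graph⇒∈ G′) (tr (proj₂ (pivot-unique S≐ (σ-unique S≐ E E′ L L′) m m′))
        (tr (proj₂ (Graph⇒∈ G)) zz′)))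
    Graph-reflects S≐ (sumʳ E L _ m β≃ G) (sumʳ E′ L′ _ m′ β′≃ G′) zz′ =
      let σ≃ = σ-unique S≐ E E′ L L′
          β₁≼ = Graph-reflects (above-resp S≐ (pivot-unique S≐ σ≃ m m′)) G G′ zz′
      in ≼-trans (proj₁ β≃) (≼-trans (+-mono-≼ (proj₁ σ≃) β₁≼) (proj₂ β′≃))
    Graph-reflects {S} {S′} {β} {β′} {z} {z′} S≐
      (layer {B = B} {δ} {ε} {ε₁} E _ _ _ C D _ ¬δβ N N₁ G)
      (layer {B = B′} {δ′} {ε′} {ε₁′} E′ _ _ _ C′ D′ δ′≼β′ ¬δ′β′ N′ N₁′ G′) zz′ = case (tri δ δ′)
      where
      B≐ = Core-unique (Exact-unique S≐ E E′) S≐ S≐ C C′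
      D→ : ∀ {δ} → Greedy.Chosen (Room S B) δ → Greedy.Chosen (Room S′ B′) δ
      D→ = Chosen′-resp (Room-monoʳ {S} {B}) (Room-monoʳ {S′} {B′}) (Room-resp S≐ B≐)
        (Room-resp (≐-sym S≐) (≐-sym B≐)) _ _ ≃-refl
      D← : ∀ {δ} → Greedy.Chosen (Room S′ B′) δ → Greedy.Chosen (Room S B) δ
      D← = Chosen′-resp (Room-monoʳ {S′} {B′}) (Room-monoʳ {S} {B}) (Room-resp (≐-sym S≐) (≐-sym B≐))
        (Room-resp S≐ B≐) _ _ ≃-refl
      case : Tri δ δ′ → β ≼ β′
      case (eq δ≃) =
        let ε≃ = Next-unique S≐ B≐ δ≃ N N′
            ε₁≃ = Next-unique S≐ B≐ ε≃ N₁ N₁′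
        in Graph-reflects (Layer-resp S≐ B≐ ε≃ ε₁≃ ,
             Layer-resp (≐-sym S≐) (≐-sym B≐) (≃-sym ε≃) (≃-sym ε₁≃)) G G′ zz′
      case (lt δ≺δ′) = ≼-trans (≺⇒≼ (⋠⇒≻ λ δ′≼β → ¬δβ (Room-monoʳ {S} {B} room δ′≼β))) δ′≼β′
        where
        room : Room S B δ δ′
        room = Chosen⇒ (Room-monoʳ {S} {B}) (D← D′) δ≺δ′ D
      -- If δ′ precedes δ, then ε′ ≼ δ and so ε₁′ ≼ ε. Hence z, and z′ above it, belong to the tail
      -- at ε₁′, where the layer of z′ has already ended.
      case (gt δ′≺δ) = ⊥-elim (proj₂ (Graph⇒∈ G′)
        (Tail-upper (proj₁ (proj₁ (Graph⇒∈ G′))) (Tail-antitone ε₁′≼ε z z∈) zz′))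
        where
        ε′≼δ : ε′ ≼ δ
        ε′≼δ = proj₂ N′ δ (Chosen⇒ (Room-monoʳ {S′} {B′}) (D→ D) δ′≺δ D′)
        ε₁′≼ε : ε₁′ ≼ ε
        ε₁′≼ε = proj₂ N₁′ ε (Room-antitoneˡ {S′} {B′} ε′≼δ (Room-resp S≐ B≐ (proj₁ N)))
        z∈ : Tail S′ B′ ε z
        z∈ = Tail-resp S≐ B≐ ≃-refl z (proj₁ (Graph⇒∈ G))

    module _ {γ : Ord ℓ} {S B : X → Set ℓ} (E : Exact S γ) (cl : Closed γ) (1≺γ : fin 1 ≺ γ)
             (B⊆S : B ⊆ S) (unbounded : Unbounded γ S B) (good : ∀ x → ¬ Bad γ S B x) where

      private
        bounded : ∀ x → B x → Σ[ ε ∈ Ord ℓ ] ε ≺ γ × ∀ z → B z → Big R (S ∖[ R ] z) ε → R x z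
        bounded x Bx with em {P = Σ[ ε ∈ Ord ℓ ] ε ≺ γ × ∀ z → B z → Big R (S ∖[ R ] z) ε → R x z}
        ... | yes r = r
        ... | no ¬r = ⊥-elim (good x (Bx , λ δ p → decidable-stable em λ ¬∃ →
                ¬r (δ , p , λ z Bz c → decidable-stable em λ ¬xz → ¬∃ (z , (Bz , ¬xz) , c))))

        room-between : ∀ {τ δ} x y → S x → R x y → Len R (S ∖[ R ] x) δ → WT R (S ∖[ R ] y) →
                       Big R (S ∖[ R ] y) (δ ⊕ τ) → Big R (λ z → (S ∖[ R ] y) z × R x z) τ
        room-between {τ} {δ} x y Sx xy l w c with Big-or-Len (WT-mono {S′ = λ z → (S ∖[ R ] y) z × R x z} (λ _ → proj₁) w) τ
        ... | inj₁ c′ = c′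
        ... | inj₂ (τ′ , τ′≺τ , l′) =
                ⊥-elim (≼⇒⊁ (Big⇒Len⇒≼ c (Len-∪ cover l l′)) (⊕-monoʳ-≺ δ τ′≺τ))
          where
          cover : ∀ z → (S ∖[ R ] y) z → (S ∖[ R ] x) z ⊎ (S ∖[ R ] y) z × R x z
          cover z Sz with em {P = R x z}
          ... | yes xz = inj₂ (Sz , xz)
          ... | no ¬xz = inj₁ (proj₁ Sz , ¬xz)

      room : ∀ τ → τ ≺ γ → Σ[ ε ∈ Ord ℓ ] ε ≺ γ × Room S B τ ε
      room τ τ≺γ =
        let (x , Bx , cx) = unbounded τ τ≺γ
            (δ , δ≺γ , lx) = Len-elim (proj₁ E) x (B⊆S x Bx)
            (εx , εx≺γ , bx) = bounded x Bx
            (y , By , cy) = unbounded ((δ ⊕ τ) ⊕ εx) (cl (cl δ≺γ τ≺γ) εx≺γ)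
            (εy , εy≺γ , by) = bounded y By
            xy = bx y By (Big-mono ⊆-refl (≼-⊕ʳ (δ ⊕ τ) εx) cy)
            (_ , _ , ly) = Len-elim (proj₁ E) y (B⊆S y By)
            c = room-between x y (B⊆S x Bx) xy lx (Len⇒WT ly) (Big-mono ⊆-refl (≼-⊕ˡ (δ ⊕ τ) εx) cy)
            -- The summand `εy` forces the generators of the tail at ε above y, so this tail misses
            -- `S ∖[ R ] y`; the summand `τ ⊕ fin 1` puts ε above τ.
            ε = εy ⊕ (τ ⊕ fin 1)
            τ≺ε = ≺-≼-trans (≼-≺-trans (≼-⊕ˡ τ (fin 0)) (⊕-monoʳ-≺ τ ≺sc)) (≼-⊕ʳ εy (τ ⊕ fin 1))
        in ε , cl εy≺γ (cl τ≺γ 1≺γ) , τ≺ε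
         , Big-mono (λ z ((Sz , ¬yz) , xz) → (Sz , x , Bx , cx , xz) ,
             λ (_ , x′ , Bx′ , cx′ , x′z) →
               ¬yz (tr (by x′ Bx′ (Big-mono ⊆-refl (≼-⊕ˡ εy (τ ⊕ fin 1)) cx′)) x′z)) ≼-refl c

      next : ∀ τ → τ ≺ γ → Σ[ ε ∈ Ord ℓ ] ε ≺ γ × Next S B τ ε
      next τ τ≺γ =
        let (ε₀ , ε₀≺γ , r₀) = room τ τ≺γ
            (ε , r , m) = least (Room S B τ) r₀
        in ε , ≼-≺-trans (m ε₀ r₀) ε₀≺γ , r , m

    module _ (γ : Ord ℓ) (ih : ∀ δ → δ ≺ γ → ∀ T → Exact T δ → ∀ β → β ≺ δ → Σ[ z ∈ X ] Graph T β z)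
             (S : X → Set ℓ) (E : Exact S γ) where

      private
        rec : ∀ {T δ ζ} → Len R T δ → δ ≺ γ → Big R T ζ → ∀ β → β ≺ ζ → Σ[ z ∈ X ] Graph T β z
        rec {T} l p c β q =
          let (ρ , l′ , c′) = rankOf (Len⇒WT l)
          in ih ρ (≼-≺-trans (Big⇒Len⇒≼ c′ l) p) T (l′ , c′) β (≺-≼-trans q (Big⇒Len⇒≼ c l′))

        graph-layer : ∀ {σ τ} → LastTerm γ σ τ → σ ≼ fin 0 → fin 1 ≺ γ → ∀ β → β ≺ γ → Σ[ z ∈ X ] Graph S β z
        graph-layer {σ} {τ} L σ≼0 1≺γ β β≺γ =
          let τ≃γ = ≼-trans (≼-+ʳ σ τ) (proj₂ (LastTerm.decomposes L))
                  , ≼-trans (proj₁ (LastTerm.decomposes L)) (≼-trans (+-mono-≼ σ≼0 ≼-refl) (proj₁ (+-identityˡ τ)))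
              cl = Closed-resp-≃ τ≃γ (lastTerm-Closed L)
              (B , C , B⊆S , u , good) = core (Len⇒WT (proj₁ E)) (λ δ p → Big-elim (proj₂ E) p)
              (δ , D , δ≼β , ¬δβ) = block (Room-monoʳ {S} {B}) (λ (p , _) → ≺-irrefl p) β
              nxt = next E cl 1≺γ B⊆S u good
              (ε , ε≺γ , N) = nxt δ (≼-≺-trans δ≼β β≺γ)
              (ε′ , ε′≺γ , N′) = nxt ε ε≺γ
              β≺ε = ⋠⇒≻ λ ε≼β → ¬δβ (Room-monoʳ {S} {B} (proj₁ N) ε≼β)
              -- Since x generates part of the tail at ε′, the layer contains nothing above x; it
              -- thus has rank below γ, and the induction hypothesis applies.
              (x , Bx , cx) = u ε′ ε′≺γ
              (ρ , ρ≺γ , l) = Len-elim (proj₁ E) x (B⊆S x Bx)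
              l′ = Len-mono (λ z ((Sz , _) , ¬v) → Sz , λ xz → ¬v (Sz , x , Bx , cx , xz)) ≼-refl l
              (z , G) = rec l′ ρ≺γ (proj₂ (proj₁ N′)) β β≺ε
          in z , layer E L σ≼0 1≺γ C D δ≼β ¬δβ N N′ G

        -- S is covered by `S ∖[ R ] x` and the part above x. Were the latter of rank below the last
        -- term τ, the natural sum would stay below γ by `lastTerm-⊕`.
        above-Big : ∀ {σ τ δ x} → LastTerm γ σ τ → δ ≺ γ → Len R (S ∖[ R ] x) δ → Big R (λ y → S y × R x y) τ
        above-Big {σ} {τ} {δ} {x} L δ≺γ l
          with Big-or-Len (WT-mono {S′ = λ y → S y × R x y} (λ _ → proj₁) (Len⇒WT (proj₁ E))) τ
        ... | inj₁ c = c
        ... | inj₂ (β , β≺τ , l′) =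
                ⊥-elim (≼⇒⊁ (Big⇒Len⇒≼ (proj₂ E) (Len-∪ cover l l′)) (lastTerm-⊕ L δ≺γ β≺τ))
          where
          cover : ∀ z → S z → (S ∖[ R ] x) z ⊎ S z × R x z
          cover z Sz with em {P = R x z}
          ... | yes xz = inj₂ (Sz , xz)
          ... | no ¬xz = inj₁ (Sz , ¬xz)

        graph-sum : ∀ {σ τ} → LastTerm γ σ τ → fin 0 ≺ σ → ∀ β → β ≺ γ → Σ[ z ∈ X ] Graph S β z
        graph-sum {σ} {τ} L 0≺σ β β≺γ =
          let γ≃ = LastTerm.decomposes L
              σ≺γ = ≼-≺-trans (≼-+ˡ σ (fin 0)) (≺-≼-trans (+-monoʳ-≺ σ (LastTerm.positive L)) (proj₂ γ≃))
              (x₀ , Sx₀ , c₀) = Big-elim (proj₂ E) σ≺γ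
              (x , m) = leastIn (λ y → S y × Big R (S ∖[ R ] y) σ) x₀ (Sx₀ , c₀)
              ((Sx , c) , _) = m
              (δ , δ≺γ , l) = Len-elim (proj₁ E) x Sx
          in case x m c δ δ≺γ l (compare σ β)
          where
          case : ∀ x → LeastIn (λ y → S y × Big R (S ∖[ R ] y) σ) x → Big R (S ∖[ R ] x) σ →
                 ∀ δ → δ ≺ γ → Len R (S ∖[ R ] x) δ → σ ≼ β ⊎ β ≺ σ → Σ[ z ∈ X ] Graph S β z
          case x m c δ δ≺γ l (inj₂ β≺σ) =
            let (z , G) = rec l δ≺γ c β β≺σ in z , sumˡ E L 0≺σ m β≺σ G
          case x m c δ δ≺γ l (inj₁ σ≼β) =
            let (β′ , β≃) = subtract σ≼β
                γ≃ = LastTerm.decomposes L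
                β′≺τ = +-cancelˡ-≺ σ (≼-≺-trans (proj₂ β≃) (≺-≼-trans β≺γ (proj₁ γ≃)))
                τ≺γ = ⋠⇒≻ λ γ≼τ → ≼⇒⊁ (LastTerm.σ-least L (≼-trans γ≼τ (proj₂ (+-identityˡ τ)) ,
                        ≼-trans (proj₁ (+-identityˡ τ)) (≼-trans (≼-+ʳ σ τ) (proj₂ γ≃)))) 0≺σ
                lU = Len-complement {B = λ y → S y × R x y} (λ _ → proj₁) (λ _ → proj₁)
                       (λ u v (_ , ¬xu) (_ , xv) vu → ¬xu (tr xv vu)) c
                       (Len-mono ⊆-refl (proj₁ γ≃) (proj₁ E))
                (z , G) = rec lU τ≺γ (above-Big L δ≺γ l) β′ β′≺τ
            in z , sumʳ E L 0≺σ m β≃ G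

      graph-step : ∀ β → β ≺ γ → Σ[ z ∈ X ] Graph S β z
      graph-step β β≺γ with compare γ (fin 1)
      ... | inj₁ γ≼1 = let (z , Sz , _) = Big-elim (proj₂ E) β≺γ in
            z , single E γ≼1 Sz (≺sc⇒≼ (≺-≼-trans β≺γ γ≼1))
      ... | inj₂ 1≺γ with lastTerm (≼-≺-trans 0≼ 1≺γ)
      ...   | σ , τ , L with compare σ (fin 0)
      ...     | inj₁ σ≼0 = graph-layer L σ≼0 1≺γ β β≺γ
      ...     | inj₂ 0≺σ = graph-sum L 0≺σ β β≺γ

    graph : ∀ γ S → Exact S γ → ∀ β → β ≺ γ → Σ[ z ∈ X ] Graph S β z
    graph = ≺-rec _ graph-step

    reflectingMap : ∀ {S γ} → WT R S → Big R S γ →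
      Σ[ e ∈ (∀ β → β ≺ γ → X) ] (∀ β p → S (e β p)) × (∀ β p β′ p′ → R (e β p) (e β′ p′) → β ≼ β′)
    reflectingMap {S} {γ} w c =
      let (ρ , l , c′) = rankOf w
          γ≼ρ = Big⇒Len⇒≼ c l
          G = λ β p → graph ρ S (l , c′) β (≺-≼-trans p γ≼ρ)
      in (λ β p → proj₁ (G β p)) , (λ β p → Graph⇒∈ (proj₂ (G β p)))
       , λ β p β′ p′ r → Graph-reflects ≐-refl (proj₂ (G β p)) (proj₂ (G β′ p′)) r

  -- Injections and initial ordinals

  -- A small type of codes for all ordinals below α up to `_≃_`. The ordinals below α themselves
  -- form a large type, and `Idx α` reaches only a cofinal family of them.
  El : Ord ℓ → Set ℓ
  El (lsub I f) = Σ[ i ∈ I ] Maybe (El (f i))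

  val : (α : Ord ℓ) → El α → Ord ℓ
  val (lsub I f) (i , nothing) = f i
  val (lsub I f) (i , just p)  = val (f i) p

  val-≺ : (α : Ord ℓ) (p : El α) → val α p ≺ α
  val-≺ (lsub I f) (i , nothing) = !-≺ i
  val-≺ (lsub I f) (i , just p)  = ≺-intro i (≺⇒≼ (val-≺ (f i) p))

  find : (α : Ord ℓ) → β ≺ α → Σ[ p ∈ El α ] val α p ≃ β
  find {β = β} (lsub I f) p with ≺-elim p
  ... | i , q with compare (f i) β
  ...   | inj₁ r = (i , nothing) , r , q
  ...   | inj₂ r = let (x , e) = find (f i) r in (i , just x) , e

  -- The order type of the set of those elements of α that satisfy P.

  module OrderType {ℓ} (P : Ord ℓ → Set ℓ) (P-resp : ∀ {β γ} → β ≃ γ → P β → P γ) where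

    type  : Ord ℓ → Ord ℓ
    -- This stands for `type (val α p)`, in a form that keeps the recursion structural.
    typeᵛ : (α : Ord ℓ) → El α → Ord ℓ

    type α = lsub (Σ[ p ∈ El α ] P (val α p)) (λ (p , _) → typeᵛ α p)

    typeᵛ (lsub I f) (i , nothing) = type (f i)
    typeᵛ (lsub I f) (i , just p)  = typeᵛ (f i) p

    typeᵛ≡ : (α : Ord ℓ) (p : El α) → typeᵛ α p ≡ type (val α p)
    typeᵛ≡ (lsub I f) (i , nothing) = refl
    typeᵛ≡ (lsub I f) (i , just p)  = typeᵛ≡ (f i) p

    type-lub : (∀ β → β ≺ α → P β → type β ≺ γ) → type α ≼ γ
    type-lub {α = α} {γ = γ} h = ≼-intro λ (p , Pp) →
      subst (_≺ γ) (sym (typeᵛ≡ α p)) (h (val α p) (val-≺ α p) Pp)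

    type-≺ : γ ≺ type α → Σ[ β ∈ Ord ℓ ] β ≺ α × P β × γ ≼ type β
    type-≺ {γ = γ} {α = α} q =
      let ((p , Pp) , r) = ≺-elim q
      in val α p , val-≺ α p , Pp , subst (γ ≼_) (typeᵛ≡ α p) r

    private
      type-intro-val : (p : El α) → P (val α p) → type (val α p) ≺ type α
      type-intro-val {α = α} p Pp = ≺-intro (p , Pp) (subst (type (val α p) ≼_) (sym (typeᵛ≡ α p)) ≼-refl)

    type-mono-≼ : ∀ α β → α ≼ β → type α ≼ type β
    type-mono-≼ = ≺-rec _ λ α ih β α≼β → type-lub λ γ γ≺α Pγ →
      let (q , e) = find β (≺-≼-trans γ≺α α≼β)
      in ≼-≺-trans (ih γ γ≺α (val β q) (proj₂ e)) (type-intro-val q (P-resp (≃-sym e) Pγ))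

    type-mono-≺ : ∀ {α β} → β ≺ α → P β → type β ≺ type α
    type-mono-≺ {α} {β} β≺α Pβ =
      let (p , e) = find α β≺α
      in ≼-≺-trans (type-mono-≼ β (val α p) (proj₂ e)) (type-intro-val p (P-resp (≃-sym e) Pβ))

    type-cong : ∀ {α β} → α ≃ β → type α ≃ type β
    type-cong (p , q) = type-mono-≼ _ _ p , type-mono-≼ _ _ q

    type-≼ : ∀ α → type α ≼ α
    type-≼ = ≺-rec _ λ α ih → type-lub λ β β≺α _ → ≼-≺-trans (ih β β≺α) β≺α

    type-surjective : ∀ α {γ} → γ ≺ type α → Σ[ β ∈ Ord ℓ ] β ≺ α × P β × γ ≃ type β
    type-surjective = ≺-rec _ step
      where
      step : ∀ α → (∀ β → β ≺ α → ∀ {γ} → γ ≺ type β → Σ[ δ ∈ Ord ℓ ] δ ≺ β × P δ × γ ≃ type δ) →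
             ∀ {γ} → γ ≺ type α → Σ[ β ∈ Ord ℓ ] β ≺ α × P β × γ ≃ type β
      step α ih {γ} p with type-≺ p
      ... | β , β≺α , Pβ , γ≼ with compare (type β) γ
      ...   | inj₁ q = β , β≺α , Pβ , γ≼ , q
      ...   | inj₂ q = let (δ , δ≺β , Pδ , e) = ih β β≺α q in δ , ≺-trans δ≺β β≺α , Pδ , e

    type-injective : ∀ {β γ} → P β → P γ → type β ≃ type γ → β ≃ γ
    type-injective {β} {γ} Pβ Pγ e with tri β γ
    ... | eq r = r
    ... | lt r = ⊥-elim (≼⇒⊁ (proj₂ e) (type-mono-≺ r Pβ))
    ... | gt r = ⊥-elim (≼⇒⊁ (proj₁ e) (type-mono-≺ r Pγ))

  Injective′ : (α : Ord ℓ) → (El α → Ord ℓ) → Set ℓ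
  Injective′ α φ = ∀ x y → φ x ≃ φ y → val α x ≃ val α y

  -- φ may take different values at codes of the same ordinal. Codes with the least value determine
  -- that value up to `_≃_`.
  Least-in-class : (α : Ord ℓ) → (El α → Ord ℓ) → El α → Set ℓ
  Least-in-class α φ x = ∀ y → val α y ≃ val α x → φ x ≼ φ y

  leastInClass : (α : Ord ℓ) (φ : El α → Ord ℓ) → β ≺ α →
                 Σ[ x ∈ El α ] val α x ≃ β × Least-in-class α φ x
  leastInClass α φ p =
    let (x₀ , e₀) = find α p
        (_ , (x , e , r) , m) = least (λ γ → Σ[ x ∈ El α ] val α x ≃ _ × φ x ≃ γ) (x₀ , e₀ , ≃-refl)
    in x , e , λ y e′ → ≼-trans (proj₁ r) (m _ (y , ≃-trans e′ e , ≃-refl))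

  leastInClass-cong : (α : Ord ℓ) (φ : El α → Ord ℓ) → ∀ {x y} → Least-in-class α φ x →
                      Least-in-class α φ y → val α x ≃ val α y → φ x ≃ φ y
  leastInClass-cong α φ mx my e = mx _ (≃-sym e) , my _ e

  infix 4 _↪_
  _↪_ : Ord ℓ → Ord ℓ → Set ℓ
  α ↪ β = Σ[ φ ∈ (El α → El β) ] Injective′ α (val β ∘ φ)

  ↪-intro : (φ : El α → Ord ℓ) → (∀ x → φ x ≺ β) → Injective′ α φ → α ↪ β
  ↪-intro {β = β} φ φ≺ inj = (λ x → proj₁ (find β (φ≺ x))) , λ x y e → inj x y
    (≃-trans (≃-sym (proj₂ (find β (φ≺ x)))) (≃-trans e (proj₂ (find β (φ≺ y)))))

  ≼⇒↪ : α ≼ β → α ↪ β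
  ≼⇒↪ {α = α} p = ↪-intro (val α) (λ x → ≺-≼-trans (val-≺ α x) p) λ _ _ e → e

  ↪-trans : α ↪ β → β ↪ γ → α ↪ γ
  ↪-trans (φ , i) (ψ , j) = ψ ∘ φ , λ x y e → i x y (j _ _ e)

  ↪-cong : α ↪ β → Σ[ φ ∈ (El α → El β) ] Injective′ α (val β ∘ φ) ×
                    (∀ x y → val α x ≃ val α y → val β (φ x) ≃ val β (φ y))
  ↪-cong {α = α} {β = β} (φ , i) =
      φ ∘ rep , (λ x y e → ≃-trans (≃-sym (rep≃ x)) (≃-trans (i _ _ e) (rep≃ y)))
    , λ x y e → leastInClass-cong α (val β ∘ φ) (rep-least x) (rep-least y)
        (≃-trans (rep≃ x) (≃-trans e (≃-sym (rep≃ y))))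
    where
    rep : El α → El α
    rep x = proj₁ (leastInClass α (val β ∘ φ) (val-≺ α x))
    rep≃ : ∀ x → val α (rep x) ≃ val α x
    rep≃ x = proj₁ (proj₂ (leastInClass α (val β ∘ φ) (val-≺ α x)))
    rep-least : ∀ x → Least-in-class α (val β ∘ φ) (rep x)
    rep-least x = proj₂ (proj₂ (leastInClass α (val β ∘ φ) (val-≺ α x)))

  Equipotent⇒↪ : Equipotent α β → α ↪ β
  Equipotent⇒↪ {α = α} {β = β} E = ↪-intro (λ x → proj₁ (B.to (below x))) (λ x → ⟨ proj₂ (B.to (below x)) ⟩)
    λ x y e → ≈⇒≃ (B.injective {below x} {below y} (≃⇒≈ e))
    where
    module B = Bijection E
    below : El α → Σ[ γ ∈ Ord _ ] γ < α
    below x = val α x , un≺ (val-≺ α x)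

  Equipotent-refl : Equipotent α α
  Equipotent-refl = record
    { to = id ; cong = id ; bijective = id , λ y → y , id }

  Initial : Ord ℓ → Set (lsuc ℓ)
  Initial κ = ∀ β → Equipotent κ β → κ ≼ β

  module _ {κ : Ord ℓ} (φ : El κ → Ord ℓ) (inj : Injective′ κ φ) where

    Image : Ord ℓ → Set ℓ
    Image γ = Σ[ x ∈ El κ ] φ x ≃ γ × Least-in-class κ φ x

    Image-resp : ∀ {β γ} → β ≃ γ → Image β → Image γ
    Image-resp e (x , r , m) = x , ≃-trans r e , m

    open OrderType Image Image-resp

    -- Through least codes, φ becomes a bijection from κ onto its image, and the image is in
    -- bijection with its order type; κ, being initial, is at most that type.
    Initial⇒≼type : Initial κ → ∀ s → (∀ x → φ x ≺ s) → κ ≼ type s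
    Initial⇒≼type init s φ≺ = init (type s) record
      { to = λ (β , p) → type (φ (rep ⟨ p ⟩)) , un≺ (type-mono-≺ (φ≺ (rep ⟨ p ⟩)) (rep∈ ⟨ p ⟩))
      ; cong = λ { {_ , p} {_ , q} e → ≃⇒≈ (type-cong (leastInClass-cong κ φ (rep-least ⟨ p ⟩) (rep-least ⟨ q ⟩)
          (≃-trans (rep≃ ⟨ p ⟩) (≃-trans (≈⇒≃ e) (≃-sym (rep≃ ⟨ q ⟩)))))) }
      ; bijective =
          (λ { {_ , p} {_ , q} e → ≃⇒≈ (≃-trans (≃-sym (rep≃ ⟨ p ⟩)) (≃-trans
            (inj _ _ (type-injective (rep∈ ⟨ p ⟩) (rep∈ ⟨ q ⟩) (≈⇒≃ e))) (rep≃ ⟨ q ⟩))) })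
        , λ (γ , q) →
            let (β , β≺s , (x , r , m) , γ≃) = type-surjective s ⟨ q ⟩
            in (val κ x , un≺ (val-≺ κ x)) , λ { {_ , p} e → ≃⇒≈ (≃-trans (type-cong
                 (≃-trans (leastInClass-cong κ φ (rep-least ⟨ p ⟩) m (≃-trans (rep≃ ⟨ p ⟩) (≈⇒≃ e))) r)) (≃-sym γ≃)) }
      }
      where
      rep : β ≺ κ → El κ
      rep p = proj₁ (leastInClass κ φ p)
      rep≃ : (p : β ≺ κ) → val κ (rep p) ≃ β
      rep≃ p = proj₁ (proj₂ (leastInClass κ φ p))
      rep-least : (p : β ≺ κ) → Least-in-class κ φ (rep p)
      rep-least p = proj₂ (proj₂ (leastInClass κ φ p))
      rep∈ : (p : β ≺ κ) → Image (φ (rep p))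
      rep∈ p = rep p , ≃-refl , rep-least p

  Initial⇒↪⇒≼ : Initial κ → κ ↪ α → κ ≼ α
  Initial⇒↪⇒≼ {α = α} init (φ , inj) =
    ≼-trans (Initial⇒≼type (val α ∘ φ) inj init α (λ x → val-≺ α (φ x)))
      (OrderType.type-≼ _ (Image-resp (val α ∘ φ) inj) α)

  fin-mono-≺ : ∀ {k m} → k ℕ.< m → fin {ℓ} k ≺ fin m
  fin-mono-≺ {k = zero} (ℕ.s≤s _) = ≺-intro _ 0≼
  fin-mono-≺ {k = suc k} (ℕ.s≤s p) = ≺-intro _ (sc-≼ (fin-mono-≺ p))

  ¬ω↪fin : ∀ k → ¬ ω {ℓ} ↪ fin k
  ¬ω↪fin {ℓ} k (φ , inj) =
    let (i , j , i<j , e) = pigeonhole (ℕₚ.n<1+n k) digit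
    in ≼⇒⊁ (proj₂ (collide i j e)) (fin-mono-≺ i<j)
    where
    pt : (m : ℕ) → Σ[ x ∈ El ω ] val ω x ≃ fin {ℓ} m
    pt m = find ω (fin≺ω m)
    img : (i : Fin (suc k)) → Σ[ m ∈ Fin k ] val (fin k) (φ (proj₁ (pt (toℕ i)))) ≃ fin (toℕ m)
    img i = ≺-fin⇒ k (val-≺ (fin k) (φ (proj₁ (pt (toℕ i)))))
    digit : Fin (suc k) → Fin k
    digit i = proj₁ (img i)
    collide : ∀ i j → digit i ≡ digit j → fin {ℓ} (toℕ i) ≃ fin (toℕ j)
    collide i j e = ≃-trans (≃-sym (proj₂ (pt (toℕ i)))) (≃-trans
      (inj _ _ (≃-trans (proj₂ (img i)) (≃-trans
        (subst (λ m → fin {ℓ} (toℕ (digit i)) ≃ fin (toℕ m)) e ≃-refl) (≃-sym (proj₂ (img j))))))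
      (proj₂ (pt (toℕ j))))

  ω≼-resp-↪ : ω ≼ α → α ↪ κ → ω ≼ κ
  ω≼-resp-↪ {κ = κ} p i with compare ω κ
  ... | inj₁ q = q
  ... | inj₂ q = let (k , r) = ≺ω⇒ q in ⊥-elim (¬ω↪fin k (↪-trans (≼⇒↪ p) (↪-trans i (≼⇒↪ r))))

  1+≼ : ω ≼ γ → fin 1 + γ ≼ γ
  1+≼ {γ = γ} ω≼γ =
    let (β , γ≃) = subtract ω≼γ
    in ≼-trans (+-mono-≼ ≼-refl (proj₁ γ≃)) (≼-trans (proj₂ (+-assoc (fin 1) ω β))
         (≼-trans (+-mono-≼ 1+ω≼ ≼-refl) (proj₂ γ≃)))
    where
    1+ω≼ : fin 1 + ω {ℓ} ≼ ω
    1+ω≼ = +-lub {α = fin 1} {β = ω} (λ _ → fin≺ω 0)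
      λ (lift k) → ≼-≺-trans (≼-trans (+≼⊕ (fin 1) (fin k)) (fin-⊕ 1 k)) (fin≺ω (suc k))

  -- `fin 2 · β` consists of β successive pairs, which at a limit amounts to β again. Only the
  -- finite part of β above its last limit costs something.
  double-≼ : (β : Ord ℓ) → Σ[ k ∈ ℕ ] fin 2 · β ≼ β + fin k
  double-≼ = ≺-rec _ step
    where
    step : (β : Ord ℓ) → (∀ γ → γ ≺ β → Σ[ k ∈ ℕ ] fin 2 · γ ≼ γ + fin k) → Σ[ k ∈ ℕ ] fin 2 · β ≼ β + fin k
    step β ih with em {P = Σ[ γ ∈ Ord _ ] γ ≺ β × β ≼ sc γ}
    ... | yes (γ , γ≺β , β≼) = let (k , p) = ih γ γ≺β in k ℕ.+ 2 ,
            ≼-trans (·-monoʳ-≼ (fin 2) β≼) (≼-trans (proj₁ (·-sc (fin 2) γ))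
              (≼-trans (+-mono-≼ p ≼-refl) (≼-trans (proj₁ (+-assoc γ (fin k) (fin 2)))
                (+-mono-≼ (≺⇒≼ γ≺β) (≼-trans (+≼⊕ (fin k) (fin 2)) (fin-⊕ k 2))))))
    ... | no limit = 0 , ≼-trans (·-lub {κ = fin 2} {π = β} λ j i →
            let (k , p) = ih (β ! j) (!-≺ j) in
            ≼-≺-trans (+-mono-≼ p (≺⇒≼ (!-≺ {α = fin 2} i)))
              (≼-≺-trans (proj₁ (+-assoc (β ! j) (fin k) (fin 2)))
                (≼-≺-trans (+-mono-≼ ≼-refl (≼-trans (+≼⊕ (fin k) (fin 2)) (fin-⊕ k 2)))
                  (+fin≺ (!-≺ j) (k ℕ.+ 2)))))
          (≼-+ˡ β (fin 0))
      where
      +fin≺ : γ ≺ β → ∀ k → γ + fin k ≺ β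
      +fin≺ {γ} p zero = ≼-≺-trans (proj₁ (+-identityʳ γ)) p
      +fin≺ {γ} p (suc k) = ≼-≺-trans (proj₁ (+-sc γ (fin k)))
        (⋠⇒≻ λ q → limit (γ + fin k , +fin≺ p k , q))

  -- Closure properties of infinite initial ordinals.

  module InitialOrdinal {ℓ} {κ : Ord ℓ} (init : Initial κ) (ω≼κ : ω ≼ κ) where

    0≺κ : fin 0 ≺ κ
    0≺κ = ≺-≼-trans (fin≺ω 0) ω≼κ

    private
      shift : sc γ ↪ γ → γ ≺ κ → sc γ ≺ κ
      shift i γ≺κ = ⋠⇒≻ λ κ≼ → ≼⇒⊁ (Initial⇒↪⇒≼ init (↪-trans (≼⇒↪ κ≼) i)) γ≺κ

      -- Hilbert's hotel: the top element moves to 0 and all others move up by one, with room enough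
      -- because γ is infinite.
      sc↪ : {γ : Ord ℓ} → ω ≼ γ → sc γ ↪ γ
      sc↪ {γ} ω≼γ = ↪-intro {α = sc γ} (λ x → φ (compare γ (v x))) (λ x → φ≺ x (compare γ (v x)))
        λ x y → φ-inj x y (compare γ (v x)) (compare γ (v y))
        where
        v = val (sc γ)
        φ : ∀ {β} → γ ≼ β ⊎ β ≺ γ → Ord ℓ
        φ (inj₁ _) = fin 0
        φ {β} (inj₂ _) = fin 1 + β
        φ≺ : ∀ x (c : γ ≼ v x ⊎ v x ≺ γ) → φ c ≺ γ
        φ≺ x (inj₁ _) = ≺-≼-trans (fin≺ω 0) ω≼γ
        φ≺ x (inj₂ p) = ≺-≼-trans (+-monoʳ-≺ (fin 1) p) (1+≼ ω≼γ)
        1+≻ : ∀ β → fin {ℓ} 0 ≺ fin 1 + β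
        1+≻ β = ≺-≼-trans ≺sc (≼-+ˡ (fin 1) β)
        φ-inj : ∀ x y (c : γ ≼ v x ⊎ v x ≺ γ) (d : γ ≼ v y ⊎ v y ≺ γ) → φ c ≃ φ d → v x ≃ v y
        φ-inj x y (inj₁ p) (inj₁ q) _ =
          ≼-trans (≺sc⇒≼ (val-≺ (sc γ) x)) q , ≼-trans (≺sc⇒≼ (val-≺ (sc γ) y)) p
        φ-inj x y (inj₁ _) (inj₂ _) e = ⊥-elim (≼⇒⊁ (proj₂ e) (1+≻ (v y)))
        φ-inj x y (inj₂ _) (inj₁ _) e = ⊥-elim (≼⇒⊁ (proj₁ e) (1+≻ (v x)))
        φ-inj x y (inj₂ _) (inj₂ _) e = +-cancelˡ-≼ (fin 1) (proj₁ e) , +-cancelˡ-≼ (fin 1) (proj₂ e)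

    sc-closed : γ ≺ κ → sc γ ≺ κ
    sc-closed {γ = γ} γ≺κ with compare ω γ
    ... | inj₁ ω≼γ = shift (sc↪ ω≼γ) γ≺κ
    ... | inj₂ γ≺ω = let (k , p) = ≺ω⇒ γ≺ω in
          ≺-≼-trans (≼-≺-trans (sc-≼ (≼-≺-trans p ≺sc)) (fin≺ω (suc k))) ω≼κ

    +fin-closed : γ ≺ κ → ∀ k → γ + fin k ≺ κ
    +fin-closed {γ = γ} p zero = ≼-≺-trans (proj₁ (+-identityʳ γ)) p
    +fin-closed {γ = γ} p (suc k) = ≼-≺-trans (proj₁ (+-sc γ (fin k))) (sc-closed (+fin-closed p k))

    double-closed : γ ≺ κ → fin 2 · γ ≺ κ
    double-closed {γ = γ} p = let (k , q) = double-≼ γ in ≼-≺-trans q (+fin-closed p k)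

    private
      -- The two copies of γ go to the first and the second places of γ pairs. With `double-closed`
      -- this yields closure under sums without cardinal multiplication.
      +↪double : (γ : Ord ℓ) → γ + γ ↪ fin 2 · γ
      +↪double γ = ↪-intro {α = γ + γ} (λ x → φ (split x)) (λ x → φ≺ (split x)) λ x y → φ-inj (split x) (split y)
        where
        Split : Ord ℓ → Set (lsuc ℓ)
        Split β = β ≺ γ ⊎ Σ[ δ ∈ Ord ℓ ] δ ≺ γ × β ≃ γ + δ
        split : ∀ x → Split (val (γ + γ) x)
        split x with compare γ (val (γ + γ) x)
        ... | inj₂ p = inj₁ p
        ... | inj₁ p = let (δ , e) = subtract p in
              inj₂ (δ , +-cancelˡ-≺ γ (≼-≺-trans (proj₂ e) (val-≺ (γ + γ) x)) , e)
        φ : ∀ {β} → Split β → Ord ℓ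
        φ {β} (inj₁ _)   = fin 2 · β + fin 0
        φ (inj₂ (δ , _)) = fin 2 · δ + fin 1
        0≺2 : fin {ℓ} 0 ≺ fin 2
        0≺2 = ≺-trans ≺sc ≺sc
        φ≺ : ∀ {β} (s : Split β) → φ s ≺ fin 2 · γ
        φ≺ (inj₁ p)           = ·-intro (fin 2) γ p 0≺2
        φ≺ (inj₂ (_ , p , _)) = ·-intro (fin 2) γ p ≺sc
        mixed : ∀ α β → ¬ (fin {ℓ} 2 · α + fin 0 ≃ fin 2 · β + fin 1)
        mixed α β e = ≼⇒⊁ (+-cancelˡ-≼ (fin 2 · α) (≼-trans
          (+-mono-≼ (·-monoʳ-≼ (fin 2) (·-cancel-≼ {σ = fin 0} (fin 2) ≺sc (proj₁ e))) ≼-refl) (proj₂ e))) ≺sc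
        φ-inj : ∀ {β β′} (s : Split β) (t : Split β′) → φ s ≃ φ t → β ≃ β′
        φ-inj (inj₁ _) (inj₁ _) e =
          ·-cancel-≼ {σ = fin 0} (fin 2) 0≺2 (proj₁ e) , ·-cancel-≼ {σ = fin 0} (fin 2) 0≺2 (proj₂ e)
        φ-inj {β} (inj₁ _) (inj₂ (δ , _)) e = ⊥-elim (mixed β δ e)
        φ-inj {β′ = β′} (inj₂ (δ , _)) (inj₁ _) e = ⊥-elim (mixed β′ δ (≃-sym e))
        φ-inj (inj₂ (_ , _ , r)) (inj₂ (_ , _ , r′)) e = ≃-trans r (≃-trans (+-cong ≃-refl
          (·-cancel-≼ {σ = fin 1} (fin 2) ≺sc (proj₁ e) , ·-cancel-≼ {σ = fin 1} (fin 2) ≺sc (proj₂ e))) (≃-sym r′))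

      +-closed-diag : γ ≺ κ → γ + γ ≺ κ
      +-closed-diag {γ = γ} p = ⋠⇒≻ λ κ≼ →
        ≼⇒⊁ (Initial⇒↪⇒≼ init (↪-trans (≼⇒↪ κ≼) (+↪double γ))) (double-closed p)

    +-closed : α ≺ κ → β ≺ κ → α + β ≺ κ
    +-closed {α = α} {β = β} p q with compare α β
    ... | inj₁ r = ≼-≺-trans (+-mono-≼ r ≼-refl) (+-closed-diag q)
    ... | inj₂ r = ≼-≺-trans (+-mono-≼ ≼-refl (≺⇒≼ r)) (+-closed-diag p)

    closed : Closed κ
    closed = +-Closed⇒Closed 0≺κ +-closed

  -- Linear extensions and lengths

  Full : {X : Set ℓ} → X → Set ℓ
  Full _ = ⊤

  Len-rank : (h : X → Ord ℓ) → (∀ x y → ¬ R x y → h y ≺ h x) → ∀ γ {S} → (∀ x → S x → h x ≺ γ) → Len R S γ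
  Len-rank {R = R} h R-h = ≺-rec _ λ γ ih {S} S-h → Len-intro λ x Sx →
    h x , S-h x Sx , ih (h x) (S-h x Sx) λ y (_ , ¬xy) → R-h x y ¬xy

  val-order : (α : Ord ℓ) → Rel (El α) ℓ
  val-order α p q = val α p ≼ val α q

  Big-El : (α : Ord ℓ) → Big (val-order α) Full α
  Big-El α = Big-mono (λ _ _ → tt) ≼-refl (go α ≼-refl)
    where
    go : ∀ δ → δ ≼ α → Big (val-order α) (λ p → val α p ≺ δ) δ
    go (lsub J g) δ≼α = big λ j →
      let (p , (p≼ , ≼p)) = find α (≼-elim δ≼α j)
      in p , ≼-≺-trans p≼ (!-≺ j)
       , Big-mono (λ q q≺ → ≺-trans q≺ (!-≺ j) , λ p≼q → ≼⇒⊁ p≼q (≺-≼-trans q≺ ≼p)) ≼-refl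
           (go (g j) (≺⇒≼ (≼-elim δ≼α j)))

  module TotalOrder {ℓ} {A : Set ℓ} {_≋_ _⊑_ : Rel A ℓ} (to : IsTotalOrder _≋_ _⊑_) where

    open IsTotalOrder to using (antisym; total; reflexive; isPartialOrder; module Eq)

    _⊏_ : Rel A ℓ
    _⊏_ = ToStrict._<_ _≋_ _⊑_

    ⊏-trans : ∀ {x y z} → x ⊏ y → y ⊏ z → x ⊏ z
    ⊏-trans = ToStrict.<-trans _≋_ _⊑_ isPartialOrder

    ⊏⇒⋢ : ∀ {x y} → x ⊏ y → ¬ y ⊑ x
    ⊏⇒⋢ (x⊑y , x≉y) y⊑x = x≉y (antisym x⊑y y⊑x)

    ⋢⇒⊏ : ∀ {x y} → ¬ y ⊑ x → x ⊏ y
    ⋢⇒⊏ {x} {y} ¬yx = [ id , (λ yx → ⊥-elim (¬yx yx)) ] (total x y) , λ x≋y → ¬yx (reflexive (Eq.sym x≋y))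

    rank-≼-rank : ∀ {x} (p q : Acc _⊏_ x) → rank p ≼ rank q
    rank-≼-rank (acc rs) (acc rs′) = ≼-intro λ (y , y⊏x) → ≺-intro (y , y⊏x) (rank-≼-rank (rs y⊏x) (rs′ y⊏x))

    rank-mono-≺ : ∀ {x y} (p : Acc _⊏_ x) (q : Acc _⊏_ y) → x ⊏ y → rank p ≺ rank q
    rank-mono-≺ p (acc rs) x⊏y = ≺-intro (_ , x⊏y) (rank-≼-rank p (rs x⊏y))

    rank-injective : ∀ {x y} (p : Acc _⊏_ x) (q : Acc _⊏_ y) → rank p ≃ rank q → x ≋ y
    rank-injective {x} {y} p q e = antisym
      (decidable-stable em λ ¬xy → ≼⇒⊁ (proj₁ e) (rank-mono-≺ q p (⋢⇒⊏ ¬xy)))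
      (decidable-stable em λ ¬yx → ≼⇒⊁ (proj₂ e) (rank-mono-≺ p q (⋢⇒⊏ ¬yx)))

    rank-mono-≼ : ∀ {x y} (p : Acc _⊏_ x) (q : Acc _⊏_ y) → x ⊑ y → rank p ≼ rank q
    rank-mono-≼ {x} {y} p q xy with em {P = y ⊑ x}
    ... | no ¬yx = ≺⇒≼ (rank-mono-≺ p q (⋢⇒⊏ ¬yx))
    ... | yes yx = same p q
      where
      same : (p : Acc _⊏_ x) (q : Acc _⊏_ y) → rank p ≼ rank q
      same (acc rs) (acc rs′) = ≼-intro λ (z , z⊏x) →
        let z⊏y = ⋢⇒⊏ λ yz → ⊏⇒⋢ z⊏x (IsTotalOrder.trans to xy yz)
        in ≺-intro (z , z⊏y) (rank-≼-rank (rs z⊏x) (rs′ z⊏y))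

    ≼-rank : ∀ {S δ x} (p : Acc _⊏_ x) → (∀ y → S y → y ⊏ x) → Big _⊑_ S δ → δ ≼ rank p
    ≼-rank (acc rs) S⊏ (big h) = ≼-intro λ j →
      let (y , Sy , c) = h j
      in ≺-intro (y , S⊏ y Sy) (≼-rank (rs (S⊏ y Sy)) (λ z (_ , ¬yz) → ⋢⇒⊏ ¬yz) c)

    ≼-orderType : ∀ {δ} (wf : WellFounded _⊏_) → Big _⊑_ Full δ → δ ≼ orderType wf
    ≼-orderType wf (big h) = ≼-intro λ j →
      let (y , _ , c) = h j
      in ≺-intro y (≼-rank (wf y) (λ z (_ , ¬yz) → ⋢⇒⊏ ¬yz) c)

    module _ {R : Rel A ℓ} (ext : R ⇒ _⊑_) where

      private
        initial-∖ : ∀ {S x y} → (∀ z → z ⊏ x → S z) → y ⊏ x → ∀ z → z ⊏ y → (S ∖[ R ] y) z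
        initial-∖ ⊏S y⊏x z z⊏y = ⊏S z (⊏-trans z⊏y y⊏x) , λ yz → ⊏⇒⋢ z⊏y (ext yz)

      rank-≼ : ∀ {S δ x} (p : Acc _⊏_ x) → (∀ y → y ⊏ x → S y) → Len R S δ → rank p ≼ δ
      rank-≼ {S} (acc rs) ⊏S (len h) = ≼-intro λ (y , y⊏x) →
        let (j , l) = h y (⊏S y y⊏x)
        in ≺-intro j (rank-≼ (rs y⊏x) (initial-∖ {S} ⊏S y⊏x) l)

      orderType-≼ : ∀ {δ} (wf : WellFounded _⊏_) → Len R Full δ → orderType wf ≼ δ
      orderType-≼ wf (len h) = ≼-intro λ x →
        let (j , l) = h x tt
        in ≺-intro j (rank-≼ (wf x) (λ z z⊏x → tt , λ xz → ⊏⇒⋢ z⊏x (ext xz)) l)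

      ⊏-wellFounded : WT R Full → WellFounded _⊏_
      ⊏-wellFounded w x = go w λ _ _ → tt
        where
        go : ∀ {S x} → WT R S → (∀ z → z ⊏ x → S z) → Acc _⊏_ x
        go {S} (wt h) ⊏S = acc λ {y} y⊏x → go (h y (⊏S y y⊏x)) (initial-∖ {S} ⊏S y⊏x)

  LinearExtensionType⇒≼ : {_≋_ _≤′_ : Rel X ℓ} → Len _≤′_ Full γ → LinearExtensionType _≋_ _≤′_ α → α ≼ γ
  LinearExtensionType⇒≼ l (_⊑_ , to , ext , wf , e) =
    ≼-trans (proj₂ (≈⇒≃ e)) (TotalOrder.orderType-≼ to ext wf l)

  total⇒IsLength : {_≋_ _≤′_ : Rel X ℓ} → IsTotalOrder _≋_ _≤′_ → Len _≤′_ Full γ → Big _≤′_ Full γ →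
                   IsLength _≋_ _≤′_ γ
  total⇒IsLength {_≤′_ = _≤′_} to l c =
    (_≤′_ , to , id , wf , ≃⇒≈ (orderType-≼ id wf l , ≼-orderType wf c)) , λ β e → un≼ (LinearExtensionType⇒≼ l e)
    where
    open TotalOrder to
    wf = ⊏-wellFounded {_≤′_} id (Len⇒WT l)

  module _ {X : Set ℓ} {_≋_ R : Rel X ℓ} (po : IsPartialOrder _≋_ R) where

    open IsPartialOrder po using (antisym; isEquivalence; reflexive; module Eq) renaming (trans to R-trans; refl to R-refl)

    -- What is retained of a linear extension. It makes choices of elements canonical, and it breaks
    -- ties when a longer linear extension is built.
    record Ranking : Set (lsuc ℓ) where
      field
        rk           : X → Ord ℓ
        rk-mono      : ∀ {x y} → R x y → rk x ≼ rk y
        rk-injective : ∀ {x y} → rk x ≃ rk y → x ≋ y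

    linearExtension⇒Ranking : LinearExtensionType _≋_ R α → Ranking
    linearExtension⇒Ranking (_⊑_ , to , ext , wf , _) = record
      { rk           = λ x → rank (wf x)
      ; rk-mono      = λ {x} {y} xy → rank-mono-≼ (wf x) (wf y) (ext xy)
      ; rk-injective = λ {x} {y} → rank-injective (wf x) (wf y)
      }
      where open TotalOrder to

    module _ (r : Ranking) where
      open Ranking r

      reflecting : ∀ {S γ} → WT R S → Big R S γ →
        Σ[ e ∈ (∀ β → β ≺ γ → X) ] (∀ β p → S (e β p)) × (∀ β p β′ p′ → R (e β p) (e β′ p′) → β ≼ β′)
      reflecting = Extension.reflectingMap R R-trans rk (λ e → reflexive (rk-injective e))

      private
        -- `h x` is the first β such that x is below `e β`, or γ if there is none. It is monotone
        -- and inverts e, so comparing by h, with ties broken by `rk`, extends R and has length at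
        -- least γ.
        module Extend {γ : Ord ℓ} (w : WT R Full) (e : ∀ β → β ≺ γ → X)
                      (e-reflects : ∀ β p β′ p′ → R (e β p) (e β′ p′) → β ≼ β′) where

          Bound : X → Ord ℓ → Set ℓ
          Bound x β = (Σ[ p ∈ β ≺ γ ] R x (e β p)) ⊎ γ ≼ β

          bound : ∀ x → Σ[ μ ∈ Ord ℓ ] (Bound x μ × ∀ β → Bound x β → μ ≼ β)
          bound x = least (Bound x) (inj₂ ≼-refl)

          h : X → Ord ℓ
          h x = proj₁ (bound x)

          h-mono : ∀ {x y} → R x y → h x ≼ h y
          h-mono {x} {y} xy = proj₂ (proj₂ (bound x)) (h y) (shift (proj₁ (proj₂ (bound y))))
            where
            shift : ∀ {β} → Bound y β → Bound x β
            shift (inj₁ (p , r)) = inj₁ (p , R-trans xy r)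
            shift (inj₂ p)       = inj₂ p

          h-e : ∀ β p → h (e β p) ≃ β
          h-e β p = proj₂ (proj₂ (bound (e β p))) β (inj₁ (p , R-refl)) , least-bound (proj₁ (proj₂ (bound (e β p))))
            where
            least-bound : ∀ {β′} → Bound (e β p) β′ → β ≼ β′
            least-bound {β′} (inj₁ (p′ , r)) = e-reflects β p β′ p′ r
            least-bound (inj₂ q) = ≼-trans (≺⇒≼ p) q

          _⊑_ : Rel X ℓ
          x ⊑ y = h x ≺ h y ⊎ h x ≃ h y × rk x ≼ rk y

          ⊑⇒≼ : ∀ {x y} → x ⊑ y → h x ≼ h y
          ⊑⇒≼ (inj₁ p)       = ≺⇒≼ p
          ⊑⇒≼ (inj₂ (p , _)) = proj₁ p

          ext : R ⇒ _⊑_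
          ext {x} {y} xy with compare (h y) (h x)
          ... | inj₁ p = inj₂ ((h-mono xy , p) , rk-mono xy)
          ... | inj₂ p = inj₁ p

          ⊑-trans : ∀ {x y z} → x ⊑ y → y ⊑ z → x ⊑ z
          ⊑-trans (inj₁ p) q = inj₁ (≺-≼-trans p (⊑⇒≼ q))
          ⊑-trans (inj₂ (p , _)) (inj₁ q) = inj₁ (≼-≺-trans (proj₁ p) q)
          ⊑-trans (inj₂ (p , p′)) (inj₂ (q , q′)) = inj₂ (≃-trans p q , ≼-trans p′ q′)

          ⊑-antisym : ∀ {x y} → x ⊑ y → y ⊑ x → x ≋ y
          ⊑-antisym (inj₁ p) q = ⊥-elim (≼⇒⊁ (⊑⇒≼ q) p)
          ⊑-antisym (inj₂ (p , _)) (inj₁ q) = ⊥-elim (≼⇒⊁ (proj₁ p) q)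
          ⊑-antisym (inj₂ (_ , p)) (inj₂ (_ , q)) = rk-injective (p , q)

          ⊑-total : Total _⊑_
          ⊑-total x y with tri (h x) (h y)
          ... | lt p = inj₁ (inj₁ p)
          ... | gt p = inj₂ (inj₁ p)
          ... | eq p with compare (rk x) (rk y)
          ...   | inj₁ q = inj₁ (inj₂ (p , q))
          ...   | inj₂ q = inj₂ (inj₂ (≃-sym p , ≺⇒≼ q))

          isTotalOrder : IsTotalOrder _≋_ _⊑_
          isTotalOrder = record
            { isPartialOrder = record
              { isPreorder = record
                { isEquivalence = isEquivalence
                ; reflexive = λ x≋y → ext (reflexive x≋y)
                ; trans = ⊑-trans
                }
              ; antisym = ⊑-antisym
              }
            ; total = ⊑-total
            }

          Big-⊑ : Big _⊑_ Full γ
          Big-⊑ = Big-map (λ p → e (val γ p) (val-≺ γ p)) (λ _ _ → tt)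
            (λ p q _ _ r → ≼-trans (proj₂ (h-e _ _)) (≼-trans (⊑⇒≼ r) (proj₁ (h-e _ _)))) ≼-refl (Big-El γ)

      Exact⇒IsLength : ∀ {γ} → Len R Full γ → Big R Full γ → IsLength _≋_ R γ
      Exact⇒IsLength {γ} l c = (_⊑_ , isTotalOrder , ext , wf , ≃⇒≈ (orderType-≼ ext wf l , ≼-orderType wf Big-⊑))
                       , λ β t → un≼ (LinearExtensionType⇒≼ l t)
        where
        m = reflecting (Len⇒WT l) c
        open Extend (Len⇒WT l) (proj₁ m) (proj₂ (proj₂ m))
        open TotalOrder isTotalOrder
        wf = ⊏-wellFounded {R} ext (Len⇒WT l)

    IsLength⇒Len : WT R Full → IsLength _≋_ R α → Len R Full α
    IsLength⇒Len w (t , greatest) =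
      let (γ , l , c) = rankOf w
      in Len-mono ⊆-refl ⟨ greatest γ (proj₁ (Exact⇒IsLength (linearExtension⇒Ranking t) l c)) ⟩ l

  -- Well partial orders

  module _ {X : Set ℓ} {_≋_ R : Rel X ℓ} (wpo : IsWPO _≋_ R) where

    open IsWPO wpo
    open IsPartialOrder isPartialOrder using (reflexive; module Eq)

    private
      _⊏_ : Rel X ℓ
      _⊏_ = ToStrict._<_ _≋_ R

      NotWT : Set (lsuc ℓ)
      NotWT = Σ[ S ∈ (X → Set ℓ) ] ¬ WT R S

      pick : (s : NotWT) → Σ[ x ∈ X ] proj₁ s x × ¬ WT R (proj₁ s ∖[ R ] x)
      pick (S , ¬w) = decidable-stable em λ ¬∃ →
        ¬w (wt λ x Sx → decidable-stable em λ ¬w′ → ¬∃ (x , Sx , ¬w′))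

      module Sequence (s₀ : NotWT) where

        state : ℕ → NotWT
        state zero    = s₀
        state (suc n) = _ , proj₂ (proj₂ (pick (state n)))

        xs : ℕ → X
        xs n = proj₁ (pick (state n))

        decreasing : ∀ {i j} → i ℕ.≤′ j → proj₁ (state j) ⊆ proj₁ (state i)
        decreasing ℕ.≤′-refl _ p = p
        decreasing (ℕ.≤′-step q) x p = decreasing q x (proj₁ p)

        bad : ∀ {i j} → i ℕ.< j → ¬ R (xs i) (xs j)
        bad {i} {j} i<j = proj₂ (decreasing (ℕₚ.≤⇒≤′ i<j) (xs j) (proj₁ (proj₂ (pick (state j)))))

        -- A bad sequence excludes only that an earlier term is below a later one. Restricted to
        -- terms with nothing strictly smaller from m on, it excludes the converse too and is an
        -- antichain.
        Minimal : ℕ → ℕ → Set ℓ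
        Minimal m i = Σ[ _ ∈ m ℕ.≤ i ] (∀ j → m ℕ.≤ j → ¬ xs j ⊏ xs i)

        minimal : ∀ m → Σ[ i ∈ ℕ ] Minimal m i
        minimal m = go m ℕₚ.≤-refl (wellFounded (xs m))
          where
          go : ∀ i → m ℕ.≤ i → Acc _⊏_ (xs i) → Σ[ i ∈ ℕ ] Minimal m i
          go i m≤i (acc rs) with em {P = Σ[ j ∈ ℕ ] m ℕ.≤ j × xs j ⊏ xs i}
          ... | yes (j , m≤j , p) = go j m≤j (rs p)
          ... | no ¬∃ = i , m≤i , λ j m≤j p → ¬∃ (j , m≤j , p)

        from idx : ℕ → ℕ
        from zero    = zero
        from (suc k) = suc (idx k)
        idx k = proj₁ (minimal (from k))

        idx-mono′ : ∀ {k m} → suc k ℕ.≤′ m → idx k ℕ.< idx m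
        idx-mono′ {k} ℕ.≤′-refl = proj₁ (proj₂ (minimal (from (suc k))))
        idx-mono′ {k} (ℕ.≤′-step {n = m} p) =
          ℕₚ.<-trans (idx-mono′ p) (proj₁ (proj₂ (minimal (from (suc m)))))

        idx-mono : ∀ {k m} → k ℕ.< m → idx k ℕ.< idx m
        idx-mono p = idx-mono′ (ℕₚ.≤⇒≤′ p)

        antichain : InfiniteAntichain _≋_ R
        antichain = xs ∘ idx , λ i j i≢j → incomparable i j i≢j (ℕₚ.<-cmp i j)
          where
          incomparable : ∀ i j → i ≢ j → _ → ¬ R (xs (idx i)) (xs (idx j))
          incomparable i j _ (tri< i<j _ _) = bad (idx-mono i<j)
          incomparable i j i≢j (tri≈ _ i≡j _) = ⊥-elim (i≢j i≡j)
          incomparable i j _ (tri> _ _ j<i) r = proj₂ (proj₂ (minimal (from j))) (idx i)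
            (ℕₚ.≤-trans (proj₁ (proj₂ (minimal (from j)))) (ℕₚ.<⇒≤ (idx-mono j<i)))
            (r , λ e → bad (idx-mono j<i) (reflexive (Eq.sym e)))

    IsWPO⇒WT : WT R Full
    IsWPO⇒WT = decidable-stable em λ ¬w → noInfiniteAntichain (Sequence.antichain (Full , ¬w))

  -- The upper bound

  infixr 6 _∩ᴿ_
  _∩ᴿ_ : {X : Set ℓ} → Rel X ℓ → Rel X ℓ → Rel X ℓ
  (R ∩ᴿ R′) x y = R x y × R′ x y

  ⋂ : ∀ {n} {X : Set ℓ} → (Fin n → Rel X ℓ) → Rel X ℓ
  ⋂ order x y = ∀ i → order i x y

  ∩-∖-cover : ∀ x y → (S ∖[ R ∩ᴿ R′ ] x) y → (S ∖[ R ] x) y ⊎ (S ∖[ R′ ] x) y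
  ∩-∖-cover {R = R} x y (Sy , ¬xy) with em {P = R x y}
  ... | no ¬r = inj₁ (Sy , ¬r)
  ... | yes r = inj₂ (Sy , λ r′ → ¬xy (r , r′))

  WT-∩ : S ⊆ A → S ⊆ B → WT R A → WT R′ B → WT (R ∩ᴿ R′) S
  WT-∩ {S = S} {A = A} {B = B} {R = R} {R′ = R′} a b (wt h) (wt k) = wt λ x Sx →
    WT-∪ (∩-∖-cover {S = S} {R = R} {R′ = R′} x)
      (WT-∩ (∖-mono R x a) (λ y (Sy , _) → b y Sy) (h x (a x Sx)) (wt k))
      (WT-∩ (λ y (Sy , _) → a y Sy) (∖-mono R′ x b) (wt h) (k x (b x Sx)))

  WT-⋂ : ∀ n {order : Fin n → Rel X ℓ} → (∀ i → WT (order i) S) → WT (⋂ order) S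
  WT-⋂ zero w = wt λ x _ → wt λ y (_ , ¬xy) → ⊥-elim (¬xy λ ())
  WT-⋂ (suc n) {order} w = WT-comap id (⊆-refl , λ _ _ _ _ (r , rs) → λ { zero → r ; (suc i) → rs i })
    (WT-∩ ⊆-refl ⊆-refl (w zero) (WT-⋂ n {order ∘ suc} (w ∘ suc)))

  module _ {X : Set ℓ} {R : Rel X ℓ} (rk : X → Ord ℓ) (rk-mono : ∀ {x y} → R x y → rk x ≼ rk y) where

    RankIn : (X → Set ℓ) → Ord ℓ → Set ℓ
    RankIn S γ = Σ[ x ∈ X ] S x × rk x ≃ γ

    RankIn-resp : ∀ {S β γ} → β ≃ γ → RankIn S β → RankIn S γ
    RankIn-resp e (x , Sx , r) = x , Sx , ≃-trans r e

    -- The place of x among the ranks occurring in S. Elements of S of smaller rank are not above x,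
    -- so that, unlike `rk`, places are bounded by the length of S.
    position : (X → Set ℓ) → X → Ord ℓ
    position S x = OrderType.type (RankIn S) RankIn-resp (rk x)

    position-injective : ∀ {S x y} → S x → S y → position S x ≃ position S y → rk x ≃ rk y
    position-injective {S} {x} {y} Sx Sy = OrderType.type-injective (RankIn S) RankIn-resp
      (x , Sx , ≃-refl) (y , Sy , ≃-refl)

    private
      type-≼-Len : ∀ {S T δ} γ → (∀ x → T x → rk x ≺ γ → S x) → Len R S δ →
                   OrderType.type (RankIn T) RankIn-resp γ ≼ δ
      type-≼-Len {T = T} γ T⊆ (len h) = OrderType.type-lub (RankIn T) RankIn-resp λ β β≺γ (x , Tx , e) →
        let (j , l) = h x (T⊆ x Tx (≼-≺-trans (proj₁ e) β≺γ))
        in ≺-intro j (type-≼-Len β (λ y Ty y≺β → T⊆ y Ty (≺-trans y≺β β≺γ) ,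
             λ xy → ≼⇒⊁ (rk-mono xy) (≺-≼-trans y≺β (proj₂ e))) l)

    position-≺ : ∀ {S δ x} → Len R S δ → S x → position S x ≺ δ
    position-≺ {x = x} (len h) Sx =
      let (j , l) = h x Sx
      in ≺-intro j (type-≼-Len (rk x) (λ y Sy y≺x → Sy , λ xy → ≼⇒⊁ (rk-mono xy) y≺x) l)

  -- Rank of the intersection of two orders.

  sum⊕ : List (Ord ℓ) → Ord ℓ
  sum⊕ = List.foldr _⊕_ (fin 0)

  sum⊕-++ : (αs βs : List (Ord ℓ)) → sum⊕ αs ⊕ sum⊕ βs ≼ sum⊕ (αs List.++ βs)
  sum⊕-++ [] βs = ⊕-identityˡ-≼ (sum⊕ βs)
  sum⊕-++ (α ∷ αs) βs = ≼-trans (proj₁ (⊕-assoc α (sum⊕ αs) (sum⊕ βs))) (⊕-mono-≼ ≼-refl (sum⊕-++ αs βs))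

  powers : List (Ord ℓ) → List (Ord ℓ) → List (Ord ℓ)
  powers = cartesianProductWith (λ a b → ω^ (a ⊕ b))

  ·-mono-≺ : (κ : Ord ℓ) → fin 0 ≺ κ → π ≺ τ → κ · π ≺ κ · τ
  ·-mono-≺ {π = π} {τ = τ} κ 0≺κ p = ≼-≺-trans (≼-+ˡ (κ · π) (fin 0)) (·-intro κ τ p 0≺κ)

  Len-0 : Len R S γ → γ ≼ fin 0 → ∀ x → ¬ S x
  Len-0 (len h) p x Sx = ≺0 (≼-elim p (proj₁ (h x Sx)))

  module _ {X : Set ℓ} {R : Rel X ℓ} {κ : Ord ℓ} where

    Bounded : Ord ℓ → (X → Set ℓ) → Set (lsuc ℓ)
    Bounded γ S = Σ[ δ ∈ Ord ℓ ] δ ≺ γ × Len R S δ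

    Bounded-∪ : ∀ {γ A B S} → Closed γ → (∀ x → S x → A x ⊎ B x) → Bounded γ A → Bounded γ B → Bounded γ S
    Bounded-∪ cl s (δ , p , l) (δ′ , p′ , l′) = δ ⊕ δ′ , cl p p′ , Len-∪ s l l′

    -- Q stands for one of the two orders intersected in R, and C for a bound on the length in the
    -- other one, which pieces of a set inherit.
    module _ {Q : Rel X ℓ} (tr : Transitiveᴿ Q) {γ : Ord ℓ} (cl : Closed γ) (κ≼γ : κ ≼ γ)
             (C : (X → Set ℓ) → Set ℓ) (C-antitone : ∀ {S T} → S ⊆ T → C T → C S)
             (small : ∀ S s → s ≺ κ → Len Q S s → Bounded κ S) (0≺κ : fin 0 ≺ κ) where

      Bounded-multiple : ∀ {ζ} → (∀ S → Len Q S (κ · ζ) → C S → Bounded γ S) →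
                         ∀ k S → Len Q S (κ · (ζ · fin k)) → C S → Bounded γ S
      Bounded-multiple {ζ} ih zero S l c = fin 0 , ≺-≼-trans 0≺κ κ≼γ ,
        Len-∅ (Len-0 l (≼-trans (·-monoʳ-≼ κ (·-zeroʳ {γ = fin 0} ζ)) (·-zeroʳ κ)))
      Bounded-multiple {ζ} ih (suc k) S l c =
        let (A , B , cover , A⊆ , B⊆ , lA , lB) = Len-split tr (Len-mono ⊆-refl
              (≼-trans (·-monoʳ-≼ κ (proj₁ (·-sc ζ (fin k)))) (proj₁ (·-distribˡ κ (ζ · fin k) ζ))) l)
        in Bounded-∪ cl cover (Bounded-multiple ih k A lA (C-antitone A⊆ c)) (ih B lB (C-antitone B⊆ c))

      Bounded-below : ∀ a → (∀ i S → Len Q S (κ · ω^ (a ! i)) → C S → Bounded γ S) →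
                      ∀ {δ} S → δ ≺ κ · ω^ a → Len Q S δ → C S → Bounded γ S
      Bounded-below a ih {δ} S p l c =
        let (j , i , q) = ≺-· κ (ω^ a) p
        in divided (ω^ a ! j) (κ ! i) (!-≺ j) (!-≺ i) q
        where
        divided : ∀ u s → u ≺ ω^ a → s ≺ κ → δ ≼ κ · u + s → Bounded γ S
        divided u s u≺ s≺ q =
          let (A , B , cover , A⊆ , B⊆ , lA , lB) = Len-split tr (Len-mono ⊆-refl q l)
              (s′ , s′≺ , l′) = small B s s≺ lB
          in Bounded-∪ cl cover (multiple A lA (C-antitone A⊆ c) (≺-ω^ a u≺)) (s′ , ≺-≼-trans s′≺ κ≼γ , l′)
          where
          multiple : ∀ A → Len Q A (κ · u) → C A → u ≼ fin 0 ⊎ (Σ[ i ∈ Idx a ] Σ[ k ∈ ℕ ] u ≼ ω^ (a ! i) · fin k) →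
                     Bounded γ A
          multiple A lA cA (inj₁ u≼0) =
            fin 0 , ≺-≼-trans 0≺κ κ≼γ , Len-∅ (Len-0 lA (≼-trans (·-monoʳ-≼ κ u≼0) (·-zeroʳ κ)))
          multiple A lA cA (inj₂ (i , k , u≼)) =
            Bounded-multiple (ih i) k A (Len-mono ⊆-refl (·-monoʳ-≼ κ u≼) lA) cA

  module Intersection {X : Set ℓ} {R₁ R₂ : Rel X ℓ} (tr₁ : Transitiveᴿ R₁) (tr₂ : Transitiveᴿ R₂)
    {κ : Ord ℓ} (cl : Closed κ) (0≺κ : fin 0 ≺ κ)
    (small₁ : ∀ S s → s ≺ κ → Len R₁ S s → Bounded {R = R₁ ∩ᴿ R₂} {κ = κ} κ S)
    (small₂ : ∀ S s → s ≺ κ → Len R₂ S s → Bounded {R = R₁ ∩ᴿ R₂} {κ = κ} κ S) where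

    private
      R∩ = R₁ ∩ᴿ R₂

      Goal : Ord ℓ → Ord ℓ → Set (lsuc ℓ)
      Goal a b = ∀ S → Len R₁ S (κ · ω^ a) → Len R₂ S (κ · ω^ b) → Len R∩ S (κ · ω^ (a ⊕ b))

      step : ∀ a b → (∀ i → Goal (a ! i) b) → (∀ j → Goal a (b ! j)) → Goal a b
      step a b ihₐ ih_b S l₁ l₂ = Len-intro λ x Sx →
        let (δ₁ , p₁ , m₁) = Len-elim l₁ x Sx
            (δ₂ , p₂ , m₂) = Len-elim l₂ x Sx
            (ε₁ , q₁ , k₁) = Bounded-below {κ = κ} tr₁ clγ κ≼γ (λ S → Len R₂ S (κ · ω^ b)) (λ s → Len-mono s ≼-refl)
              small₁ 0≺κ a (λ i T l c → _ , ·-mono-≺ κ 0≺κ (ω^-mono-≺ (⊕-monoˡ-! a b i)) , ihₐ i T l c)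
              (S ∖[ R₁ ] x) p₁ m₁ (Len-mono (λ _ → proj₁) ≼-refl l₂)
            (ε₂ , q₂ , k₂) = Bounded-below {κ = κ} tr₂ clγ κ≼γ (λ S → Len R₁ S (κ · ω^ a)) (λ s → Len-mono s ≼-refl)
              small₂ 0≺κ b (λ j T l c → _ , ·-mono-≺ κ 0≺κ (ω^-mono-≺ (⊕-monoʳ-! a b j)) , ih_b j T c l)
              (S ∖[ R₂ ] x) p₂ m₂ (Len-mono (λ _ → proj₁) ≼-refl l₁)
        in ε₁ ⊕ ε₂ , clγ q₁ q₂ , Len-∪ (∩-∖-cover {S = S} {R = R₁} {R′ = R₂} x) k₁ k₂
        where
        -- Closure keeps finite unions of bounded pieces bounded, and lets the parts missed by
        -- either order be combined.
        clγ : Closed (κ · ω^ (a ⊕ b))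
        clγ = Closed-· {κ = κ} {π = ω^ (a ⊕ b)} cl (Closed-ω^ (a ⊕ b))
        κ≼γ : κ ≼ κ · ω^ (a ⊕ b)
        κ≼γ = ≼-trans (proj₂ (·-identityʳ κ)) (·-monoʳ-≼ κ (sc-≼ (0≺ω^ (a ⊕ b))))

    Len-ω^ : ∀ a b → Goal a b
    Len-ω^ (lsub I f) (lsub J g) = step (lsub I f) (lsub J g)
      (λ i → Len-ω^ (f i) (lsub J g)) (λ j → Len-ω^ (lsub I f) (g j))

    private
      Len-row : ∀ a bs S → Len R₁ S (κ · ω^ a) → Len R₂ S (κ · sumω^ bs) →
                Len R∩ S (κ · sum⊕ (List.map (λ b → ω^ (a ⊕ b)) bs))
      Len-row a [] S l₁ l₂ = Len-∅ (Len-0 l₂ (·-zeroʳ κ))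
      Len-row a (b ∷ bs) S l₁ l₂ =
        let (A , B , cover , A⊆ , B⊆ , lA , lB) = Len-split tr₂ (Len-mono ⊆-refl (proj₁ (·-distribˡ κ (ω^ b) (sumω^ bs))) l₂)
        in Len-mono ⊆-refl (·-⊕-≼ κ cl 0≺κ (ω^ (a ⊕ b)) (sum⊕ (List.map (λ b → ω^ (a ⊕ b)) bs)))
             (Len-∪ cover (Len-ω^ a b A (Len-mono A⊆ ≼-refl l₁) lA) (Len-row a bs B (Len-mono B⊆ ≼-refl l₁) lB))

      Len-powers : ∀ as bs S → Len R₁ S (κ · sumω^ as) → Len R₂ S (κ · sumω^ bs) →
                   Len R∩ S (κ · sum⊕ (powers as bs))
      Len-powers [] bs S l₁ l₂ = Len-∅ (Len-0 l₁ (·-zeroʳ κ))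
      Len-powers (a ∷ as) bs S l₁ l₂ =
        let (A , B , cover , A⊆ , B⊆ , lA , lB) = Len-split tr₁ (Len-mono ⊆-refl (proj₁ (·-distribˡ κ (ω^ a) (sumω^ as))) l₁)
            row = List.map (λ b → ω^ (a ⊕ b)) bs
        in Len-mono ⊆-refl (≼-trans (·-⊕-≼ κ cl 0≺κ (sum⊕ row) (sum⊕ (powers as bs)))
               (·-monoʳ-≼ κ (sum⊕-++ row (powers as bs))))
             (Len-∪ cover (Len-row a bs A lA (Len-mono A⊆ ≼-refl l₂))
               (Len-powers as bs B lB (Len-mono B⊆ ≼-refl l₂)))

    Len-∩ : ∀ {α β γ S} → IsNaturalProduct α β γ → Len R₁ S (κ · α) → Len R₂ S (κ · β) → Len R∩ S (κ · γ)
    Len-∩ {S = S} (as , bs , (_ , α≈) , (_ , β≈) , γ≈) l₁ l₂ =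
      Len-mono ⊆-refl (·-monoʳ-≼ κ (proj₂ (≈⇒≃ γ≈))) (Len-powers as bs S
        (Len-mono ⊆-refl (·-monoʳ-≼ κ (proj₁ (≈⇒≃ α≈))) l₁)
        (Len-mono ⊆-refl (·-monoʳ-≼ κ (proj₁ (≈⇒≃ β≈))) l₂))

  sumω^-≼-powers : ∀ as b bs → sumω^ {ℓ} as ≼ sum⊕ (powers as (b ∷ bs))
  sumω^-≼-powers [] b bs = ≼-refl
  sumω^-≼-powers (a ∷ as) b bs =
    ≼-trans (+≼⊕ (ω^ a) (sumω^ as)) (⊕-mono-≼ (ω^-mono-≼ (≼-⊕ˡ a b))
      (≼-trans (sumω^-≼-powers as b bs) (≼-trans (≼-⊕ʳ (sum⊕ row) _) (sum⊕-++ row (powers as (b ∷ bs))))))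
    where row = List.map (λ b → ω^ (a ⊕ b)) bs

  -- This is for the end of `Is⨂`, where the second factor is 1: its normal form has a term, and
  -- this term alone contributes powers at least as large as those of α.
  naturalProduct-≽ˡ : IsNaturalProduct α β γ → fin 0 ≺ β → α ≼ γ
  naturalProduct-≽ˡ (as , [] , _ , (_ , β≈) , _) 0≺β = ⊥-elim (≺0 (≺-≼-trans 0≺β (proj₁ (≈⇒≃ β≈))))
  naturalProduct-≽ˡ (as , b ∷ bs , (_ , α≈) , _ , γ≈) _ =
    ≼-trans (proj₁ (≈⇒≃ α≈)) (≼-trans (sumω^-≼-powers as b bs) (proj₂ (≈⇒≃ γ≈)))

  module _ {X : Set ℓ} {_≋_ : Rel X ℓ} {κ : Ord ℓ} (init : Initial κ) (cl : Closed κ) (0≺κ : fin 0 ≺ κ) where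

    module _ {Q R : Rel X ℓ} (poQ : IsPartialOrder _≋_ Q) (poR : IsPartialOrder _≋_ R)
             (rQ : Ranking poQ) (rR : Ranking poR) (w : WT R Full) where
      open Ranking rQ

      -- By cardinality: if S had R-rank at least κ, it would contain distinct elements indexed by
      -- κ, and their positions with respect to Q would inject the initial ordinal κ into s.
      small-resp : ∀ S s → s ≺ κ → Len Q S s → Bounded {R = R} {κ = κ} κ S
      small-resp S s s≺κ l with Big-or-Len (WT-mono (λ _ _ → tt) w) κ
      ... | inj₂ b = b
      ... | inj₁ c =
        let (e , e∈ , e-reflects) = reflecting poR rR (WT-mono (λ _ _ → tt) w) c
            at = λ x → e (val κ x) (val-≺ κ x)
            at∈ = λ x → e∈ (val κ x) (val-≺ κ x)
            R-reflexive = IsPartialOrder.reflexive poR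
            ≋-sym = IsPartialOrder.Eq.sym poR
        in ⊥-elim (≼⇒⊁ (Initial⇒↪⇒≼ init (↪-intro (λ x → position rk rk-mono S (at x))
             (λ x → position-≺ rk rk-mono l (at∈ x))
             λ x y p → let x≋y = rk-injective (position-injective rk rk-mono {S} (at∈ x) (at∈ y) p) in
               e-reflects _ _ _ _ (R-reflexive x≋y) , e-reflects _ _ _ _ (R-reflexive (≋-sym x≋y)))) s≺κ)

    ⋂-isPartialOrder : ∀ {n} {order : Fin (suc n) → Rel X ℓ} → (∀ i → IsPartialOrder _≋_ (order i)) →
                       IsPartialOrder _≋_ (⋂ order)
    ⋂-isPartialOrder po = record
      { isPreorder = record
        { isEquivalence = IsPartialOrder.isEquivalence (po zero)
        ; reflexive = λ e i → IsPartialOrder.reflexive (po i) e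
        ; trans = λ p q i → IsPartialOrder.trans (po i) (p i) (q i)
        }
      ; antisym = λ p q → IsPartialOrder.antisym (po zero) (p zero) (q zero)
      }

    ⋂-ranking : ∀ {n} {order : Fin (suc n) → Rel X ℓ} (po : ∀ i → IsPartialOrder _≋_ (order i)) →
                Ranking (po zero) → Ranking (⋂-isPartialOrder po)
    ⋂-ranking po r = record
      { rk = rk ; rk-mono = λ p → rk-mono (p zero) ; rk-injective = rk-injective }
      where open Ranking r

    Len-⋂ : ∀ n {order : Fin (suc n) → Rel X ℓ} {q : Vector (Ord ℓ) (suc n)} {π S} →
            (po : ∀ i → IsPartialOrder _≋_ (order i)) → (∀ i → Ranking (po i)) → (∀ i → WT (order i) Full) →
            Is⨂ q π → (∀ i → Len (order i) S (κ · q i)) → Len (⋂ order) S (κ · π)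
    Len-⋂ zero po r w (cons (nil β≈1) prod) l =
      Len-comap id (⊆-refl , λ _ _ _ _ p → λ { zero → p })
        (·-monoʳ-≼ κ (naturalProduct-≽ˡ prod (≺-≼-trans ≺sc (proj₂ (≈⇒≃ β≈1))))) (l zero)
    Len-⋂ (suc n) {order} po r w (cons t prod) l =
      Len-comap id (⊆-refl , λ _ _ _ _ p → merge p) ≼-refl
        (Intersection.Len-∩ (λ {x} {y} {z} → IsPartialOrder.trans (po zero) {x} {y} {z})
          (λ {x} {y} {z} → IsPartialOrder.trans poₜ {x} {y} {z}) cl 0≺κ
          (small-resp (po zero) po∩ (r zero) r∩ w∩) (small-resp poₜ po∩ rₜ r∩ w∩)
          prod (l zero) (Len-⋂ n (po ∘ suc) (r ∘ suc) (w ∘ suc) t (l ∘ suc)))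
      where
      merge : ∀ {x y} → (order zero ∩ᴿ ⋂ (order ∘ suc)) x y → ⋂ order x y
      merge (p , ps) zero    = p
      merge (p , ps) (suc i) = ps i
      poₜ = ⋂-isPartialOrder (po ∘ suc)
      rₜ = ⋂-ranking (po ∘ suc) (r (suc zero))
      po∩ : IsPartialOrder _≋_ (order zero ∩ᴿ ⋂ (order ∘ suc))
      po∩ = record
        { isPreorder = record
          { isEquivalence = IsPartialOrder.isEquivalence (po zero)
          ; reflexive = λ e → IsPartialOrder.reflexive (po zero) e , IsPartialOrder.reflexive poₜ e
          ; trans = λ (p , ps) (q , qs) → IsPartialOrder.trans (po zero) p q , IsPartialOrder.trans poₜ ps qs
          }
        ; antisym = λ (p , _) (q , _) → IsPartialOrder.antisym (po zero) p q
        }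
      r∩ : Ranking po∩
      r∩ = record { rk = rk ; rk-mono = λ (p , _) → rk-mono p ; rk-injective = rk-injective }
        where open Ranking (r zero)
      w∩ = WT-∩ ⊆-refl ⊆-refl (w zero) (WT-⋂ (suc n) {order ∘ suc} (w ∘ suc))

  -- Cardinal successor

  code : ∀ {n} → Vector (Ord ℓ) n → Fin n → Ord ℓ → Ord ℓ
  code r zero    β = β
  code r (suc i) β = r zero + code (r ∘ suc) i β

  code-≺ : ∀ {n} (r : Vector (Ord ℓ) n) i → β ≺ r i → code r i β ≺ ∑ r
  code-≺ r zero    p = ≺-≼-trans p (≼-+ˡ (r zero) (∑ (r ∘ suc)))
  code-≺ r (suc i) p = +-monoʳ-≺ (r zero) (code-≺ (r ∘ suc) i p)

  code-cong : ∀ {n} (r : Vector (Ord ℓ) n) i → β ≃ γ → code r i β ≃ code r i γ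
  code-cong r zero    e = e
  code-cong r (suc i) e = +-cong ≃-refl (code-cong (r ∘ suc) i e)

  code-injective : ∀ {n} (r : Vector (Ord ℓ) n) i j → β ≺ r i → γ ≺ r j → code r i β ≃ code r j γ →
                   i ≡ j × β ≃ γ
  code-injective r zero    zero    _ _ e = refl , e
  code-injective r zero    (suc j) p _ e = ⊥-elim (≼⇒⊁ (≼-trans (≼-+ˡ (r zero) _) (proj₂ e)) p)
  code-injective r (suc i) zero    _ q e = ⊥-elim (≼⇒⊁ (≼-trans (≼-+ˡ (r zero) _) (proj₁ e)) q)
  code-injective r (suc i) (suc j) p q e =
    let (i≡j , e′) = code-injective (r ∘ suc) i j p q
          (+-cancelˡ-≼ (r zero) (proj₁ e) , +-cancelˡ-≼ (r zero) (proj₂ e))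
    in cong suc i≡j , e′

  decode : ∀ {n} (r : Vector (Ord ℓ) n) → γ ≺ ∑ r →
           Σ[ i ∈ Fin n ] Σ[ β ∈ Ord ℓ ] β ≺ r i × γ ≃ code r i β
  decode {n = zero} r p = ⊥-elim (≺0 p)
  decode {γ = γ} {n = suc n} r p with compare (r zero) γ
  ... | inj₂ q = zero , γ , q , ≃-refl
  ... | inj₁ q =
    let (δ , e) = subtract q
        (i , β , β≺ , e′) = decode (r ∘ suc) (+-cancelˡ-≺ (r zero) (≼-≺-trans (proj₂ e) p))
    in suc i , β , β≺ , ≃-trans e (+-cong ≃-refl e′)

  module Successor {ℓ} {κ : Ord ℓ} (init : Initial κ) (s : Ord ℓ) (s≺κ : s ≺ κ) where

    -- Hartogs' construction, cut off at κ. Since κ is initial and s ≺ κ, all ordinals that inject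
    -- into s are below κ, so the codes in `El κ` provide a small index type.
    μ : Ord ℓ
    μ = lsub (Σ[ p ∈ El κ ] val κ p ↪ s) (val κ ∘ proj₁)

    ≺μ⇒↪ : ∀ {β} → β ≺ μ → β ↪ s
    ≺μ⇒↪ p = let ((_ , i) , q) = ≺-elim p in ↪-trans (≼⇒↪ q) i

    ↪⇒≺μ : ∀ {β} → β ↪ s → β ≺ μ
    ↪⇒≺μ i =
      let (p , e) = find κ (⋠⇒≻ λ q → ≼⇒⊁ (Initial⇒↪⇒≼ init (↪-trans (≼⇒↪ q) i)) s≺κ)
      in ≺-intro (p , ↪-trans (≼⇒↪ (proj₁ e)) i) (proj₂ e)

    μ≼κ : μ ≼ κ
    μ≼κ = ≼-intro λ (p , _) → val-≺ κ p

    isCardinalSuccessor : IsCardinalSuccessor s μ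
    isCardinalSuccessor =
        ((Equipotent-refl , λ β E → un≼ (μ-initial β E)) , un≺ (↪⇒≺μ (≼⇒↪ ≼-refl)))
      , λ ν ((_ , initν) , s<ν) → un≼ (⊀⇒≽ λ ν≺μ →
          ≼⇒⊁ (Initial⇒↪⇒≼ (λ β E → ⟨ initν β E ⟩) (≺μ⇒↪ ν≺μ)) ⟨ s<ν ⟩)
      where
      μ-initial : Initial μ
      μ-initial β E = ⊀⇒≽ λ β≺μ → ≺-irrefl (↪⇒≺μ (↪-trans (Equipotent⇒↪ E) (≺μ⇒↪ β≺μ)))

  ∑-≺ : ∀ {n} {κ : Ord ℓ} (r : Vector (Ord ℓ) n) → fin 0 ≺ κ → (∀ {α β} → α ≺ κ → β ≺ κ → α + β ≺ κ) →
        (∀ i → r i ≺ κ) → ∑ r ≺ κ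
  ∑-≺ {n = zero}  r 0≺κ cl r≺ = 0≺κ
  ∑-≺ {n = suc n} r 0≺κ cl r≺ = cl (r≺ zero) (∑-≺ (r ∘ suc) 0≺κ cl (r≺ ∘ suc))

  module Setting {ℓ} {n : ℕ} (α q r : Vector (Ord ℓ) (suc n)) (κ : Ord ℓ)
                 (ω≤α : ∀ i → ω ≤ α i) (card : ∀ i → IsCardinality (α i) κ)
                 (α≈ : ∀ i → α i ≈ κ · q i + r i) (r<κ : ∀ i → r i < κ) where

    κ-initial : Initial κ
    κ-initial β E = ⟨ proj₂ (card zero) β (Compose.bijection (proj₁ (card zero)) E) ⟩

    ω≼κ : ω ≼ κ
    ω≼κ = ω≼-resp-↪ ⟨ ω≤α zero ⟩ (Equipotent⇒↪ (proj₁ (card zero)))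

    open InitialOrdinal κ-initial ω≼κ public

    r≺κ : ∀ i → r i ≺ κ
    r≺κ i = ⟨ r<κ i ⟩

    ∑r≺κ : ∑ r ≺ κ
    ∑r≺κ = ∑-≺ r 0≺κ +-closed r≺κ

    open Successor κ-initial (∑ r) ∑r≺κ public

    α≃ : ∀ i → α i ≃ κ · q i + r i
    α≃ i = ≈⇒≃ (α≈ i)

    module Upper (P : Poset ℓ ℓ ℓ) (D : IntersectionOfWPOs P α) where
      open Poset P using () renaming (Carrier to V; _≈_ to _≋_; _≤_ to _≤ᴾ_)
      open IntersectionOfWPOs D

      po : ∀ i → IsPartialOrder _≋_ (order i)
      po i = IsWPO.isPartialOrder (isWPO i)

      ranking : ∀ i → Ranking (po i)
      ranking i = linearExtension⇒Ranking (po i) (proj₁ (isLength i))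

      wt-order : ∀ i → WT (order i) Full
      wt-order i = IsWPO⇒WT (isWPO i)

      wt-⋂ : WT (⋂ order) Full
      wt-⋂ = WT-⋂ (suc n) wt-order

      module Parts {main rest : Fin (suc n) → V → Set ℓ} (main-or-rest : ∀ i x → main i x ⊎ rest i x)
                   (Len-main : ∀ i → Len (order i) (main i) (κ · q i))
                   (Len-rest : ∀ i → Len (order i) (rest i) (r i)) where

        Main Rest : V → Set ℓ
        Main x = ∀ i → main i x
        Rest x = Σ[ i ∈ Fin (suc n) ] rest i x

        cover : ∀ x → Full x → Main x ⊎ Rest x
        cover x _ with em {P = Rest x}
        ... | yes p = inj₂ p
        ... | no ¬p = inj₁ λ i → [ id , (λ p → ⊥-elim (¬p (i , p))) ] (main-or-rest i x)

        rest↪ : ∀ {ρ} → Big (⋂ order) Rest ρ → ρ ↪ ∑ r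
        rest↪ {ρ} c = ↪-intro {α = ρ} φ φ≺ λ x y e → φ-inj x y (code-injective r _ _ (pos≺ x) (pos≺ y) e)
          where
          po∩ = ⋂-isPartialOrder κ-initial closed 0≺κ po
          m = reflecting po∩ (⋂-ranking κ-initial closed 0≺κ po (ranking zero)) (WT-mono (λ _ _ → tt) wt-⋂) c
          at : El ρ → V
          at x = proj₁ m (val ρ x) (val-≺ ρ x)
          at∈ : ∀ x → Rest (at x)
          at∈ x = proj₁ (proj₂ m) (val ρ x) (val-≺ ρ x)
          rk : Fin (suc n) → V → Ord ℓ
          rk i = Ranking.rk (ranking i)
          pos : El ρ → Ord ℓ
          pos x = let i = proj₁ (at∈ x) in position (rk i) (Ranking.rk-mono (ranking i)) (rest i) (at x)
          pos≺ : ∀ x → pos x ≺ r (proj₁ (at∈ x))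
          pos≺ x = let i = proj₁ (at∈ x) in
            position-≺ (rk i) (Ranking.rk-mono (ranking i)) (Len-rest i) (proj₂ (at∈ x))
          φ : El ρ → Ord ℓ
          φ x = code r (proj₁ (at∈ x)) (pos x)
          φ≺ : ∀ x → φ x ≺ ∑ r
          φ≺ x = code-≺ r (proj₁ (at∈ x)) (pos≺ x)
          same : ∀ i j x y → rest i x → rest j y → i ≡ j →
                 position (rk i) (Ranking.rk-mono (ranking i)) (rest i) x ≃
                 position (rk j) (Ranking.rk-mono (ranking j)) (rest j) y → x ≋ y
          same i _ x y p p′ refl e = Ranking.rk-injective (ranking i)
            (position-injective (rk i) (Ranking.rk-mono (ranking i)) {rest i} p p′ e)
          φ-inj : ∀ x y → proj₁ (at∈ x) ≡ proj₁ (at∈ y) × pos x ≃ pos y → val ρ x ≃ val ρ y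
          φ-inj x y (i≡j , e) =
            let x≋y = same _ _ _ _ (proj₂ (at∈ x)) (proj₂ (at∈ y)) i≡j e
            in proj₂ (proj₂ m) _ _ _ _ (IsPartialOrder.reflexive po∩ x≋y)
             , proj₂ (proj₂ m) _ _ _ _ (IsPartialOrder.reflexive po∩ (IsPartialOrder.Eq.sym po∩ x≋y))

        bound : ∀ {π} → Is⨂ q π → Σ[ ρ ∈ Ord ℓ ] ρ ≺ μ × Len _≤ᴾ_ Full (κ · π + ρ)
        bound {π} t =
          let (ρ , l , c) = rankOf {S = Rest} (WT-mono (λ _ _ → tt) wt-⋂)
              ρ≺μ = ↪⇒≺μ (rest↪ c)
              l′ = Len-⋂ κ-initial closed 0≺κ n po ranking wt-order t
                     (λ i → Len-mono {S′ = Main} (λ x p → p i) ≼-refl (Len-main i))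
          in ρ , ρ≺μ , Len-comap id (⊆-refl , λ x y _ _ p → Equivalence.from (intersection x y) p)
               -- As ρ ≺ μ ≼ κ, the natural sum of `κ · π` and ρ is at most the ordinary one.
               (≼-trans (⊕-mono-≼ (≼-+ˡ (κ · π) (fin 0)) ≼-refl)
                 (≼-trans (·-+-⊕-≼ κ closed π 0≺κ (≺-≼-trans ρ≺μ μ≼κ)) (+-mono-≼ ≼-refl (⊕-identityˡ-≼ ρ))))
               (Len-∪ cover l′ l)

      Len-≤ : ∀ {π} → Is⨂ q π → Σ[ ρ ∈ Ord ℓ ] ρ ≺ μ × Len _≤ᴾ_ Full (κ · π + ρ)
      Len-≤ = Parts.bound (λ i x → proj₁ (proj₂ (proj₂ (parts i))) x tt)
        (λ i → proj₁ (proj₂ (proj₂ (proj₂ (proj₂ (proj₂ (parts i)))))))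
        (λ i → proj₂ (proj₂ (proj₂ (proj₂ (proj₂ (proj₂ (parts i)))))))
        where
        parts = λ i → Len-split (λ {x} {y} {z} → IsPartialOrder.trans (po i) {x} {y} {z})
          (Len-mono ⊆-refl (proj₁ (α≃ i)) (IsLength⇒Len (po i) (wt-order i) (isLength i)))

    IntersectionLength⇒≺ : ∀ {π} → Is⨂ q π → ∀ l → IntersectionLength α l → l < κ · π + μ
    IntersectionLength⇒≺ {π} t l (P , D , isLen , _) =
      let (ρ , ρ≺μ , b) = Upper.Len-≤ P D t
      in un≺ (≼-≺-trans (LinearExtensionType⇒≼ b isLen) (+-monoʳ-≺ (κ · π) ρ≺μ))

  -- Natural products

  ≺-⊕ : (α β : Ord ℓ) → γ ≺ α ⊕ β → (Σ[ i ∈ Idx α ] γ ≼ α ! i ⊕ β) ⊎ (Σ[ j ∈ Idx β ] γ ≼ α ⊕ β ! j)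
  ≺-⊕ (lsub I f) (lsub J g) p with ≺-elim p
  ... | inj₁ i , q = inj₁ (i , q)
  ... | inj₂ j , q = inj₂ (j , q)

  ·-fin-suc-≽ : (κ : Ord ℓ) (k : ℕ) → κ + κ · fin k ≼ κ · fin (suc k)
  ·-fin-suc-≽ κ k = ≼-trans (+-mono-≼ (proj₂ (·-identityʳ κ)) ≼-refl)
    (≼-trans (proj₂ (·-distribˡ κ (fin 1) (fin k)))
      (·-monoʳ-≼ κ (≼-trans (+≼⊕ (fin 1) (fin k)) (fin-⊕ 1 k))))

  Big-intro : (∀ δ → δ ≺ γ → Σ[ x ∈ _ ] S x × Big R (S ∖[ R ] x) δ) → Big R S γ
  Big-intro h = big λ j → h _ (!-≺ j)

  infixr 5 _×ᴿ_ _×ˢ_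
  _×ᴿ_ : {X Y : Set ℓ} → Rel X ℓ → Rel Y ℓ → Rel (X × Y) ℓ
  R ×ᴿ R′ = (λ p q → R (proj₁ p) (proj₁ q)) ∩ᴿ (λ p q → R′ (proj₂ p) (proj₂ q))

  _×ˢ_ : {X Y : Set ℓ} → (X → Set ℓ) → (Y → Set ℓ) → X × Y → Set ℓ
  (A ×ˢ B) (x , y) = A x × B y

  WT-× : WT R S → WT R′ T → WT (R ×ᴿ R′) (S ×ˢ T)
  WT-× {R = R} {R′ = R′} w w′ = WT-∩ (λ _ → proj₁) (λ _ → proj₂)
    (WT-comap {R′ = λ p q → R (proj₁ p) (proj₁ q)} proj₁ ((λ _ Sx → Sx) , λ _ _ _ _ p → p) w)
    (WT-comap {R′ = λ p q → R′ (proj₂ p) (proj₂ q)} proj₂ ((λ _ Ty → Ty) , λ _ _ _ _ p → p) w′)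

  -- Φ is the product with a fixed set on one side. It keeps separated pieces separated, so k
  -- successive pieces of A yield k successive pieces of `Φ A`.
  Big-multiple : {Q : Rel Y ℓ} → Transitiveᴿ R → Closed κ → fin 0 ≺ κ →
    (Φ : (X → Set ℓ) → Y → Set ℓ) → (∀ {A B} → A ⊆ B → Φ A ⊆ Φ B) →
    (∀ {A B} → NotBelow R B A → NotBelow Q (Φ B) (Φ A)) →
    (∀ A → WT R A → Big R A κ → Big Q (Φ A) δ) →
    ∀ k A → WT R A → Big R A (κ · fin k) → Big Q (Φ A) (δ · fin k)
  Big-multiple {δ = δ} tr cl 0≺κ Φ mono sep ih zero A w c = Big-mono ⊆-refl (·-zeroʳ {γ = fin 0} δ) Big-0
  Big-multiple {κ = κ} {δ = δ} tr cl 0≺κ Φ mono sep ih (suc k) A w c =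
    let (B , C , B⊆ , C⊆ , ¬CB , cB , cC) =
          Big-split tr w cl 0≺κ k ≼-refl (Big-mono ⊆-refl (·-fin-suc-≽ κ k) c)
    in Big-mono ⊆-refl (·-fin-suc-≼ δ k) (Big-+ (mono B⊆) (mono C⊆) (sep ¬CB)
         (ih B (WT-mono B⊆ w) cB) (Big-multiple tr cl 0≺κ Φ mono sep ih k C (WT-mono C⊆ w) cC))

  sum⊕-≼ : Closed κ → fin 0 ≺ κ → ∀ {αs} → All (_≼ κ) αs → sum⊕ αs ≼ κ · fin (List.length αs)
  sum⊕-≼ {κ = κ} cl 0≺κ [] = 0≼
  sum⊕-≼ {κ = κ} cl 0≺κ {_ ∷ αs} (p ∷ ps) =
    ≼-trans (⊕-mono-≼ (≼-trans p (proj₂ (·-identityʳ κ))) (sum⊕-≼ cl 0≺κ ps))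
      (≼-trans (·-⊕-≼ κ cl 0≺κ (fin 1) (fin (List.length αs))) (·-monoʳ-≼ κ (fin-⊕ 1 (List.length αs))))

  sumω^≼sum⊕ : (as : List (Ord ℓ)) → sumω^ as ≼ sum⊕ (List.map ω^ as)
  sumω^≼sum⊕ [] = ≼-refl
  sumω^≼sum⊕ (a ∷ as) = ≼-trans (+≼⊕ (ω^ a) (sumω^ as)) (⊕-mono-≼ ≼-refl (sumω^≼sum⊕ as))

  nonincreasing⇒All : ∀ {as} → Nonincreasing (α ∷ as) → All (_≼ α) as
  nonincreasing⇒All [-] = []
  nonincreasing⇒All (p ∷ l) = ⟨ p ⟩ ∷ All.map (λ q → ≼-trans q ⟨ p ⟩) (nonincreasing⇒All l)

  nonincreasing-tail : ∀ {as} → Nonincreasing (α ∷ as) → Nonincreasing as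
  nonincreasing-tail [-]     = []
  nonincreasing-tail (_ ∷ l) = l

  -- Pieces of indecomposable rank and their rearrangement.

  module _ {X : Set ℓ} (R : Rel X ℓ) where

    record Block (S : X → Set ℓ) : Set (lsuc ℓ) where
      constructor mkBlock
      field
        exponent : Ord ℓ
        part     : X → Set ℓ
        part⊆    : part ⊆ S
        part-Big : Big R part (ω^ exponent)

  open Block

  module _ {X : Set ℓ} {R : Rel X ℓ} where

    Block-mono : S ⊆ T → Block R S → Block R T
    Block-mono s (mkBlock e A A⊆ c) = mkBlock e A (λ x Ax → s x (A⊆ x Ax)) c

    -- Sortable blocks can be rearranged by decreasing exponents without putting an element before a
    -- smaller one.

    Sorted : Block R S → Block R S → Set ℓ
    Sorted p q = NotBelow R (part q) (part p) × exponent q ≼ exponent p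

    Sortable : Block R S → Block R S → Set ℓ
    Sortable p q = NotBelow R (part q) (part p) × (exponent p ≺ exponent q → NotBelow R (part p) (part q))

    weights : List (Block R S) → List (Ord ℓ)
    weights = List.map (ω^ ∘ exponent)

    ⋃ : List (Block R S) → X → Set ℓ
    ⋃ []       x = ⊥
    ⋃ (p ∷ ps) x = part p x ⊎ ⋃ ps x

    ⋃-⊆ : (ps : List (Block R S)) → ⋃ ps ⊆ S
    ⋃-⊆ (p ∷ ps) x = [ part⊆ p x , ⋃-⊆ ps x ]

    ⋃-NotBelow : ∀ {p : Block R S} {ps} → All (Sorted p) ps → NotBelow R (⋃ ps) (part p)
    ⋃-NotBelow ((s , _) ∷ _) x y px (inj₁ qy) = s x y px qy
    ⋃-NotBelow {p = p} (_ ∷ ss) x y px (inj₂ qy) = ⋃-NotBelow {p = p} ss x y px qy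

    -- Each exponent bounds the following ones, so the rest is within a finite multiple of the
    -- leading power, and the ordinary sum obtained from `Big-+` is as large as the natural one.
    Sorted⇒Big : (ps : List (Block R S)) → AllPairs Sorted ps → Big R (⋃ ps) (sum⊕ (weights ps))
    Sorted⇒Big [] [] = Big-0
    Sorted⇒Big (p ∷ ps) (s ∷ ss) = Big-mono ⊆-refl
      (⊕-absorb-≼ (ω^ (exponent p)) (Closed-ω^ (exponent p)) (0≺ω^ (exponent p)) (List.length (weights ps))
        (sum⊕-≼ (Closed-ω^ (exponent p)) (0≺ω^ (exponent p)) (AllP.map⁺ (All.map (λ t → ω^-mono-≼ (proj₂ t)) s))))
      (Big-+ (λ _ → inj₁) (λ _ → inj₂) (⋃-NotBelow {p = p} s) (part-Big p) (Sorted⇒Big ps ss))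

    -- `Sortable` permits moving p past the blocks of larger exponent. The quantified predicate
    -- expresses that `qs` has no entries besides p and those of `ps`.
    insert : (p : Block R S) (ps : List (Block R S)) → All (Sortable p) ps → AllPairs Sorted ps →
      Σ[ qs ∈ List (Block R S) ] AllPairs Sorted qs ×
        (∀ {P : Block R S → Set ℓ} → P p → All P ps → All P qs) ×
        ω^ (exponent p) ⊕ sum⊕ (weights ps) ≼ sum⊕ (weights qs)
    insert p [] [] [] = p ∷ [] , [] ∷ [] , (λ Pp _ → Pp ∷ []) , ≼-refl
    insert p (q ∷ qs) (t ∷ ts) (s ∷ ss) with compare (exponent q) (exponent p)
    ... | inj₁ e = p ∷ q ∷ qs
                 , ((proj₁ t , e) ∷ All.zipWith (λ ((u , _) , (_ , v)) → u , ≼-trans v e) (ts , s)) ∷ s ∷ ss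
                 , _∷_ , ≼-refl
    ... | inj₂ e with insert p qs ts ss
    ...   | rs , ss′ , all , sum≼ = q ∷ rs , all (proj₂ t e , ≺⇒≼ e) s ∷ ss′
          , (λ { Pp (Pq ∷ Ps) → Pq ∷ all Pp Ps })
          , ≼-trans (proj₂ (⊕-assoc P Q Σqs)) (≼-trans (⊕-mono-≼ (⊕-comm-≼ P Q) ≼-refl)
              (≼-trans (proj₁ (⊕-assoc Q P Σqs)) (⊕-mono-≼ ≼-refl sum≼)))
      where
      P = ω^ (exponent p)
      Q = ω^ (exponent q)
      Σqs = sum⊕ (weights qs)

    sort : (ps : List (Block R S)) → AllPairs Sortable ps →
      Σ[ qs ∈ List (Block R S) ] AllPairs Sorted qs ×
        (∀ {P : Block R S → Set ℓ} → All P ps → All P qs) × sum⊕ (weights ps) ≼ sum⊕ (weights qs)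
    sort [] [] = [] , [] , (λ _ → []) , ≼-refl
    sort (p ∷ ps) (t ∷ ts) =
      let (qs , ss , all , sum≼) = sort ps ts
          (rs , ss′ , all′ , sum≼′) = insert p qs (all t) ss
      in rs , ss′ , (λ { (Pp ∷ Ps) → all′ Pp (all Ps) }) , ≼-trans (⊕-mono-≼ ≼-refl sum≼) sum≼′

    Sortable⇒Big : (ps : List (Block R S)) → AllPairs Sortable ps → Big R S (sum⊕ (weights ps))
    Sortable⇒Big ps ts =
      let (qs , ss , _ , sum≼) = sort ps ts
      in Big-mono (⋃-⊆ qs) sum≼ (Sorted⇒Big qs ss)

    blocks : Transitiveᴿ R → ∀ as → Nonincreasing as → WT R S → Big R S (sumω^ as) →
             Σ[ ps ∈ List (Block R S) ] List.map exponent ps ≡ as × AllPairs Sorted ps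
    blocks tr [] _ _ _ = [] , refl , []
    blocks {S = S} tr (a ∷ as) l w c =
      let as≼a = nonincreasing⇒All l
          (A , B , A⊆ , B⊆ , ¬BA , cA , cB) = Big-split tr w (Closed-ω^ a) (0≺ω^ a) (List.length (List.map ω^ as))
            (≼-trans (sumω^≼sum⊕ as) (sum⊕-≼ (Closed-ω^ a) (0≺ω^ a) (AllP.map⁺ (All.map ω^-mono-≼ as≼a)))) c
          (ps , ≡e , ss) = blocks tr as (nonincreasing-tail l) (WT-mono B⊆ w) cB
      in mkBlock a A A⊆ cA ∷ List.map (Block-mono B⊆) ps
       , cong (a ∷_) (trans (exponents B⊆ ps) ≡e)
       , AllP.map⁺ (separated {A⊆ = A⊆} {c = cA} B⊆ ¬BA ps (subst (All (_≼ a)) (sym ≡e) as≼a)) ∷ AllPairs.map⁺ ss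
      where
      exponents : (s : T ⊆ S) (ps : List (Block R T)) →
                  List.map exponent (List.map (Block-mono s) ps) ≡ List.map exponent ps
      exponents s []       = refl
      exponents s (p ∷ ps) = cong (exponent p ∷_) (exponents s ps)
      separated : ∀ {A A⊆ c} → (s : T ⊆ S) → NotBelow R T A → (ps : List (Block R T)) →
                  All (_≼ a) (List.map exponent ps) → All (λ q → Sorted (mkBlock a A A⊆ c) (Block-mono s q)) ps
      separated s ¬TA []       []       = []
      separated {A⊆ = A⊆} {c = c} s ¬TA (p ∷ ps) (e ∷ es) =
        ((λ x y Ax py → ¬TA x y Ax (part⊆ p y py)) , e) ∷ separated {A⊆ = A⊆} {c = c} s ¬TA ps es

    Sorted⇒NotBelow : (ps : List (Block R S)) → AllPairs Sorted ps →
      All (λ p → All (λ q → exponent p ≺ exponent q → NotBelow R (part p) (part q)) ps) ps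
    Sorted⇒NotBelow [] [] = []
    Sorted⇒NotBelow (p ∷ ps) (s ∷ ss) =
        ((λ e → ⊥-elim (≺-irrefl e)) ∷ All.map (λ (_ , v) e → ⊥-elim (≼⇒⊁ v e)) s)
      ∷ All.zipWith (λ ((u , _) , vs) → (λ _ → u) ∷ vs) (s , Sorted⇒NotBelow ps ss)

  map-cartesianProductWith : {A B C : Set a} {D E : Set b} {g : A → B → C} {f : C → E} {h : D → D → E}
    {k : A → D} {k′ : B → D} → (∀ x y → f (g x y) ≡ h (k x) (k′ y)) →
    ∀ xs ys → List.map f (cartesianProductWith g xs ys) ≡ cartesianProductWith h (List.map k xs) (List.map k′ ys)
  map-cartesianProductWith ≡e [] ys = refl
  map-cartesianProductWith {g = g} {f} {h} {k} {k′} ≡e (x ∷ xs) ys =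
    trans (map-++ f (List.map (g x) ys) (cartesianProductWith g xs ys))
      (cong₂ List._++_ (row ys) (map-cartesianProductWith {g = g} {f} {h} {k} {k′} ≡e xs ys))
    where
    row : ∀ ys → List.map f (List.map (g x) ys) ≡ List.map (h (k x)) (List.map k′ ys)
    row []       = refl
    row (y ∷ ys) = cong₂ _∷_ (≡e x y) (row ys)

  module _ {X Y : Set ℓ} {R₁ : Rel X ℓ} {R₂ : Rel Y ℓ} (tr₁ : Transitiveᴿ R₁) (tr₂ : Transitiveᴿ R₂) where

    private
      Goal : Ord ℓ → Ord ℓ → Set (lsuc ℓ)
      Goal a b = ∀ A B → WT R₁ A → WT R₂ B → Big R₁ A (ω^ a) → Big R₂ B (ω^ b) → Big (R₁ ×ᴿ R₂) (A ×ˢ B) (ω^ (a ⊕ b))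

      step : ∀ a b → (∀ i → Goal (a ! i) b) → (∀ j → Goal a (b ! j)) → Goal a b
      step a b ihₐ ih_b A B w₁ w₂ c₁ c₂ = Big-intro λ δ p → point δ (≺-ω^ (a ⊕ b) p)
        where
        Point : Ord ℓ → Set ℓ
        Point δ = Σ[ z ∈ X × Y ] (A ×ˢ B) z × Big (R₁ ×ᴿ R₂) ((A ×ˢ B) ∖[ R₁ ×ᴿ R₂ ] z) δ
        -- After (x , y), a bad sequence may continue anywhere in the product of `A ∖[ R₁ ] x` with
        -- B; x is taken such that the first factor keeps rank at least k copies of `ω^ (a ! i)`.
        left : ∀ i k → Point (ω^ (a ! i ⊕ b) · fin k)
        left i k =
          let (x , Ax , c) = Big-elim c₁ (ω^-intro-! a i k)
              (y , By , _) = Big-elim c₂ (0≺ω^ b)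
          in (x , y) , (Ax , By) , Big-mono (λ z ((Az , ¬xz) , Bz) → (Az , Bz) , λ (r , _) → ¬xz r) ≼-refl
               (Big-multiple {Q = R₁ ×ᴿ R₂} tr₁ (Closed-ω^ (a ! i)) (0≺ω^ (a ! i)) (_×ˢ B)
                 (λ s z (Az , Bz) → s _ Az , Bz) (λ s z z′ (Az , _) (Az′ , _) (r , _) → s _ _ Az Az′ r)
                 (λ A′ w c′ → ihₐ i A′ B w w₂ c′ c₂) k (A ∖[ R₁ ] x) (WT-mono (λ _ → proj₁) w₁) c)
        right : ∀ j k → Point (ω^ (a ⊕ b ! j) · fin k)
        right j k =
          let (x , Ax , _) = Big-elim c₁ (0≺ω^ a)
              (y , By , c) = Big-elim c₂ (ω^-intro-! b j k)
          in (x , y) , (Ax , By) , Big-mono (λ z (Az , (Bz , ¬yz)) → (Az , Bz) , λ (_ , r) → ¬yz r) ≼-refl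
               (Big-multiple {Q = R₁ ×ᴿ R₂} tr₂ (Closed-ω^ (b ! j)) (0≺ω^ (b ! j)) (A ×ˢ_)
                 (λ s z (Az , Bz) → Az , s _ Bz) (λ s z z′ (_ , Bz) (_ , Bz′) (_ , r) → s _ _ Bz Bz′ r)
                 (λ B′ w c′ → ih_b j A B′ w₁ w c₁ c′) k (B ∖[ R₂ ] y) (WT-mono (λ _ → proj₁) w₂) c)
        weaken : ∀ {δ δ′} → δ ≼ δ′ → Point δ′ → Point δ
        weaken p (z , z∈ , c) = z , z∈ , Big-mono ⊆-refl p c
        point : ∀ δ → δ ≼ fin 0 ⊎ (Σ[ i ∈ Idx (a ⊕ b) ] Σ[ k ∈ ℕ ] δ ≼ ω^ ((a ⊕ b) ! i) · fin k) → Point δ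
        point δ (inj₁ p) =
          let (x , Ax , _) = Big-elim c₁ (0≺ω^ a)
              (y , By , _) = Big-elim c₂ (0≺ω^ b)
          in (x , y) , (Ax , By) , Big-mono ⊆-refl p Big-0
        point δ (inj₂ (i , k , p)) with ≺-⊕ a b (!-≺ i)
        ... | inj₁ (i′ , q) = weaken (≼-trans p (·-monoˡ-≼ (ω^-mono-≼ q) (fin k))) (left i′ k)
        ... | inj₂ (j′ , q) = weaken (≼-trans p (·-monoˡ-≼ (ω^-mono-≼ q) (fin k))) (right j′ k)

    Big-ω^-× : ∀ a b → Goal a b
    Big-ω^-× (lsub I f) (lsub J g) = step (lsub I f) (lsub J g)
      (λ i → Big-ω^-× (f i) (lsub J g)) (λ j → Big-ω^-× (lsub I f) (g j))

    module _ {A : X → Set ℓ} {B : Y → Set ℓ} (w₁ : WT R₁ A) (w₂ : WT R₂ B) where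

      private
        pair : Block R₁ A → Block R₂ B → Block (R₁ ×ᴿ R₂) (A ×ˢ B)
        pair (mkBlock a A′ A′⊆ c) (mkBlock b B′ B′⊆ d) = mkBlock (a ⊕ b) (A′ ×ˢ B′) (λ z (p , q) → A′⊆ _ p , B′⊆ _ q)
          (Big-ω^-× a b A′ B′ (WT-mono A′⊆ w₁) (WT-mono B′⊆ w₂) c d)

        Free : Block R₂ B → Block R₂ B → Set ℓ
        Free q q′ = exponent q ≺ exponent q′ → NotBelow R₂ (part q) (part q′)

        sortable-row : ∀ p qs → AllPairs Sorted qs → AllPairs Sortable (List.map (pair p) qs)
        sortable-row p [] [] = []
        sortable-row p (q ∷ qs) (s ∷ ss) = AllP.map⁺ (All.map
            (λ (u , v) → (λ z z′ (_ , Bz) (_ , Bz′) (_ , r) → u _ _ Bz Bz′ r)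
                       , λ e → ⊥-elim (≼⇒⊁ (⊕-mono-≼ ≼-refl v) e)) s)
          ∷ sortable-row p qs ss

        -- The exponent of `p′` is at most that of p. So if the second product has the larger
        -- exponent, then q has a smaller exponent than `q′` and by `Free` is not below it; the two
        -- products may be exchanged.
        sortable-pair : ∀ {p p′ q q′} → Sorted p p′ → Free q q′ → Sortable (pair p q) (pair p′ q′)
        sortable-pair (u , v) f = (λ z z′ (Az , _) (Az′ , _) (r , _) → u _ _ Az Az′ r)
          , λ e z z′ (_ , Bz) (_ , Bz′) (_ , r) →
              f (⋠⇒≻ λ q′≼q → ≼⇒⊁ (⊕-mono-≼ v q′≼q) e) _ _ Bz Bz′ r

        sortable-rows : ∀ p ps q qs → All (Sorted p) ps → All (Free q) qs →
                        All (Sortable (pair p q)) (cartesianProductWith pair ps qs)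
        sortable-rows p [] q qs _ _ = []
        sortable-rows p (p′ ∷ ps) q qs (s ∷ ss) fs = AllP.++⁺
          (AllP.map⁺ (All.map (λ {q′} → sortable-pair {p} {p′} {q} {q′} s) fs)) (sortable-rows p ps q qs ss fs)

        sortable : ∀ ps qs → AllPairs Sorted ps → AllPairs Sorted qs →
                   AllPairs Sortable (cartesianProductWith pair ps qs)
        sortable [] qs _ _ = []
        sortable (p ∷ ps) qs (s ∷ ss) ts = AllPairs.++⁺ (sortable-row p qs ts) (sortable ps qs ss ts)
          (AllP.map⁺ (All.map (λ {q} fs → sortable-rows p ps q qs s fs) (Sorted⇒NotBelow qs ts)))

      Big-× : IsNaturalProduct α β γ → Big R₁ A α → Big R₂ B β → Big (R₁ ×ᴿ R₂) (A ×ˢ B) γ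
      Big-× (as , bs , (las , α≈) , (lbs , β≈) , γ≈) c d =
        let (ps , eqp , ss) = blocks tr₁ as las w₁ (Big-mono ⊆-refl (proj₂ (≈⇒≃ α≈)) c)
            (qs , eqq , ts) = blocks tr₂ bs lbs w₂ (Big-mono ⊆-refl (proj₂ (≈⇒≃ β≈)) d)
            ≡e = trans (map-cartesianProductWith {g = pair} {f = ω^ ∘ exponent} {h = λ a b → ω^ (a ⊕ b)}
                          (λ _ _ → refl) ps qs) (cong₂ powers eqp eqq)
        in Big-mono ⊆-refl (proj₁ (≈⇒≃ γ≈)) (subst (λ γs → Big _ _ (sum⊕ γs)) ≡e
             (Sortable⇒Big (cartesianProductWith pair ps qs) (sortable ps qs ss ts)))

  naturalProduct : (α β : Ord ℓ) → Σ[ γ ∈ Ord ℓ ] IsNaturalProduct α β γ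
  naturalProduct α β =
    let (as , las , α≃) = cantor α
        (bs , lbs , β≃) = cantor β
    in sum⊕ (powers as bs) , as , bs , (las , ≃⇒≈ α≃) , (lbs , ≃⇒≈ β≃) , ≃⇒≈ ≃-refl

  ⨂ : ∀ {n} (q : Vector (Ord ℓ) n) → Σ[ π ∈ Ord ℓ ] Is⨂ q π
  ⨂ {n = zero}  q = fin 1 , nil (≃⇒≈ ≃-refl)
  ⨂ {n = suc n} q =
    let (β , t) = ⨂ (q ∘ suc)
        (γ , p) = naturalProduct (q zero) β
    in γ , cons t p

  -- Finite products of ordinals under the coordinatewise order.

  Π : ∀ {n} → Vector (Ord ℓ) n → Set ℓ
  Π {n = n} q = (i : Fin n) → El (q i)

  Π-order : ∀ {n} (q : Vector (Ord ℓ) n) → Rel (Π q) ℓ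
  Π-order q f g = ∀ i → val-order (q i) (f i) (g i)

  WT-El : (α : Ord ℓ) → WT (val-order α) Full
  WT-El α = Len⇒WT (Len-rank (val α) (λ _ _ → ⋠⇒≻) α (λ p _ → val-≺ α p))

  WT-Π : ∀ n (q : Vector (Ord ℓ) n) → WT (Π-order q) Full
  WT-Π zero q = wt λ f _ → wt λ g (_ , ¬fg) → ⊥-elim (¬fg λ ())
  WT-Π (suc n) q = WT-comap (λ f → f zero , f ∘ suc)
    ((λ _ _ → tt , tt) , λ { _ _ _ _ (r , rs) → λ { zero → r ; (suc i) → rs i } })
    (WT-× (WT-El (q zero)) (WT-Π n (q ∘ suc)))

  Big-Π : ∀ n {q : Vector (Ord ℓ) n} {π} → Is⨂ q π → Big (Π-order q) Full π
  Big-Π zero (nil π≈1) = Big-mono ⊆-refl (proj₁ (≈⇒≃ π≈1)) (big λ _ → (λ ()) , tt , Big-0)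
  Big-Π (suc n) {q} (cons t p) = Big-map cons′ (λ _ _ → tt) (λ _ _ _ _ r → r zero , r ∘ suc) ≼-refl
    (Big-× {R₁ = val-order (q zero)} {R₂ = Π-order (q ∘ suc)} ≼-trans (λ f g i → ≼-trans (f i) (g i))
      (WT-El (q zero)) (WT-Π n (q ∘ suc)) p (Big-El (q zero)) (Big-Π n t))
    where
    cons′ : El (q zero) × Π (q ∘ suc) → Π q
    cons′ (x , f) zero    = x
    cons′ (x , f) (suc i) = f i

  -- The lower bound

  -- Once x is chosen in the fibre over y, the fibres over `T ∖[ Q ] y` are still complete. None of
  -- their elements lies above one of `F y`, so the rest of `F y` can be stacked on them.
  Big-lex : {X Y : Set ℓ} {R : Rel X ℓ} {Q : Rel Y ℓ} {T : Y → Set ℓ} (F : Y → X → Set ℓ) →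
            (∀ y → Big R (F y) κ) → (∀ {x x′ y y′} → F y x → F y′ x′ → R x x′ → Q y y′) →
            Big Q T π → Big R (λ x → Σ[ y ∈ Y ] T y × F y x) (κ · π)
  Big-lex {κ = lsub I f} {π = lsub J g} {R = R} {Q = Q} {T = T} F fib reflects (big h) = big λ (j , i) →
    let (y , Ty , c) = h j
        (x , Fx , d) = Big-elim (fib y) (!-≺ {α = lsub I f} i)
    in x , (y , Ty , Fx) , Big-+
         {A = λ z → Σ[ y′ ∈ _ ] (T ∖[ Q ] y) y′ × F y′ z} {B = F y ∖[ R ] x}
         (λ { z (y′ , (Ty′ , ¬yy′) , Fz) → (y′ , Ty′ , Fz) , λ xz → ¬yy′ (reflects Fx Fz xz) })
         (λ { z (Fz , ¬xz) → (y , Ty , Fz) , ¬xz })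
         (λ { u v (y′ , (_ , ¬yy′) , Fu) (Fv , _) vu → ¬yy′ (reflects Fv Fu vu) })
         (Big-lex F fib reflects c) d

  -- φ may reorder κ, but its image is a subset of κ in bijection with κ, and as κ is initial the
  -- image has order type at least κ.
  Big-injective : Initial κ → (φ : El κ → Ord ℓ) → Injective′ κ φ → (∀ x → φ x ≺ κ) →
                  Big (λ x y → φ x ≼ φ y) Full κ
  Big-injective {κ = κ} init φ inj φ≺ =
    Big-mono (λ _ _ → tt) (Initial⇒≼type φ inj init κ φ≺) (≺-rec _ step κ)
    where
    open OrderType (Image φ inj) (Image-resp φ inj)
    step : ∀ γ → (∀ β → β ≺ γ → Big (λ x y → φ x ≼ φ y) (λ x → φ x ≺ β) (type β)) →
           Big (λ x y → φ x ≼ φ y) (λ x → φ x ≺ γ) (type γ)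
    step γ ih = big λ (p , (x , (x≼ , ≼x) , _)) → x , ≼-≺-trans x≼ (val-≺ γ p)
      , subst (Big _ _) (sym (typeᵛ≡ γ p)) (Big-mono
          (λ y y≺ → ≺-trans y≺ (val-≺ γ p) , λ x≼y → ≼⇒⊁ x≼y (≺-≼-trans y≺ ≼x)) ≼-refl
          (ih (val γ p) (val-≺ γ p)))

  ·-+-injective : (κ : Ord ℓ) → σ ≺ κ → ρ ≺ κ → κ · π + σ ≃ κ · τ + ρ → π ≃ τ × σ ≃ ρ
  ·-+-injective {σ = σ} {ρ = ρ} {π = π} {τ = τ} κ σ≺ ρ≺ e =
    let π≼τ = ·-cancel-≼ {σ = σ} κ ρ≺ (proj₁ e)
        τ≼π = ·-cancel-≼ {σ = ρ} κ σ≺ (proj₂ e)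
    in (π≼τ , τ≼π)
     , +-cancelˡ-≼ (κ · π) (≼-trans (proj₁ e) (+-mono-≼ (·-monoʳ-≼ κ τ≼π) ≼-refl))
     , +-cancelˡ-≼ (κ · τ) (≼-trans (proj₂ e) (+-mono-≼ (·-monoʳ-≼ κ π≼τ) ≼-refl))

  module Packing {ℓ} {κ : Ord ℓ} where

    -- An injection of Π q × κ into κ that absorbs one coordinate at a time: the coordinate becomes
    -- the quotient and the code of the others the remainder of an element of `κ · q i`.
    pack : ∀ n {q : Vector (Ord ℓ) n} → (∀ i → κ · q i ↪ κ) → Π q → El κ → El κ
    pack zero    inj f k = k
    pack (suc n) {q} inj f k = proj₁ (inj zero) (proj₁ (find (κ · q zero)
      (·-intro κ (q zero) (val-≺ (q zero) (f zero)) (val-≺ κ (pack n (inj ∘ suc) (f ∘ suc) k)))))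

    pack-injective : ∀ n {q : Vector (Ord ℓ) n} (inj : ∀ i → κ · q i ↪ κ) f f′ k k′ →
      val κ (pack n inj f k) ≃ val κ (pack n inj f′ k′) →
      (∀ i → val (q i) (f i) ≃ val (q i) (f′ i)) × val κ k ≃ val κ k′
    pack-injective zero inj f f′ k k′ e = (λ ()) , e
    pack-injective (suc n) {q} inj f f′ k k′ e =
      let (e₀ , e′) = ·-+-injective κ (val-≺ κ (rest f k)) (val-≺ κ (rest f′ k′))
            (≃-trans (≃-sym (proj₂ (found f k))) (≃-trans (proj₂ (inj zero) _ _ e) (proj₂ (found f′ k′))))
          (es , e″) = pack-injective n (inj ∘ suc) (f ∘ suc) (f′ ∘ suc) k k′ e′
      in (λ { zero → e₀ ; (suc i) → es i }) , e″
      where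
      rest : Π q → El κ → El κ
      rest f k = pack n (inj ∘ suc) (f ∘ suc) k
      found : ∀ f k → Σ[ p ∈ El (κ · q zero) ] val (κ · q zero) p ≃ κ · val (q zero) (f zero) + val κ (rest f k)
      found f k = find (κ · q zero) (·-intro κ (q zero) (val-≺ (q zero) (f zero)) (val-≺ κ (rest f k)))

  module Lower {ℓ} {m : ℕ} (α q r : Vector (Ord ℓ) (suc (suc m))) (κ : Ord ℓ)
               (ω≤α : ∀ i → ω ≤ α i) (card : ∀ i → IsCardinality (α i) κ)
               (α≈ : ∀ i → α i ≈ κ · q i + r i) (r<κ : ∀ i → r i < κ) where

    open Setting α q r κ ω≤α card α≈ r<κ
    open Packing {κ = κ}

    private
      I = Fin (suc (suc m))

      other : (i : I) → Σ[ j ∈ I ] ¬ j ≡ i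
      other zero    = suc zero , λ ()
      other (suc i) = zero , λ ()

    0≺q : ∀ i → fin 0 ≺ q i
    0≺q i = ⋠⇒≻ λ q≼0 → ≼⇒⊁ (≼-trans ⟨ proj₂ (card i) (α i) Equipotent-refl ⟩ (≼-trans (proj₁ (α≃ i))
      (≼-trans (+-mono-≼ (≼-trans (·-monoʳ-≼ κ q≼0) (·-zeroʳ κ)) ≼-refl) (proj₁ (+-identityˡ (r i)))))) (r≺κ i)

    κ·q↪κ : ∀ i → κ · q i ↪ κ
    κ·q↪κ i = ↪-trans (≼⇒↪ (≼-trans (≼-+ˡ (κ · q i) (r i)) (proj₂ (α≃ i)))) (Equipotent⇒↪ (proj₁ (card i)))

    V : Set ℓ
    V = (Π q × El κ) ⊎ Σ[ j ∈ I ] El (r j)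

    module Example (ρ : Ord ℓ) (ρ≺κ : ρ ≺ κ) (φ : El ρ → El (∑ r)) (φ-injective : Injective′ ρ (val (∑ r) ∘ φ))
                   (φ-cong : ∀ x y → val ρ x ≃ val ρ y → val (∑ r) (φ x) ≃ val (∑ r) (φ y)) where

      -- ι numbers the elements of V by ordinals below κ, the decoded images of the elements of ρ by
      -- these elements themselves.  The i-th order has the copy of r i on top, and below it compares
      -- the i-th coordinates (0 outside Π q × El κ) before the numbers.

      codeᴿ : (Σ[ j ∈ I ] El (r j)) → Ord ℓ
      codeᴿ (j , v) = code r j (val (r j) v)

      codeᴿ-≺ : ∀ p → codeᴿ p ≺ ∑ r
      codeᴿ-≺ (j , v) = code-≺ r j (val-≺ (r j) v)

      Hit : Ord ℓ → Set ℓ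
      Hit γ = Σ[ b ∈ El ρ ] val (∑ r) (φ b) ≃ γ

      place : ∀ {γ} → Dec (Hit γ) → Ord ℓ
      place     (yes (b , _)) = val ρ b
      -- Codes missed by φ go above ρ, clear of the numbers given to its images.
      place {γ} (no _)        = ρ + γ

      place-≺ : ∀ {γ} (d : Dec (Hit γ)) → γ ≺ ∑ r → place d ≺ ρ + ∑ r
      place-≺ (yes (b , _)) _ = ≺-≼-trans (val-≺ ρ b) (≼-+ˡ ρ (∑ r))
      place-≺ (no _)        p = +-monoʳ-≺ ρ p

      place-cong : ∀ {γ γ′} (d : Dec (Hit γ)) (d′ : Dec (Hit γ′)) → γ ≃ γ′ → place d ≃ place d′
      place-cong (yes (b , e)) (yes (b′ , e′)) p = φ-injective b b′ (≃-trans e (≃-trans p (≃-sym e′)))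
      place-cong (yes (b , e)) (no ¬h)         p = ⊥-elim (¬h (b , ≃-trans e p))
      place-cong (no ¬h)       (yes (b , e))   p = ⊥-elim (¬h (b , ≃-trans e (≃-sym p)))
      place-cong (no _)        (no _)          p = +-cong ≃-refl p

      place-injective : ∀ {γ γ′} (d : Dec (Hit γ)) (d′ : Dec (Hit γ′)) → place d ≃ place d′ → γ ≃ γ′
      place-injective (yes (b , e)) (yes (b′ , e′)) p = ≃-trans (≃-sym e) (≃-trans (φ-cong b b′ p) e′)
      place-injective {γ′ = γ′} (yes (b , _)) (no _) p =
        ⊥-elim (≼⇒⊁ (≼-trans (≼-+ˡ ρ γ′) (proj₂ p)) (val-≺ ρ b))
      place-injective {γ} (no _) (yes (b , _)) p =
        ⊥-elim (≼⇒⊁ (≼-trans (≼-+ˡ ρ γ) (proj₁ p)) (val-≺ ρ b))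
      place-injective (no _) (no _) p = +-cancelˡ-≼ ρ (proj₁ p) , +-cancelˡ-≼ ρ (proj₂ p)

      ιᴿ : (Σ[ j ∈ I ] El (r j)) → Ord ℓ
      ιᴿ p = place (em {P = Hit (codeᴿ p)})

      ι : V → Ord ℓ
      -- The offset keeps these numbers clear of those of the copies of the `r j`, which are all
      -- below ρ + `∑ r`.
      ι (inj₁ (f , k)) = (ρ + ∑ r) + val κ (pack _ κ·q↪κ f k)
      ι (inj₂ p)       = ιᴿ p

      ιᴿ-≺ : ∀ p → ιᴿ p ≺ ρ + ∑ r
      ιᴿ-≺ p = place-≺ em (codeᴿ-≺ p)

      ι-≺ : ∀ x → ι x ≺ κ
      ι-≺ (inj₁ (f , k)) = +-closed (+-closed ρ≺κ ∑r≺κ) (val-≺ κ (pack _ κ·q↪κ f k))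
      ι-≺ (inj₂ p)       = ≺-trans (ιᴿ-≺ p) (+-closed ρ≺κ ∑r≺κ)

      hᴿ : ∀ i (p : Σ[ j ∈ I ] El (r j)) → Dec (i ≡ proj₁ p) → Ord ℓ
      hᴿ i (j , v) (yes _) = κ · q i + val (r j) v
      hᴿ i p       (no _)  = κ · fin 0 + ιᴿ p

      h : I → V → Ord ℓ
      h i (inj₁ (f , k)) = κ · val (q i) (f i) + ι (inj₁ (f , k))
      h i (inj₂ p)       = hᴿ i p (i ≟ proj₁ p)

      data Position (i : I) (x : V) : Set (lsuc ℓ) where
        below : ∀ c → c ≺ q i → h i x ≡ κ · c + ι x → Position i x
        top   : ∀ v → x ≡ inj₂ (i , v) → h i x ≡ κ · q i + val (r i) v → Position i x

      h-top : ∀ i v → h i (inj₂ (i , v)) ≡ κ · q i + val (r i) v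
      h-top i v = go (i ≟ i)
        where
        go : (d : Dec (i ≡ i)) → hᴿ i (i , v) d ≡ κ · q i + val (r i) v
        go (yes _)  = refl
        go (no i≢i) = ⊥-elim (i≢i refl)

      h-other : ∀ i p → ¬ i ≡ proj₁ p → h i (inj₂ p) ≡ κ · fin 0 + ιᴿ p
      h-other i p i≢j = go (i ≟ proj₁ p)
        where
        go : (d : Dec (i ≡ proj₁ p)) → hᴿ i p d ≡ κ · fin 0 + ιᴿ p
        go (yes i≡j) = ⊥-elim (i≢j i≡j)
        go (no _)    = refl

      locate : ∀ i x → Position i x
      locate i (inj₁ (f , k)) = below (val (q i) (f i)) (val-≺ (q i) (f i)) refl
      locate i (inj₂ (j , v)) = go (i ≟ j)
        where
        go : Dec (i ≡ j) → Position i (inj₂ (j , v))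
        go (yes refl) = top v refl (h-top i v)
        go (no i≢j)   = below (fin 0) (0≺q i) (h-other i (j , v) i≢j)

      h-≺ : ∀ i x → h i x ≺ κ · q i + r i
      h-≺ i x with locate i x
      ... | below c c≺ e = subst (_≺ κ · q i + r i) (sym e)
              (≺-≼-trans (·-intro κ (q i) c≺ (ι-≺ x)) (≼-+ˡ (κ · q i) (r i)))
      ... | top v _ e = subst (_≺ κ · q i + r i) (sym e) (+-monoʳ-≺ (κ · q i) (val-≺ (r i) v))

      below≺top : ∀ i x {c v} → c ≺ q i → κ · c + ι x ≺ κ · q i + v
      below≺top i x {v = v} c≺ = ≺-≼-trans (·-intro κ (q i) c≺ (ι-≺ x)) (≼-+ˡ (κ · q i) v)

      h⇒ι : ∀ i x y → h i x ≃ h i y → ι x ≃ ι y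
      h⇒ι i x y e with locate i x | locate i y
      ... | below c _ ex | below c′ _ ey =
              proj₂ (·-+-injective {π = c} {τ = c′} κ (ι-≺ x) (ι-≺ y) (subst₂ _≃_ ex ey e))
      ... | below c c≺ ex | top v _ ey =
              ⊥-elim (≼⇒⊁ (proj₂ (subst₂ _≃_ ex ey e)) (below≺top i x c≺))
      ... | top v _ ex | below c c≺ ey =
              ⊥-elim (≼⇒⊁ (proj₁ (subst₂ _≃_ ex ey e)) (below≺top i y c≺))
      ... | top v refl ex | top v′ refl ey =
              let e′ = subst₂ _≃_ ex ey e
              in place-cong em em (code-cong r i (+-cancelˡ-≼ (κ · q i) (proj₁ e′) , +-cancelˡ-≼ (κ · q i) (proj₂ e′)))

      ι⇒h : ∀ i x y → ι x ≃ ι y → h i x ≃ h i y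
      ι⇒h i (inj₁ (f , k)) (inj₁ (f′ , k′)) e =
        let (es , _) = pack-injective _ κ·q↪κ f f′ k k′
              (+-cancelˡ-≼ (ρ + ∑ r) (proj₁ e) , +-cancelˡ-≼ (ρ + ∑ r) (proj₂ e))
        in +-cong (·-monoʳ-≼ κ (proj₁ (es i)) , ·-monoʳ-≼ κ (proj₂ (es i))) e
      ι⇒h i (inj₁ x) (inj₂ p) e = ⊥-elim (≼⇒⊁ (≼-trans (≼-+ˡ (ρ + ∑ r) _) (proj₁ e)) (ιᴿ-≺ p))
      ι⇒h i (inj₂ p) (inj₁ x) e = ⊥-elim (≼⇒⊁ (≼-trans (≼-+ˡ (ρ + ∑ r) _) (proj₂ e)) (ιᴿ-≺ p))
      ι⇒h i (inj₂ (j , v)) (inj₂ (j′ , v′)) e =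
        let (j≡ , e′) = code-injective r j j′ (val-≺ (r j) v) (val-≺ (r j′) v′) (place-injective em em e)
        in same j≡ e′ (i ≟ j) (i ≟ j′)
        where
        same : j ≡ j′ → val (r j) v ≃ val (r j′) v′ → (d : Dec (i ≡ j)) (d′ : Dec (i ≡ j′)) →
               hᴿ i (j , v) d ≃ hᴿ i (j′ , v′) d′
        same _    e′ (yes _)   (yes _)    = +-cong ≃-refl e′
        same refl _  (yes i≡j) (no i≢j)   = ⊥-elim (i≢j i≡j)
        same refl _  (no i≢j)  (yes i≡j)  = ⊥-elim (i≢j i≡j)
        same _    _  (no _)    (no _)     = +-cong ≃-refl e

      _≋_ : Rel V ℓ
      x ≋ y = ι x ≈ ι y

      order : I → Rel V ℓ
      order i x y = h i x ≼ h i y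

      order-total : ∀ i → Total (order i)
      order-total i x y with compare (h i x) (h i y)
      ... | inj₁ p = inj₁ p
      ... | inj₂ p = inj₂ (≺⇒≼ p)

      order-isTotalOrder : ∀ i → IsTotalOrder _≋_ (order i)
      order-isTotalOrder i = record
        { isPartialOrder = record
          { isPreorder = record
            { isEquivalence = record
              { refl  = ≃⇒≈ ≃-refl
              ; sym   = λ e → ≃⇒≈ (≃-sym (≈⇒≃ e))
              ; trans = λ e e′ → ≃⇒≈ (≃-trans (≈⇒≃ e) (≈⇒≃ e′))
              }
            ; reflexive = λ {x} {y} e → proj₁ (ι⇒h i x y (≈⇒≃ e))
            ; trans = ≼-trans
            }
          ; antisym = λ {x} {y} p p′ → ≃⇒≈ (h⇒ι i x y (p , p′))
          }
        ; total = order-total i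
        }

      po : ∀ i → IsPartialOrder _≋_ (order i)
      po i = IsTotalOrder.isPartialOrder (order-isTotalOrder i)

      poset : Poset ℓ ℓ ℓ
      poset = record
        { Carrier = V ; _≈_ = _≋_ ; _≤_ = ⋂ order
        ; isPartialOrder = ⋂-isPartialOrder κ-initial closed 0≺κ po }

      Fibre : Π q → V → Set ℓ
      Fibre f x = Σ[ k ∈ El κ ] x ≡ inj₁ (f , k)

      Topmost : I → V → Set ℓ
      Topmost i x = Σ[ v ∈ El (r i) ] x ≡ inj₂ (i , v)

      Topmost-NotBelow : ∀ i f x y → Fibre f x → Topmost i y → ¬ order i y x
      Topmost-NotBelow i f x y (k , refl) (v , refl) p =
        ≼⇒⊁ (subst (_≼ h i x) (h-top i v) p) (below≺top i x (val-≺ (q i) (f i)))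

      Fibre-reflects : ∀ i {f f′ x x′} → Fibre f x → Fibre f′ x′ → order i x x′ →
                       val (q i) (f i) ≼ val (q i) (f′ i)
      Fibre-reflects i {f} {f′} (k , refl) (k′ , refl) p =
        ·-cancel-≼ {σ = ι (inj₁ (f , k))} κ (ι-≺ (inj₁ (f′ , k′))) p

      Big-Fibre : ∀ i {R : Rel V ℓ} → (∀ {x y} → R x y → order i x y) → ∀ f → Big R (Fibre f) κ
      Big-Fibre i R⇒order f = Big-map (λ k → inj₁ (f , k)) (λ k _ → k , refl)
        (λ k k′ _ _ p → +-cancelˡ-≼ (κ · val (q i) (f i)) (R⇒order p)) ≼-refl
        (Big-injective κ-initial (λ k → ι (inj₁ (f , k)))
          (λ k k′ e → proj₂ (pack-injective _ κ·q↪κ f f k k′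
            (+-cancelˡ-≼ (ρ + ∑ r) (proj₁ e) , +-cancelˡ-≼ (ρ + ∑ r) (proj₂ e))))
          (λ k → ι-≺ (inj₁ (f , k))))

      -- In the i-th order alone, one fibre for each value of the i-th coordinate suffices to reach
      -- `κ · q i`. The other coordinates are set to 0, which is available as each `q j` is
      -- positive.
      atᵢ : ∀ i → El (q i) → Π q
      atᵢ i c j = go (i ≟ j)
        where
        go : Dec (i ≡ j) → El (q j)
        go (yes refl) = c
        go (no _)     = proj₁ (find (q j) (0≺q j))

      atᵢ-i : ∀ i c → atᵢ i c i ≡ c
      atᵢ-i i c with i ≟ i
      ... | yes refl = refl
      ... | no i≢i   = ⊥-elim (i≢i refl)

      Big-Topmost : ∀ i → Big (order i) (Topmost i) (r i)
      Big-Topmost i = Big-map (λ v → inj₂ (i , v)) (λ v _ → v , refl)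
        (λ v v′ _ _ p → +-cancelˡ-≼ (κ · q i) (subst₂ _≼_ (h-top i v) (h-top i v′) p)) ≼-refl (Big-El (r i))

      Big-order : ∀ i → Big (order i) Full (κ · q i + r i)
      Big-order i = Big-+ (λ _ _ → tt) (λ _ _ → tt)
        (λ { x y (c , _ , Fx) Ty → Topmost-NotBelow i (atᵢ i c) x y Fx Ty })
        (Big-lex {Q = val-order (q i)} {T = Full} (λ c → Fibre (atᵢ i c)) (λ c → Big-Fibre i id (atᵢ i c))
          (λ {x} {x′} {c} {c′} Fx Fx′ p → subst₂ (val-order (q i)) (atᵢ-i i c) (atᵢ-i i c′) (Fibre-reflects i Fx Fx′ p))
          (Big-El (q i)))
        (Big-Topmost i)

      Len-order : ∀ i → Len (order i) Full (κ · q i + r i)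
      Len-order i = Len-rank (h i) (λ _ _ → ⋠⇒≻) (κ · q i + r i) (λ x _ → h-≺ i x)

      Remainder : V → Set ℓ
      Remainder x = Σ[ p ∈ _ ] x ≡ inj₂ p

      decoded : (b : El ρ) → Σ[ p ∈ Σ[ j ∈ I ] El (r j) ] val (∑ r) (φ b) ≃ codeᴿ p
      decoded b =
        let (j , β , β≺ , e) = decode r (val-≺ (∑ r) (φ b))
            (v , e′) = find (r j) β≺
        in (j , v) , ≃-trans e (code-cong r j (≃-sym e′))

      ιᴿ-decoded : ∀ b → ιᴿ (proj₁ (decoded b)) ≃ val ρ b
      ιᴿ-decoded b = go em
        where
        go : (d : Dec (Hit (codeᴿ (proj₁ (decoded b))))) → place d ≃ val ρ b
        go (yes (b′ , e)) = φ-injective b′ b (≃-trans e (≃-sym (proj₂ (decoded b))))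
        go (no ¬hit)      = ⊥-elim (¬hit (b , proj₂ (decoded b)))

      -- Within one copy, every other order compares by `ιᴿ`, and n ≥ 2 provides another order.
      -- Between different copies, the order that has the first one on top excludes the comparison.
      Remainder-reflects : ∀ p p′ → ⋂ order (inj₂ p) (inj₂ p′) → ιᴿ p ≼ ιᴿ p′
      Remainder-reflects p@(j , v) p′@(j′ , v′) le = go (j ≟ j′)
        where
        go : Dec (j ≡ j′) → ιᴿ p ≼ ιᴿ p′
        go (yes refl) =
          let (i , i≢j) = other j
          in +-cancelˡ-≼ (κ · fin 0) (subst₂ _≼_ (h-other i p i≢j) (h-other i p′ i≢j) (le i))
        go (no j≢j′) = ⊥-elim (≼⇒⊁ (subst₂ _≼_ (h-top j v) (h-other j p′ j≢j′) (le j))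
          (below≺top j (inj₂ p′) (0≺q j)))

      Big-Remainder : Big (⋂ order) Remainder ρ
      Big-Remainder = Big-map (λ b → inj₂ (proj₁ (decoded b))) (λ b _ → proj₁ (decoded b) , refl)
        (λ b b′ _ _ le → ≼-trans (proj₂ (ιᴿ-decoded b))
          (≼-trans (Remainder-reflects (proj₁ (decoded b)) (proj₁ (decoded b′)) le) (proj₁ (ιᴿ-decoded b′))))
        ≼-refl (Big-El ρ)

      Big-⋂ : ∀ {π} → Is⨂ q π → Big (⋂ order) Full (κ · π + ρ)
      Big-⋂ t = Big-+ (λ _ _ → tt) (λ _ _ → tt)
        (λ { x _ (f , _ , Fx) ((j , v) , refl) le → Topmost-NotBelow j f x _ Fx (v , refl) (le j) })
        (Big-lex {Q = Π-order q} {T = Full} Fibre (Big-Fibre zero (λ le → le zero))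
          (λ Fx Fx′ le i → Fibre-reflects i Fx Fx′ (le i)) (Big-Π _ t))
        Big-Remainder

      intersectionOfWPOs : IntersectionOfWPOs poset α
      intersectionOfWPOs = record
        { order = order
        ; isWPO = λ i → record
          { isPartialOrder = po i
          ; wellFounded = TotalOrder.⊏-wellFounded (order-isTotalOrder i) {order i} id (Len⇒WT (Len-order i))
          ; noInfiniteAntichain = λ (xs , anti) →
              [ anti 0 1 (λ ()) , anti 1 0 (λ ()) ] (order-total i (xs 0) (xs 1))
          }
        ; isLength = λ i → total⇒IsLength (order-isTotalOrder i)
            (Len-mono ⊆-refl (proj₂ (α≃ i)) (Len-order i)) (Big-mono ⊆-refl (proj₁ (α≃ i)) (Big-order i))
        ; intersection = λ x y → mk⇔ id id
        }

      exists : ∀ {π} → Is⨂ q π → Σ[ l ∈ Ord ℓ ] LinearIntersectionLength α l × κ · π + ρ ≼ l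
      exists t =
        let (l , u , c) = rankOf (Upper.wt-⋂ poset intersectionOfWPOs)
            ranking = record { rk = h zero ; rk-mono = λ le → le zero
                             ; rk-injective = λ {x} {y} e → ≃⇒≈ (h⇒ι zero x y e) }
        in l , (poset , (intersectionOfWPOs , order-total)
               , Exact⇒IsLength (Poset.isPartialOrder poset) ranking u c)
         , Big⇒Len⇒≼ (Big-⋂ t) u

    lowerBound : ∀ {π} → Is⨂ q π → ∀ {ρ} → ρ ≺ μ → Σ[ l ∈ Ord ℓ ] LinearIntersectionLength α l × κ · π + ρ ≼ l
    lowerBound t {ρ} ρ≺μ =
      let (φ , inj , φ-cong) = ↪-cong (≺μ⇒↪ ρ≺μ)
      in Example.exists ρ (≺-≼-trans ρ≺μ μ≼κ) φ inj φ-cong t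

    theorem : ∃[ π ] ∃[ μ ] Is⨂ q π × IsCardinalSuccessor (∑ r) μ
              × IsLeastStrictUpperBound (IntersectionLength α) (κ · π + μ)
              × IsLeastStrictUpperBound (LinearIntersectionLength α) (κ · π + μ)
    theorem =
        ϖ , μ , t , isCardinalSuccessor
      , (upper , λ β b → least-bound β λ l c → b l (forget l c))
      , (λ l c → upper l (forget l c)) , least-bound
      where
      ϖ = proj₁ (⨂ q)
      t = proj₂ (⨂ q)
      upper = IntersectionLength⇒≺ t
      forget : ∀ l → LinearIntersectionLength α l → IntersectionLength α l
      forget l (P , (D , _) , isLen) = P , D , isLen
      least-bound : ∀ β → (∀ l → LinearIntersectionLength α l → l < β) → κ · ϖ + μ ≤ β
      least-bound β b = un≼ (+-lub {β = μ}
        -- Here `∑ r` serves as some element of μ: it shows that already `κ · ϖ` is below β.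
        (λ i → ≺-trans (!-≺ i) (≼-≺-trans (≼-+ˡ (κ · ϖ) (∑ r)) (reach ⟨ proj₂ (proj₁ isCardinalSuccessor) ⟩)))
        (λ j → reach (!-≺ j)))
        where
        reach : ∀ {ρ} → ρ ≺ μ → κ · ϖ + ρ ≺ β
        reach p = let (l , c , q) = lowerBound t p in ≼-≺-trans q ⟨ b l c ⟩

theorem1p1 : (∀ {a} → ExcludedMiddle a) →
    ∀ {ℓ} (n : ℕ) → 2 ℕ.≤ n →
    (α q r : Vector (Ord ℓ) n) (κ : Ord ℓ) →
    (∀ i → ω ≤ α i) →
    (∀ i → IsCardinality (α i) κ) →
    (∀ i → α i ≈ κ · q i + r i) →
    (∀ i → r i < κ) →
    ∃[ π ] ∃[ μ ]
    Is⨂ q π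
    × IsCardinalSuccessor (∑ r) μ
    × IsLeastStrictUpperBound (IntersectionLength α) (κ · π + μ)
    × IsLeastStrictUpperBound (LinearIntersectionLength α) (κ · π + μ)
theorem1p1 em (suc (suc m)) (ℕ.s≤s (ℕ.s≤s ℕ.z≤n)) α q r κ ω≤α card α≈ r<κ =
  Classical.Lower.theorem em α q r κ ω≤α card α≈ r<κ
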